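{- For each integer $k\ge 2$, the decision version of Fair $k$-Division Under Conflicts is strongly NP-complete when restricted to bipartite conflict graphs.
   Context: A partial $k$-coloring of a graph $G=(V,E)$ is a sequence $(X_1,\dots,X_k)$ of $k$ pairwise disjoint independent sets of $G$. Given profit functions $p_1,\dots,p_k:V\to\mathbb{Z}_+$, write $p_j(X)=\sum_{v\in X}p_j(v)$; the satisfaction level of $(X_1,\dots,X_k)$ is $\min_j p_j(X_j)$. The decision version of Fair $k$-Division Under Conflicts: given a graph $G$, $p_1,\dots,p_k$ and $q\in\mathbb{Z}_+$, decide whether $G$ has a partial $k$-coloring with satisfaction level at least $q$. Strong NP-completeness means NP-completeness even when all numbers in the input are bounded by a polynomial in the input size. -}

module Defs where

open import Data.Bool using (Bool; true; false; T)
open import Data.Fin using (Fin; zero; suc)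
open import Data.Fin.Subset using (Subset; _∈_; _∩_; ∁; Empty)
open import Data.Fin.Subset.Properties using (_∈?_)
open import Data.List using (List; []; _∷_; _++_; map; length; sum; filter; allFin; tabulate; concat; replicate)
open import Data.List.Relation.Unary.All using (All)
open import Data.Maybe using (Maybe; just; nothing)
open import Data.Nat using (ℕ; zero; suc; _+_; _*_; _≤_; _⊓_)
open import Data.Nat.Binary using (ℕᵇ; zero; 2[1+_]; 1+[2_]; fromℕ)
open import Data.Product using (Σ; ∃; _×_; _,_; proj₁; proj₂)
open import Data.Vec as Vec using (Vec; []; _∷_)
open import Function using (_∘_; _⇔_)
open import Relation.Binary.PropositionalEquality using (_≡_; _≢_)
open import Relation.Nullary using (¬_)

------------------------------------------------------------------------
-- Deterministic multi-tape Turing machines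

Bits : Set
Bits = List Bool

data Symbol (a : ℕ) : Set where
  blank : Symbol a
  bit   : Bool → Symbol a
  aux   : Fin a → Symbol a

data Move : Set where
  left stay right : Move

-- A two-way infinite tape, almost everywhere blank.  Both lists are ordered
-- by increasing distance from the head; cells beyond their ends are blank.
record Tape (a : ℕ) : Set where
  constructor tape
  field
    leftOf  : List (Symbol a)
    scanned : Symbol a
    rightOf : List (Symbol a)
open Tape public

write : ∀ {a} → Symbol a → Tape a → Tape a
write s (tape ls _ rs) = tape ls s rs

move : ∀ {a} → Move → Tape a → Tape a
move left  (tape []       s rs)       = tape [] blank (s ∷ rs)
move left  (tape (l ∷ ls) s rs)       = tape ls l (s ∷ rs)
move stay  t                          = t
move right (tape ls       s [])       = tape (s ∷ ls) blank []
move right (tape ls       s (r ∷ rs)) = tape (s ∷ ls) r rs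

record TM : Set where
  field
    auxSymbols : ℕ
    states     : ℕ
    workTapes  : ℕ
    start      : Fin states
    -- `nothing` means that the machine halts.
    δ          : Fin states → Vec (Symbol auxSymbols) (suc workTapes) →
                 Maybe (Fin states × Vec (Symbol auxSymbols × Move) (suc workTapes))

module _ (M : TM) where
  open TM M

  record Config : Set where
    constructor config
    field
      state : Fin states
      tapes : Vec (Tape auxSymbols) (suc workTapes)

  step : Config → Maybe Config
  step (config s ts) with δ s (Vec.map scanned ts)
  ... | nothing         = nothing
  ... | just (s′ , act) =
        just (config s′ (Vec.zipWith (λ (c , m) t → move m (write c t)) act ts))

  inputTape : Bits → Tape auxSymbols
  inputTape []       = tape [] blank []
  inputTape (b ∷ bs) = tape [] (bit b) (map bit bs)

  initial : Bits → Config
  initial w = config start (inputTape w ∷ Vec.replicate workTapes (tape [] blank []))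

  bitPrefix : List (Symbol auxSymbols) → Bits
  bitPrefix (bit b ∷ ss) = b ∷ bitPrefix ss
  bitPrefix _            = []

  -- The output is the maximal bit string on the first tape that begins at
  -- the head and extends to the right.
  output : Config → Bits
  output (config _ (t ∷ _)) = bitPrefix (scanned t ∷ rightOf t)

  -- HaltsWithin t c d : started in c, the machine halts in d after at most
  -- t steps.
  data HaltsWithin : ℕ → Config → Config → Set where
    halted : ∀ {t c} → step c ≡ nothing → HaltsWithin t c c
    next   : ∀ {t c c′ d} → step c ≡ just c′ → HaltsWithin t c′ d →
             HaltsWithin (suc t) c d

------------------------------------------------------------------------
-- Polynomial time, NP, and strong NP-completeness

-- Coefficients, constant term first.
Polynomial : Set
Polynomial = List ℕ

eval : Polynomial → ℕ → ℕ
eval []       x = 0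
eval (a ∷ as) x = a + x * eval as x

PolyTime : (Bits → Bits) → Set
PolyTime f = Σ TM λ M → Σ Polynomial λ p → ∀ w →
  ∃ λ c → HaltsWithin M (eval p (length w)) (initial M w) c × output M c ≡ f w

Language : Set₁
Language = Bits → Set

-- Self-delimiting form b₁…bₘ ↦ 1b₁…1bₘ0.
delimit : Bits → Bits
delimit []       = false ∷ []
delimit (b ∷ bs) = true ∷ b ∷ delimit bs

⟨_,_⟩ : Bits → Bits → Bits
⟨ x , y ⟩ = delimit x ++ y

-- Polynomially long certificates checked by a polynomial-time verifier.
InNP : Language → Set
InNP L = Σ (Bits → Bool) λ verify → PolyTime (λ w → verify w ∷ []) ×
  Σ Polynomial λ p → ∀ x →
    L x ⇔ (∃ λ y → length y ≤ eval p (length x) × verify ⟨ x , y ⟩ ≡ true)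

_≤ᵖ_ : Language → Language → Set
L ≤ᵖ L′ = Σ (Bits → Bits) λ f → PolyTime f × (∀ x → L x ⇔ L′ (f x))

NPHard : Language → Set₁
NPHard L = (L′ : Language) → InNP L′ → L′ ≤ᵖ L

NPComplete : Language → Set₁
NPComplete L = InNP L × NPHard L

record DecisionProblem : Set₁ where
  field
    Instance : Set
    encode   : Instance → Bits
    numbers  : Instance → List ℕ
    Yes      : Instance → Set

module _ (Π : DecisionProblem) where
  open DecisionProblem Π

  language : Language
  language w = ∃ λ I → encode I ≡ w × Yes I

  restrict : (Instance → Set) → DecisionProblem
  restrict P = record
    { Instance = Σ Instance P
    ; encode   = encode ∘ proj₁
    ; numbers  = numbers ∘ proj₁
    ; Yes      = Yes ∘ proj₁
    }

  NumbersBounded : Polynomial → Instance → Set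
  NumbersBounded p I = All (_≤ eval p (length (encode I))) (numbers I)

StronglyNPComplete : DecisionProblem → Set₁
StronglyNPComplete Π = NPComplete (language Π) ×
  Σ Polynomial λ p → NPComplete (language (restrict Π (NumbersBounded Π p)))

------------------------------------------------------------------------
-- Graphs

record Graph (n : ℕ) : Set where
  field
    adjacent  : Fin n → Fin n → Bool
    symmetric : ∀ u v → adjacent u v ≡ adjacent v u
    loopless  : ∀ v → adjacent v v ≡ false
open Graph public

Independent : ∀ {n} → Graph n → Subset n → Set
Independent G X = ∀ u v → u ∈ X → v ∈ X → ¬ T (adjacent G u v)

Bipartite : ∀ {n} → Graph n → Set
Bipartite G = ∃ λ A → Independent G A × Independent G (∁ A)

record PartialColoring {n : ℕ} (k : ℕ) (G : Graph n) : Set where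
  field
    X           : Fin k → Subset n
    independent : ∀ j → Independent G (X j)
    disjoint    : ∀ i j → i ≢ j → Empty (X i ∩ X j)

------------------------------------------------------------------------
-- Fair k-Division Under Conflicts

profit : ∀ {n} → (Fin n → ℕ) → Subset n → ℕ
profit {n} p X = sum (map p (filter (_∈? X) (allFin n)))

-- The value at k = 0 is a junk value.
minimum : ∀ {k} → (Fin k → ℕ) → ℕ
minimum {zero}        f = 0
minimum {suc zero}    f = f zero
minimum {suc (suc k)} f = f zero ⊓ minimum (f ∘ suc)

satisfaction : ∀ {n k} {G : Graph n} →
               (Fin k → Fin n → ℕ) → PartialColoring k G → ℕ
satisfaction p C = minimum (λ j → profit (p j) (PartialColoring.X C j))

record FairInstance (k : ℕ) : Set where
  field
    n : ℕ
    G : Graph n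
    p : Fin k → Fin n → ℕ
    q : ℕ

-- ℕᵇ is bijective base 2, least significant digit first: the bit 0 stands
-- for the digit 1 and the bit 1 for the digit 2.  The length is
-- logarithmic in the number, as for ordinary binary.
digits : ℕᵇ → Bits
digits zero     = []
digits 2[1+ b ] = true  ∷ digits b
digits 1+[2 b ] = false ∷ digits b

encodeNumber : ℕ → Bits
encodeNumber = delimit ∘ digits ∘ fromℕ

-- The number of vertices is written in unary; this does not affect the
-- order of magnitude of the size, as n² adjacency bits follow.
encodeGraph : ∀ {n} → Graph n → Bits
encodeGraph {n} G = replicate n true ++ false ∷
  concat (tabulate λ u → tabulate λ v → adjacent G u v)

FairDivision : ℕ → DecisionProblem
FairDivision k = record
  { Instance = FairInstance k
  ; encode   = λ I → encodeGraph (G I) ++ concat (map encodeNumber (inputNumbers I))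
  ; numbers  = inputNumbers
  ; Yes      = λ I → Σ (PartialColoring k (G I)) λ C → q I ≤ satisfaction (p I) C
  }
  where
  open FairInstance
  inputNumbers : FairInstance k → List ℕ
  inputNumbers I = q I ∷ concat (tabulate λ j → tabulate (p I j))

BipartiteFairDivision : ℕ → DecisionProblem
BipartiteFairDivision k = restrict (FairDivision k) (Bipartite ∘ FairInstance.G)

{-# OPTIONS --safe #-}

-- Hardness.  A run of the verifier of a language in NP is a tableau whose
-- cell (t, d) holds the state and the scanned symbols at time t and the symbols
-- at distance d from the heads.  All constraints on a tableau concern at most
-- two cells, so the tableaux are the cliques with one vertex per cell among the
-- triples (t, d, content).  A clique of size K among N vertices becomes a fair
-- division in the bipartite graph that joins each vertex to the ordered pairs
-- containing it: the second colour needs K vertices, and the first needs the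
-- other N - K together with K² compatible pairs not meeting them.
--
-- Membership.  The certificate lists one side of a bipartition and the colour
-- classes.  Profits are added column by column in binary, so that only small
-- carries have to be stored.
--
-- Reduction and verifier are primitive recursive functions of small numbers.
-- A number is stored as a head position on a marked tape, and a recursion whose
-- steps grow by polynomially bounded amounts runs in polynomial time.

module Submission where

open import Data.Bool using (Bool; true; false; T; if_then_else_; _∧_; _∨_; not)
open import Data.Bool.ListAction using (and)
import Data.Bool.Properties as Boolₚ
open import Data.Empty using (⊥; ⊥-elim)
open import Data.Fin as Fin using (Fin; zero; suc; toℕ)
import Data.Fin.Properties as Finₚ
open import Data.Fin.Subset using (Subset; _∈_; _∩_; ∁; Empty)
open import Data.Fin.Subset.Properties using (_∈?_; x∈p∩q⁻; x∈∁p⇒x∉p; x∈p∩q⁺)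
open import Data.Integer using (ℤ; -[1+_]) renaming (+_ to ⁺_)
open import Data.List as List using (List; []; _∷_; _++_; length; map; concat; applyUpTo; replicate; tabulate; take; drop)
import Data.List.Properties as Listₚ
open import Data.List.Relation.Unary.All using (All; []; _∷_)
import Data.List.Relation.Unary.All.Properties as Allₚ
open import Data.Maybe as Maybe using (Maybe; just; nothing; maybe)
open import Data.Nat
open import Data.Nat.Binary as ℕᵇ using (ℕᵇ; zero; 2[1+_]; 1+[2_])
import Data.Nat.Binary.Properties as ℕᵇₚ
open import Data.Nat.Properties
open import Data.Nat.Tactic.RingSolver using (solve-∀)
open import Data.Product using (Σ; ∃; _×_; _,_; proj₁; proj₂)
open import Data.Sum using (_⊎_; inj₁; inj₂; [_,_]′)
open import Data.Unit using (⊤; tt)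
open import Data.Vec as Vec using (Vec; []; _∷_; lookup)
import Data.Vec.Properties as Vecₚ
open import Function using (_∘_; id; _⇔_; mk⇔; module Equivalence)
open import Relation.Binary.PropositionalEquality
open import Relation.Nullary using (Dec; ¬_; yes; no; contradiction)
open import Defs

-- Tapes as functions of the offset from the head

-- Every cell of the tableau repeats the state and the scanned symbols, so an old cell alone
-- determines the head moves; together with offsets taken from the heads this leaves only two cells
-- in each rule. A clique has exactly K vertices, whereas fair division knows only lower bounds. The
-- second colour limits the vertices of the first from above. The profit M = 1 + N² of a vertex,
-- more than all pairs together can bring, limits them from below. Since all colours share one
-- threshold q, private vertices supply what the other colours lack. A register holds its number in
-- unary, while profits may be exponential in the length of the word. This rules out forming sums of
-- profits and leads to the comparison by digits. For the strong version the identity serves as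
-- polynomial: the n² adjacency bits of the constructed graph already outweigh all its numbers. A
-- word belongs to the language if some instance encodes to it. Uniqueness of this instance is not
-- proved; instead the verifier, which sees only the word, makes all instances with the same
-- encoding equivalent.

nth : ∀ {A : Set} → A → List A → ℕ → A
nth d []       i       = d
nth d (x ∷ xs) zero    = x
nth d (x ∷ xs) (suc i) = nth d xs i

nth-toList : ∀ {A : Set} {n} (d : A) (v : Vec A n) j → nth d (Vec.toList v) (toℕ j) ≡ lookup v j
nth-toList d (x ∷ v) zero    = refl
nth-toList d (x ∷ v) (suc j) = nth-toList d v j

-- Reading a tape as a function of the offset identifies tapes that differ only by blanks stored at
-- the ends of the two lists.
at : ∀ {a} → Tape a → ℤ → Symbol a
at t (⁺ zero)  = scanned t
at t (⁺ suc i) = nth blank (rightOf t) i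
at t -[1+ i ]  = nth blank (leftOf t) i

shift : Move → ℤ → ℤ
shift left  (⁺ zero)     = -[1+ 0 ]
shift left  (⁺ suc i)    = ⁺ i
shift left  -[1+ i ]     = -[1+ suc i ]
shift stay  z            = z
shift right (⁺ i)        = ⁺ suc i
shift right -[1+ zero ]  = ⁺ 0
shift right -[1+ suc i ] = -[1+ i ]

at-move : ∀ {a} m (t : Tape a) z → at (move m t) z ≡ at t (shift m z)
at-move left  (tape [] s rs)       (⁺ zero)        = refl
at-move left  (tape [] s rs)       (⁺ suc zero)    = refl
at-move left  (tape [] s rs)       (⁺ suc (suc i)) = refl
at-move left  (tape [] s rs)       -[1+ i ]        = refl
at-move left  (tape (l ∷ ls) s rs) (⁺ zero)        = refl
at-move left  (tape (l ∷ ls) s rs) (⁺ suc zero)    = refl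
at-move left  (tape (l ∷ ls) s rs) (⁺ suc (suc i)) = refl
at-move left  (tape (l ∷ ls) s rs) -[1+ i ]        = refl
at-move stay  t                    z               = refl
at-move right (tape ls s [])       (⁺ zero)        = refl
at-move right (tape ls s [])       (⁺ suc i)       = refl
at-move right (tape ls s [])       -[1+ zero ]     = refl
at-move right (tape ls s [])       -[1+ suc i ]    = refl
at-move right (tape ls s (r ∷ rs)) (⁺ zero)        = refl
at-move right (tape ls s (r ∷ rs)) (⁺ suc i)       = refl
at-move right (tape ls s (r ∷ rs)) -[1+ zero ]     = refl
at-move right (tape ls s (r ∷ rs)) -[1+ suc i ]    = refl

-- The difference p - v.
rel : ℕ → ℕ → ℤ
rel p       zero    = ⁺ p
rel zero    (suc v) = -[1+ v ]
rel (suc p) (suc v) = rel p v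

rel-refl : ∀ v → rel v v ≡ ⁺ 0
rel-refl zero    = refl
rel-refl (suc v) = rel-refl v

shift-right-rel : ∀ p v → shift right (rel p (suc v)) ≡ rel p v
shift-right-rel zero    zero    = refl
shift-right-rel zero    (suc v) = refl
shift-right-rel (suc p) zero    = refl
shift-right-rel (suc p) (suc v) = shift-right-rel p v

shift-left-rel : ∀ p v → shift left (rel p v) ≡ rel p (suc v)
shift-left-rel zero    zero    = refl
shift-left-rel (suc p) zero    = refl
shift-left-rel zero    (suc v) = refl
shift-left-rel (suc p) (suc v) = shift-left-rel p v

at-write-rel : ∀ {a} (t : Tape a) s {p v} → p ≢ v → at (write s t) (rel p v) ≡ at t (rel p v)
at-write-rel t s {zero}  {zero}  p≢v = contradiction refl p≢v
at-write-rel t s {suc p} {zero}  p≢v = refl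
at-write-rel t s {zero}  {suc v} p≢v = refl
at-write-rel t s {suc p} {suc v} p≢v = at-write-rel t s (p≢v ∘ cong suc)

at-write-here : ∀ {a} (t : Tape a) s v → at (write s t) (rel v v) ≡ s
at-write-here t s v = cong (at (write s t)) (rel-refl v)

-- Finite types

record Finite (A : Set) : Set where
  field
    card    : ℕ
    code     : A → Fin card
    decode     : Fin card → A
    decode∘code : ∀ x → decode (code x) ≡ x
open Finite

⊤-finite : Finite ⊤
⊤-finite = record { card = 1 ; code = λ _ → zero ; decode = λ _ → tt ; decode∘code = λ _ → refl }

retract-finite : ∀ {A B : Set} (f : A → B) (g : B → A) → (∀ x → g (f x) ≡ x) → Finite B → Finite A
retract-finite f g gf F = record
  { card = card F ; code = code F ∘ f ; decode = g ∘ decode F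
  ; decode∘code = λ x → trans (cong g (decode∘code F (f x))) (gf x) }

⊎-finite : ∀ {A B : Set} → Finite A → Finite B → Finite (A ⊎ B)
⊎-finite {A} {B} FA FB = record
  { card = card FA + card FB
  ; code = Fin.join (card FA) (card FB) ∘ Data.Sum.map (code FA) (code FB)
  ; decode = Data.Sum.map (decode FA) (decode FB) ∘ Fin.splitAt (card FA)
  ; decode∘code = λ x → trans (cong (Data.Sum.map (decode FA) (decode FB)) (Finₚ.splitAt-join (card FA) (card FB) (Data.Sum.map (code FA) (code FB) x))) (inv x)
  }
  where
  inv : ∀ x → Data.Sum.map (decode FA) (decode FB) (Data.Sum.map (code FA) (code FB) x) ≡ x
  inv (inj₁ a) = cong inj₁ (decode∘code FA a)
  inv (inj₂ b) = cong inj₂ (decode∘code FB b)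

×-finite : ∀ {A B : Set} → Finite A → Finite B → Finite (A × B)
×-finite FA FB = record
  { card = card FA * card FB
  ; code = λ (a , b) → Fin.combine (code FA a) (code FB b)
  ; decode = λ i → let (a , b) = Fin.remQuot (card FB) i in decode FA a , decode FB b
  ; decode∘code = λ (a , b) → trans
      (cong (λ (i , j) → decode FA i , decode FB j) (Finₚ.remQuot-combine (code FA a) (code FB b)))
      (cong₂ _,_ (decode∘code FA a) (decode∘code FB b))
  }

Fin-finite : ∀ n → Finite (Fin n)
Fin-finite n = record { card = n ; code = id ; decode = id ; decode∘code = λ _ → refl }

Maybe-finite : ∀ {A : Set} → Finite A → Finite (Maybe A)
Maybe-finite F = retract-finite (maybe inj₂ (inj₁ tt)) [ (λ _ → nothing) , just ]′
  (λ { nothing → refl ; (just _) → refl }) (⊎-finite ⊤-finite F)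

Bool-finite : Finite Bool
Bool-finite = retract-finite (λ b → if b then inj₁ tt else inj₂ tt) [ (λ _ → true) , (λ _ → false) ]′
  (λ { true → refl ; false → refl }) (⊎-finite ⊤-finite ⊤-finite)

Vec-finite : ∀ {A : Set} n → Finite A → Finite (Vec A n)
Vec-finite zero    F = retract-finite (λ _ → tt) (λ _ → []) (λ { [] → refl }) ⊤-finite
Vec-finite (suc n) F = retract-finite (λ { (x ∷ xs) → x , xs }) (λ (x , xs) → x ∷ xs)
  (λ { (x ∷ xs) → refl }) (×-finite F (Vec-finite n F))

Symbol-finite : ∀ a → Finite (Symbol a)
Symbol-finite a = retract-finite
  (λ { blank → inj₁ tt ; (bit b) → inj₂ (inj₁ b) ; (aux i) → inj₂ (inj₂ i) })
  [ (λ _ → blank) , [ bit , aux ]′ ]′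
  (λ { blank → refl ; (bit b) → refl ; (aux i) → refl })
  (⊎-finite ⊤-finite (⊎-finite Bool-finite (Fin-finite a)))

-- Counter programs

-- The registers of a counter program are the head positions on marked tapes,
-- so that a test may look at the scanned cell.  The input is stored on the
-- tape of register 0, its i-th bit in cell 1+i.
Sym : Set
Sym = Symbol 1

mark : Sym
mark = aux zero

cell : Bits → ℕ → ℕ → Sym
cell w i       zero    = mark
cell w zero    (suc p) = nth blank (map bit w) p
cell w (suc i) (suc p) = blank

data Prog : Set where
  skip  : Prog
  inc   : ℕ → Prog
  dec   : ℕ → Prog
  emit  : Bool → Prog
  _⨾_   : Prog → Prog → Prog
  ite   : ℕ → (Sym → Bool) → Prog → Prog → Prog
  while : ℕ → Prog → Prog

infixr 5 _⨾_

record St : Set where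
  constructor st
  field
    regs : ℕ → ℕ
    out  : Bits
open St

infix 4 _≈_
-- The registers form a function, so states are compared pointwise. The base constructors of `Run`
-- end up to `≈`, which lets states be rewritten freely.
_≈_ : St → St → Set
s ≈ s′ = (∀ i → regs s i ≡ regs s′ i) × out s ≡ out s′

opaque
  setReg : ℕ → ℕ → St → St
  setReg i v s = st (λ j → if j ≡ᵇ i then v else regs s j) (out s)

-- Output is prepended because the result of a machine is read from the head to the right: a head
-- that only moves left while writing ends at the right place.
push : Bits → St → St
push o s = st (regs s) (o ++ out s)

-- The mark stands in cell 0 of every register tape and nowhere else, so the scanned symbol tells
-- whether the register is 0.
nonzero : Sym → Bool
nonzero (aux _) = false
nonzero _       = true

-- Run w P s t s′ : P takes s to s′ in at most t machine steps.
data Run (w : Bits) : Prog → St → ℕ → St → Set where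
  skipR  : ∀ {s s′} → s ≈ s′ → Run w skip s 1 s′
  incR   : ∀ {i s s′} → setReg i (suc (regs s i)) s ≈ s′ → Run w (inc i) s 1 s′
  decR   : ∀ {i s s′ v} → regs s i ≡ suc v → setReg i v s ≈ s′ → Run w (dec i) s 1 s′
  emitR  : ∀ {b s s′} → push (b ∷ []) s ≈ s′ → Run w (emit b) s 2 s′
  seqR   : ∀ {P Q s s′ s″ t t′} → Run w P s t s′ → Run w Q s′ t′ s″ → Run w (P ⨾ Q) s (t + t′) s″
  thenR  : ∀ {i f P Q s s′ t} → f (cell w i (regs s i)) ≡ true → Run w P s t s′ → Run w (ite i f P Q) s (suc t) s′
  elseR  : ∀ {i f P Q s s′ t} → f (cell w i (regs s i)) ≡ false → Run w Q s t s′ → Run w (ite i f P Q) s (suc t) s′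
  doneR  : ∀ {i P s s′} → regs s i ≡ 0 → s ≈ s′ → Run w (while i P) s 1 s′
  againR : ∀ {i P s s′ s″ t t′ v} → regs s i ≡ suc v → Run w P s t s′ → Run w (while i P) s′ t′ s″ →
           Run w (while i P) s (suc (t + t′)) s″
  weaken : ∀ {P s s′ t t′} → t ≤ t′ → Run w P s t s′ → Run w P s t′ s′

-- Only registers that are tested count. Moving a register without a tape leaves the machine
-- unchanged, and `Rep` says nothing about such a register.
width : Prog → ℕ
width (P ⨾ Q)       = width P ⊔ width Q
width (ite i f P Q) = suc i ⊔ (width P ⊔ width Q)
width (while i P)   = suc i ⊔ width P
width _             = 0

-- `emit` has two positions because a machine step writes before it moves, while the output head has
-- to move left first. Tests occupy the extra position `nothing`.
Pos : Prog → Set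
Pos (emit b)      = Bool
Pos (P ⨾ Q)       = Pos P ⊎ Pos Q
Pos (ite i f P Q) = Maybe (Pos P ⊎ Pos Q)
Pos (while i P)   = Maybe (Pos P)
Pos _             = ⊤

Pos-finite : ∀ P → Finite (Pos P)
Pos-finite skip          = ⊤-finite
Pos-finite (inc i)       = ⊤-finite
Pos-finite (dec i)       = ⊤-finite
Pos-finite (emit b)      = Bool-finite
Pos-finite (P ⨾ Q)       = ⊎-finite (Pos-finite P) (Pos-finite Q)
Pos-finite (ite i f P Q) = Maybe-finite (⊎-finite (Pos-finite P) (Pos-finite Q))
Pos-finite (while i P)   = Maybe-finite (Pos-finite P)

entry : ∀ P → Pos P
entry skip          = tt
entry (inc i)       = tt
entry (dec i)       = tt
entry (emit b)      = false
entry (P ⨾ Q)       = inj₁ (entry P)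
entry (ite i f P Q) = nothing
entry (while i P)   = nothing

-- What to do on each tape: tape 0 is the output, tape 1+i is register i.
Command : Set
Command = ℕ → Sym → Sym × Move

idle : Command
idle _ s = s , stay

onReg : ℕ → Move → Command
onReg i m zero    s = s , stay
onReg i m (suc j) s = s , (if j ≡ᵇ i then m else stay)

onOut : (Sym → Sym × Move) → Command
onOut f zero    s = f s
onOut f (suc j) s = s , stay

-- The next position `nothing` is the exit of the program. In the last clause the exit of the loop
-- body becomes, under `just`, the test position of the loop.
ctrl : ∀ P → Pos P → (ℕ → Sym) → Command × Maybe (Pos P)
ctrl skip          _               σ = idle , nothing
ctrl (inc i)       _               σ = onReg i right , nothing
ctrl (dec i)       _               σ = onReg i left , nothing
ctrl (emit b)      false           σ = onOut (_, left) , just true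
ctrl (emit b)      true            σ = onOut (λ _ → bit b , stay) , nothing
ctrl (P ⨾ Q)       (inj₁ p)        σ = proj₁ (ctrl P p σ) , just (maybe inj₁ (inj₂ (entry Q)) (proj₂ (ctrl P p σ)))
ctrl (P ⨾ Q)       (inj₂ q)        σ = proj₁ (ctrl Q q σ) , Maybe.map inj₂ (proj₂ (ctrl Q q σ))
ctrl (ite i f P Q) nothing         σ = idle , just (just (if f (σ i) then inj₁ (entry P) else inj₂ (entry Q)))
ctrl (ite i f P Q) (just (inj₁ p)) σ = proj₁ (ctrl P p σ) , Maybe.map (just ∘ inj₁) (proj₂ (ctrl P p σ))
ctrl (ite i f P Q) (just (inj₂ q)) σ = proj₁ (ctrl Q q σ) , Maybe.map (just ∘ inj₂) (proj₂ (ctrl Q q σ))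
ctrl (while i P)   nothing         σ = idle , (if nonzero (σ i) then just (just (entry P)) else nothing)
ctrl (while i P)   (just p)        σ = proj₁ (ctrl P p σ) , just (proj₂ (ctrl P p σ))

-- The Turing machine of a counter program

module Machine (P₀ : Prog) where

  -- Registers 0 and 1 always get tapes: they receive the input and its length.
  W : ℕ
  W = 2 + width P₀

  S : Set
  S = Maybe (Maybe (Maybe (Pos P₀)))

  pattern marking = nothing
  pattern copying = just nothing
  pattern finished = just (just nothing)
  pattern running p = just (just (just p))

  S-finite : Finite S
  S-finite = Maybe-finite (Maybe-finite (Maybe-finite (Pos-finite P₀)))

  regSym : Vec Sym (suc W) → ℕ → Sym
  regSym (_ ∷ ss) = nth blank (Vec.toList ss)

  markAll : Command
  markAll zero          s = s , stay
  markAll (suc zero)    s = mark , right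
  markAll (suc (suc _)) s = mark , stay

  -- The input is erased from tape 0, which is to become the output tape. Register 0 takes over the
  -- bits, and the head of register 1 counts them.
  copy : Bool → Command
  copy b zero                s = blank , right
  copy b (suc zero)          s = bit b , right
  copy b (suc (suc zero))    s = s , right
  copy b (suc (suc (suc _))) s = s , stay

  control : S → Vec Sym (suc W) → Maybe (S × Command)
  control marking     σ           = just (copying , markAll)
  control copying     (bit b ∷ σ) = just (copying , copy b)
  control copying     (_ ∷ σ)     = just (running (entry P₀) , idle)
  control (running p) σ           = let (c , p′) = ctrl P₀ p (regSym σ) in
                                    just (maybe (λ q → running q) finished p′ , c)
  control finished    σ           = nothing

  acts : Command → Vec Sym (suc W) → Vec (Sym × Move) (suc W)
  acts c σ = Vec.tabulate λ j → c (toℕ j) (lookup σ j)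

  M : TM
  M = record
    { auxSymbols = 1
    ; states     = card S-finite
    ; workTapes  = W
    ; start      = code S-finite marking
    ; δ          = λ s σ → Maybe.map (λ (s′ , c) → code S-finite s′ , acts c σ) (control (decode S-finite s) σ)
    }

  Tapes : Set
  Tapes = Vec (Tape 1) (suc W)

  cfg : S → Tapes → Config M
  cfg s ts = config (code S-finite s) ts

  act : Sym × Move → Tape 1 → Tape 1
  act (s , m) t = move m (write s t)

  perform : Command → Tapes → Tapes
  perform c ts = Vec.zipWith act (acts c (Vec.map scanned ts)) ts

  lookup-perform : ∀ c ts j →
                   lookup (perform c ts) j ≡ act (c (toℕ j) (scanned (lookup ts j))) (lookup ts j)
  lookup-perform c ts j
    rewrite Vecₚ.lookup-zipWith act j (acts c (Vec.map scanned ts)) ts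
          | Vecₚ.lookup∘tabulate (λ j → c (toℕ j) (lookup (Vec.map scanned ts) j)) j
          | Vecₚ.lookup-map j scanned ts = refl

  step-cfg : ∀ {s s′ c} ts → control s (Vec.map scanned ts) ≡ just (s′ , c) →
             step M (cfg s ts) ≡ just (cfg s′ (perform c ts))
  step-cfg {s} ts eq rewrite decode∘code S-finite s | eq = refl

  step-finished : ∀ ts → step M (cfg finished ts) ≡ nothing
  step-finished ts rewrite decode∘code S-finite finished = refl

  data Reach : ℕ → Config M → Config M → Set where
    here : ∀ {t c} → Reach t c c
    next : ∀ {t c c′ d} → step M c ≡ just c′ → Reach t c′ d → Reach (suc t) c d

  reach-++ : ∀ {t t′ c d e} → Reach t c d → Reach t′ d e → Reach (t + t′) c e
  reach-++ {zero}  here        r = r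
  reach-++ {suc t} here        r = weak r
    where
    weak : ∀ {t t′ c d} → Reach t′ c d → Reach (t + t′) c d
    weak here = here
    weak {t} {suc t′} (next e r) rewrite +-suc t t′ = next e (weak r)
  reach-++ (next e r) r′ = next e (reach-++ r r′)

  reach-≤ : ∀ {t t′ c d} → t ≤ t′ → Reach t c d → Reach t′ c d
  reach-≤ le       here       = here
  reach-≤ (s≤s le) (next e r) = next e (reach-≤ le r)

  reach-halts : ∀ {t c d} → Reach t c d → step M d ≡ nothing → HaltsWithin M t c d
  reach-halts here       h = halted h
  reach-halts (next e r) h = next e (reach-halts r h)

  outSym : Bits → ℤ → Sym
  outSym o (⁺ i)    = nth blank (map bit o) i
  outSym o -[1+ _ ] = blank

  RepOut : Bits → Tape 1 → Set
  RepOut o t = ∀ z → at t z ≡ outSym o z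

  RepReg : (ℕ → Sym) → ℕ → Tape 1 → Set
  RepReg c v t = ∀ p → at t (rel p v) ≡ c p

  -- Simulation of counter programs by the machine

  module _ (w : Bits) where

    record Rep (s : St) (ts : Tapes) : Set where
      field
        repOut : RepOut (out s) (lookup ts zero)
        repReg : ∀ j → RepReg (cell w (toℕ j)) (regs s (toℕ j)) (lookup ts (suc j))
    open Rep

    rep-≈ : ∀ {s s′ ts} → s ≈ s′ → Rep s ts → Rep s′ ts
    rep-≈ {s} {s′} {ts} (r , o) R = record
      { repOut = subst (λ o → RepOut o (lookup ts zero)) o (repOut R)
      ; repReg = λ j → subst (λ v → RepReg (cell w (toℕ j)) v (lookup ts (suc j))) (r (toℕ j)) (repReg R j) }

    reg-right : ∀ {c v t} → RepReg c v t → RepReg c (suc v) (move right t)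
    reg-right {c} {v} {t} R p = trans (at-move right t (rel p (suc v))) (trans (cong (at t) (shift-right-rel p v)) (R p))

    reg-left : ∀ {c v t} → RepReg c (suc v) t → RepReg c v (move left t)
    reg-left {c} {v} {t} R p = trans (at-move left t (rel p v)) (trans (cong (at t) (shift-left-rel p v)) (R p))

    rep-idle : ∀ {s ts} → Rep s ts → Rep s (perform idle ts)
    rep-idle {s} {ts} R = record
      { repOut = subst (RepOut (out s)) (sym (lookup-perform idle ts zero)) (repOut R)
      ; repReg = λ j → subst (RepReg (cell w (toℕ j)) (regs s (toℕ j))) (sym (lookup-perform idle ts (suc j))) (repReg R j) }

    opaque
      unfolding setReg

      rep-onReg : ∀ {s ts i v} m → (∀ {c t} → RepReg c (regs s i) t → RepReg c v (move m t)) →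
                  Rep s ts → Rep (setReg i v s) (perform (onReg i m) ts)
      rep-onReg {s} {ts} {i} {v} m moves R = record
        { repOut = subst (RepOut (out s)) (sym (lookup-perform (onReg i m) ts zero)) (repOut R)
        ; repReg = λ j → subst (RepReg (cell w (toℕ j)) (if toℕ j ≡ᵇ i then v else regs s (toℕ j))) (sym (lookup-perform (onReg i m) ts (suc j))) (onTape j) }
        where
        onTape : ∀ j → RepReg (cell w (toℕ j)) (if toℕ j ≡ᵇ i then v else regs s (toℕ j))
                   (move (if toℕ j ≡ᵇ i then m else stay) (lookup ts (suc j)))
        onTape j with toℕ j ≡ᵇ i in eq
        ... | false = repReg R j
        ... | true  = moves (subst (λ k → RepReg (cell w (toℕ j)) (regs s k) (lookup ts (suc j))) (≡ᵇ⇒≡ _ _ (subst T (sym eq) tt)) (repReg R j))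

    rep-emit : ∀ {s ts} b → Rep s ts →
               Rep (push (b ∷ []) s) (perform (onOut (λ _ → bit b , stay)) (perform (onOut (_, left)) ts))
    rep-emit {s} {ts} b R = record
      { repOut = subst (RepOut (b ∷ out s)) (sym (trans (lookup-perform c₂ (perform c₁ ts) zero)
                   (cong (write (bit b)) (lookup-perform c₁ ts zero)))) written
      ; repReg = λ j → subst (RepReg (cell w (toℕ j)) (regs s (toℕ j))) (sym (trans (lookup-perform c₂ (perform c₁ ts) (suc j))
                   (lookup-perform c₁ ts (suc j)))) (repReg R j) }
      where
      c₁ = onOut (_, left)
      c₂ = onOut (λ _ → bit b , stay)
      t₀ = lookup ts zero
      written : RepOut (b ∷ out s) (write (bit b) (move left t₀))
      written (⁺ zero)  = refl
      written (⁺ suc i) = trans (at-move left t₀ (⁺ suc i)) (repOut R (⁺ i))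
      written -[1+ i ]  = trans (at-move left t₀ -[1+ i ]) (repOut R -[1+ suc i ])

    read-symbol : ∀ {s ts i} → Rep s ts → i < W → regSym (Vec.map scanned ts) i ≡ cell w i (regs s i)
    read-symbol {s} {t ∷ ts} {i} R i<W = begin
      nth blank (Vec.toList (Vec.map scanned ts)) i         ≡⟨ cong (nth blank (Vec.toList (Vec.map scanned ts))) (sym i≡) ⟩
      nth blank (Vec.toList (Vec.map scanned ts)) (toℕ j)   ≡⟨ nth-toList blank (Vec.map scanned ts) j ⟩
      lookup (Vec.map scanned ts) j                         ≡⟨ Vecₚ.lookup-map j scanned ts ⟩
      at (lookup ts j) (⁺ 0)                                ≡⟨ cong (at (lookup ts j)) (sym (rel-refl v)) ⟩
      at (lookup ts j) (rel v v)                            ≡⟨ repReg R j v ⟩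
      cell w (toℕ j) v                                      ≡⟨ cong (λ i → cell w i (regs s i)) i≡ ⟩
      cell w i (regs s i)                                   ∎
      where
      open ≡-Reasoning
      j = Fin.fromℕ< i<W
      i≡ = Finₚ.toℕ-fromℕ< i<W
      v = regs s (toℕ j)

    nonzero-cell : ∀ i p → nonzero (cell w i (suc p)) ≡ true
    nonzero-cell zero    p = bits w p
      where
      bits : ∀ u p → nonzero (nth blank (map bit u) p) ≡ true
      bits []      p       = refl
      bits (b ∷ u) zero    = refl
      bits (b ∷ u) (suc p) = bits u p
    nonzero-cell (suc i) p = refl

    -- A subprogram inside the machine: `emb` places its positions among the states, and `exit` is
    -- the state that takes over when it ends.
    Embeds : ∀ P → (Pos P → S) → S → Set
    Embeds P emb exit = ∀ p σ → control (emb p) σ ≡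
      just (maybe emb exit (proj₂ (ctrl P p (regSym σ))) , proj₁ (ctrl P p (regSym σ)))

    -- Induction on the run. A compound program gives each part an embedding whose exit is the entry
    -- of what comes next; for a loop body this is the test of the same loop.
    simulate : ∀ {P s t s′} (emb : Pos P → S) (exit : S) → width P ≤ W → Embeds P emb exit →
      Run w P s t s′ → ∀ {ts} → Rep s ts →
      ∃ λ ts′ → Reach t (cfg (emb (entry P)) ts) (cfg exit ts′) × Rep s′ ts′
    simulate emb exit wd H (skipR e) {ts} R =
      _ , next (step-cfg ts (H tt _)) here , rep-≈ e (rep-idle R)
    simulate emb exit wd H (incR e) {ts} R =
      _ , next (step-cfg ts (H tt _)) here , rep-≈ e (rep-onReg right reg-right R)
    simulate emb exit wd H (decR {i} {s} {v = v} eq e) {ts} R =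
      _ , next (step-cfg ts (H tt _)) here ,
      rep-≈ e (rep-onReg left (λ {c} {t} r → reg-left (subst (λ v → RepReg c v t) eq r)) R)
    simulate emb exit wd H (emitR {b} e) {ts} R =
      _ , next (step-cfg ts (H false _)) (next (step-cfg _ (H true _)) here) , rep-≈ e (rep-emit b R)
    simulate emb exit wd H (seqR {P} {Q} r r′) {ts} R =
      let (ts₁ , reach₁ , R₁) = simulate (emb ∘ inj₁) (emb (inj₂ (entry Q))) (m⊔n≤o⇒m≤o _ _ wd) H₁ r R
          (ts₂ , reach₂ , R₂) = simulate (emb ∘ inj₂) exit (m⊔n≤o⇒n≤o (width P) _ wd) H₂ r′ R₁
      in ts₂ , reach-++ reach₁ reach₂ , R₂
      where
      H₁ : Embeds P (emb ∘ inj₁) (emb (inj₂ (entry Q)))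
      H₁ p σ with proj₂ (ctrl P p (regSym σ)) | H (inj₁ p) σ
      ... | nothing | h = h
      ... | just _  | h = h
      H₂ : Embeds Q (emb ∘ inj₂) exit
      H₂ q σ with proj₂ (ctrl Q q (regSym σ)) | H (inj₂ q) σ
      ... | nothing | h = h
      ... | just _  | h = h
    simulate emb exit wd H (thenR {i} {f} {P} {Q} test r) {ts} R =
      let (ts₁ , reach₁ , R₁) = simulate (emb ∘ just ∘ inj₁) exit wdP H₁ r (rep-idle R)
      in ts₁ , next (step-cfg ts branch) reach₁ , R₁
      where
      wdP = m⊔n≤o⇒m≤o _ _ (m⊔n≤o⇒n≤o (suc i) (width P ⊔ width Q) wd)
      branch : control (emb nothing) (Vec.map scanned ts) ≡ just (emb (just (inj₁ (entry P))) , idle)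
      branch = trans (H nothing _) (cong (λ b → just (emb (just (if b then inj₁ (entry P) else inj₂ (entry Q))) , idle))
        (trans (cong f (read-symbol R (m⊔n≤o⇒m≤o (suc i) (width P ⊔ width Q) wd))) test))
      H₁ : Embeds P (emb ∘ just ∘ inj₁) exit
      H₁ p σ with proj₂ (ctrl P p (regSym σ)) | H (just (inj₁ p)) σ
      ... | nothing | h = h
      ... | just _  | h = h
    simulate emb exit wd H (elseR {i} {f} {P} {Q} test r) {ts} R =
      let (ts₁ , reach₁ , R₁) = simulate (emb ∘ just ∘ inj₂) exit wdQ H₂ r (rep-idle R)
      in ts₁ , next (step-cfg ts branch) reach₁ , R₁
      where
      wdQ = m⊔n≤o⇒n≤o (width P) _ (m⊔n≤o⇒n≤o (suc i) (width P ⊔ width Q) wd)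
      branch : control (emb nothing) (Vec.map scanned ts) ≡ just (emb (just (inj₂ (entry Q))) , idle)
      branch = trans (H nothing _) (cong (λ b → just (emb (just (if b then inj₁ (entry P) else inj₂ (entry Q))) , idle))
        (trans (cong f (read-symbol R (m⊔n≤o⇒m≤o (suc i) (width P ⊔ width Q) wd))) test))
      H₂ : Embeds Q (emb ∘ just ∘ inj₂) exit
      H₂ q σ with proj₂ (ctrl Q q (regSym σ)) | H (just (inj₂ q)) σ
      ... | nothing | h = h
      ... | just _  | h = h
    simulate emb exit wd H (doneR {i} {P} eq e) {ts} R =
      _ , next (step-cfg ts leave) here , rep-≈ e (rep-idle R)
      where
      leave : control (emb nothing) (Vec.map scanned ts) ≡ just (exit , idle)
      leave = trans (H nothing _) (cong (λ b → just (maybe emb exit (if b then just (just (entry P)) else nothing) , idle))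
        (cong nonzero (trans (read-symbol R (m⊔n≤o⇒m≤o (suc i) (width P) wd)) (cong (cell w i) eq))))
    simulate emb exit wd H (againR {i} {P} {v = v} eq r r′) {ts} R =
      let (ts₁ , reach₁ , R₁) = simulate (emb ∘ just) (emb nothing) (m⊔n≤o⇒n≤o (suc i) (width P) wd) H₁ r (rep-idle R)
          (ts₂ , reach₂ , R₂) = simulate emb exit wd H r′ R₁
      in ts₂ , next (step-cfg ts enter) (reach-++ reach₁ reach₂) , R₂
      where
      enter : control (emb nothing) (Vec.map scanned ts) ≡ just (emb (just (entry P)) , idle)
      enter = trans (H nothing _) (cong (λ b → just (maybe emb exit (if b then just (just (entry P)) else nothing) , idle))
        (trans (cong nonzero (trans (read-symbol R (m⊔n≤o⇒m≤o (suc i) (width P) wd)) (cong (cell w i) eq))) (nonzero-cell i v)))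
      H₁ : Embeds P (emb ∘ just) (emb nothing)
      H₁ p σ with proj₂ (ctrl P p (regSym σ)) | H (just p) σ
      ... | nothing | h = h
      ... | just _  | h = h
    simulate emb exit wd H (weaken le r) R =
      let (ts₁ , reach₁ , R₁) = simulate emb exit wd H r R in ts₁ , reach-≤ le reach₁ , R₁

  -- While the input v still has to be copied after u, the tapes look as if u
  -- were the input and v the output.
  copySt : Bits → Bits → St
  copySt u v = st (λ { zero → suc (length u) ; (suc zero) → length u ; (suc (suc _)) → 0 }) v

  cell-snoc : ∀ u b p → p ≢ suc (length u) → cell (u ++ b ∷ []) 0 p ≡ cell u 0 p
  cell-snoc u       b zero          _  = refl
  cell-snoc []      b (suc zero)    ne = contradiction refl ne
  cell-snoc []      b (suc (suc p)) _  = refl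
  cell-snoc (x ∷ u) b (suc zero)    _  = refl
  cell-snoc (x ∷ u) b (suc (suc p)) ne = cell-snoc u b (suc p) (ne ∘ cong suc)

  cell-last : ∀ u b → cell (u ++ b ∷ []) 0 (suc (length u)) ≡ bit b
  cell-last []      b = refl
  cell-last (x ∷ u) b = cell-last u b

  rep-copy : ∀ {u b v ts} → Rep u (copySt u (b ∷ v)) ts →
             Rep (u ++ b ∷ []) (copySt (u ++ b ∷ []) v) (perform (copy b) ts)
  rep-copy {u} {b} {v} {ts} R = record { repOut = outTape ; repReg = regTape }
    where
    open Rep
    t₀ = lookup ts zero
    t₁ = lookup ts (suc zero)
    t₂ = lookup ts (suc (suc zero))
    len : length (u ++ b ∷ []) ≡ suc (length u)
    len = trans (Listₚ.length-++ u) (+-comm (length u) 1)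
    outTape : RepOut v (lookup (perform (copy b) ts) zero)
    outTape z rewrite lookup-perform (copy b) ts zero = trans (at-move right (write blank t₀) z) (erased z)
      where
      erased : ∀ z → at (write blank t₀) (shift right z) ≡ outSym v z
      erased (⁺ i)        = repOut R (⁺ suc i)
      erased -[1+ zero ]  = refl
      erased -[1+ suc i ] = repOut R -[1+ i ]
    copied : RepReg (cell (u ++ b ∷ []) 0) (suc (length u)) (write (bit b) t₁)
    copied p with p ≟ suc (length u)
    ... | yes refl = trans (at-write-here t₁ (bit b) (suc (length u))) (sym (cell-last u b))
    ... | no  p≢   = trans (at-write-rel t₁ (bit b) p≢) (trans (repReg R zero p) (sym (cell-snoc u b p p≢)))
    regTape : ∀ j → RepReg (cell (u ++ b ∷ []) (toℕ j)) (regs (copySt (u ++ b ∷ []) v) (toℕ j))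
                      (lookup (perform (copy b) ts) (suc j))
    regTape zero rewrite lookup-perform (copy b) ts (suc zero) | len = reg-right u {t = write (bit b) t₁} copied
    regTape (suc zero) rewrite lookup-perform (copy b) ts (suc (suc zero)) | len = reg-right u {t = t₂} second
      where
      second : RepReg (cell (u ++ b ∷ []) 1) (length u) t₂
      second zero    = repReg R (suc zero) zero
      second (suc p) = repReg R (suc zero) (suc p)
    regTape (suc (suc j)) rewrite lookup-perform (copy b) ts (suc (suc (suc j))) = λ where
      zero    → repReg R (suc (suc j)) zero
      (suc p) → repReg R (suc (suc j)) (suc p)

  copy-loop : ∀ v {u ts} → Rep u (copySt u v) ts →
    ∃ λ ts′ → Reach (suc (length v)) (cfg copying ts) (cfg (running (entry P₀)) ts′) ×
              Rep (u ++ v) (copySt (u ++ v) []) ts′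
  copy-loop [] {u} {t ∷ ts} R rewrite Listₚ.++-identityʳ u =
    _ , next (step-cfg (t ∷ ts) (cong (λ s → control copying (s ∷ Vec.map scanned ts)) (Rep.repOut R (⁺ 0)))) here ,
    rep-idle u R
  copy-loop (b ∷ v) {u} {t ∷ ts} R =
    let (ts′ , reach , R′) = copy-loop v (rep-copy R)
    in ts′ ,
       next (step-cfg (t ∷ ts) (cong (λ s → control copying (s ∷ Vec.map scanned ts)) (Rep.repOut R (⁺ 0)))) reach ,
       subst (λ u → Rep u (copySt u []) ts′) (Listₚ.++-assoc u (b ∷ []) v) R′

  initTapes : Bits → Tapes
  initTapes w = inputTape M w ∷ Vec.replicate W (tape [] blank [])

  rep-init : ∀ w → Rep [] (copySt [] w) (perform markAll (initTapes w))
  rep-init w = record { repOut = input w ; repReg = regTape }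
    where
    input : ∀ w → RepOut w (inputTape M w)
    input []      (⁺ zero)  = refl
    input []      (⁺ suc i) = refl
    input []      -[1+ i ]  = refl
    input (b ∷ w) (⁺ zero)  = refl
    input (b ∷ w) (⁺ suc i) = refl
    input (b ∷ w) -[1+ i ]  = refl
    regTape : ∀ j → RepReg (cell [] (toℕ j)) (regs (copySt [] w) (toℕ j))
                      (lookup (perform markAll (initTapes w)) (suc j))
    regTape zero zero = refl
    regTape zero (suc zero) = refl
    regTape zero (suc (suc p)) = refl
    regTape (suc zero) zero = refl
    regTape (suc zero) (suc p) = refl
    regTape (suc (suc j)) p
      rewrite lookup-perform markAll (initTapes w) (suc (suc (suc j)))
            | Vecₚ.lookup-replicate (suc (suc j)) (tape {1} [] blank []) = blankTape p
      where
      blankTape : RepReg (cell [] (2 + toℕ j)) 0 (tape [] mark [])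
      blankTape zero    = refl
      blankTape (suc p) = refl

  bitPrefix-nth : ∀ l o → (∀ i → nth blank l i ≡ nth blank (map bit o) i) → bitPrefix M l ≡ o
  bitPrefix-nth []      []      h = refl
  bitPrefix-nth []      (b ∷ o) h with () ← h 0
  bitPrefix-nth (x ∷ l) []      h rewrite h 0 = refl
  bitPrefix-nth (x ∷ l) (b ∷ o) h rewrite h 0 = cong (b ∷_) (bitPrefix-nth l o (h ∘ suc))

  output-rep : ∀ {w s′} ts → Rep w s′ ts → output M (cfg finished ts) ≡ out s′
  output-rep (t ∷ ts) R = bitPrefix-nth (scanned t ∷ rightOf t) _ λ where
    zero    → Rep.repOut R (⁺ 0)
    (suc i) → Rep.repOut R (⁺ suc i)

  run⇒halts : ∀ {w t s′} → Run w P₀ (copySt w []) t s′ →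
    ∃ λ c → HaltsWithin M (2 + length w + t) (initial M w) c × output M c ≡ out s′
  run⇒halts {w} {t} {s′} r =
    let (ts₁ , reach₁ , R₁) = copy-loop w (rep-init w)
        (ts₂ , reach₂ , R₂) = simulate w {P₀} (λ p → running p) finished (m≤n+m (width P₀) 2) (λ p σ → refl) r R₁
    in cfg finished ts₂ ,
       reach-halts (next (step-cfg {marking} {copying} {markAll} (initTapes w) refl) (reach-++ reach₁ reach₂)) (step-finished ts₂) ,
       output-rep ts₂ R₂

-- Polynomially bounded functions

addP : Polynomial → Polynomial → Polynomial
addP []      q       = q
addP (a ∷ p) []      = a ∷ p
addP (a ∷ p) (b ∷ q) = a + b ∷ addP p q

mulP : Polynomial → Polynomial → Polynomial
mulP []      q = []
mulP (a ∷ p) q = addP (map (a *_) q) (0 ∷ mulP p q)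

compP : Polynomial → Polynomial → Polynomial
compP []      q = []
compP (a ∷ p) q = addP (a ∷ []) (mulP q (compP p q))

eval-addP : ∀ p q x → eval (addP p q) x ≡ eval p x + eval q x
eval-addP []      q       x = refl
eval-addP (a ∷ p) []      x = sym (+-identityʳ _)
eval-addP (a ∷ p) (b ∷ q) x rewrite eval-addP p q x = lemma a b x (eval p x) (eval q x)
  where
  lemma : ∀ a b x u v → a + b + x * (u + v) ≡ a + x * u + (b + x * v)
  lemma = solve-∀

eval-scale : ∀ a q x → eval (map (a *_) q) x ≡ a * eval q x
eval-scale a []      x = sym (*-zeroʳ a)
eval-scale a (b ∷ q) x rewrite eval-scale a q x = lemma a b x (eval q x)
  where
  lemma : ∀ a b x u → a * b + x * (a * u) ≡ a * (b + x * u)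
  lemma = solve-∀

eval-mulP : ∀ p q x → eval (mulP p q) x ≡ eval p x * eval q x
eval-mulP []      q x = refl
eval-mulP (a ∷ p) q x
  rewrite eval-addP (map (a *_) q) (0 ∷ mulP p q) x | eval-scale a q x | eval-mulP p q x =
  lemma a x (eval p x) (eval q x)
  where
  lemma : ∀ a x u v → a * v + x * (u * v) ≡ (a + x * u) * v
  lemma = solve-∀

eval-compP : ∀ p q x → eval (compP p q) x ≡ eval p (eval q x)
eval-compP []      q x = refl
eval-compP (a ∷ p) q x
  rewrite eval-addP (a ∷ []) (mulP q (compP p q)) x | eval-mulP q (compP p q) x | eval-compP p q x =
  cong (_+ eval q x * eval p (eval q x)) (trans (cong (a +_) (*-zeroʳ x)) (+-identityʳ a))

eval-mono : ∀ p {x y} → x ≤ y → eval p x ≤ eval p y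
eval-mono []      le = z≤n
eval-mono (a ∷ p) le = +-monoʳ-≤ a (*-mono-≤ le (eval-mono p le))

-- Upper bounds suffice, and since polynomials with natural coefficients are monotone, these bounds
-- can be composed.
PB : (ℕ → ℕ) → Set
PB g = Σ Polynomial λ p → ∀ x → g x ≤ eval p x

pb-const : ∀ c → PB (λ _ → c)
pb-const c = (c ∷ []) , λ x → m≤m+n c _

eval-id : ∀ x → eval (0 ∷ 1 ∷ []) x ≡ x
eval-id = lemma
  where
  lemma : ∀ x → x * (1 + x * 0) ≡ x
  lemma = solve-∀

pb-id : PB (λ x → x)
pb-id = (0 ∷ 1 ∷ []) , λ x → ≤-reflexive (sym (eval-id x))

pb-+ : ∀ {f g} → PB f → PB g → PB (λ x → f x + g x)
pb-+ (p , hp) (q , hq) = addP p q , λ x → ≤-trans (+-mono-≤ (hp x) (hq x)) (≤-reflexive (sym (eval-addP p q x)))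

pb-* : ∀ {f g} → PB f → PB g → PB (λ x → f x * g x)
pb-* (p , hp) (q , hq) = mulP p q , λ x → ≤-trans (*-mono-≤ (hp x) (hq x)) (≤-reflexive (sym (eval-mulP p q x)))

pb-∘ : ∀ {f g} → PB f → PB g → PB (λ x → f (g x))
pb-∘ (p , hp) (q , hq) = compP p q , λ x →
  ≤-trans (hp _) (≤-trans (eval-mono p (hq x)) (≤-reflexive (sym (eval-compP p q x))))

pb-suc : ∀ {f} → PB f → PB (λ x → suc (f x))
pb-suc = pb-+ (pb-const 1)

-- Loops of counter programs

≡ᵇ-refl : ∀ i → (i ≡ᵇ i) ≡ true
≡ᵇ-refl zero    = refl
≡ᵇ-refl (suc i) = ≡ᵇ-refl i

≢⇒≡ᵇ : ∀ {i j} → i ≢ j → (i ≡ᵇ j) ≡ false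
≢⇒≡ᵇ {i} {j} ne with i ≡ᵇ j in eq
... | false = refl
... | true  = contradiction (≡ᵇ⇒≡ i j (subst T (sym eq) tt)) ne

≡ᵇ-true : ∀ {i j} → (i ≡ᵇ j) ≡ true → i ≡ j
≡ᵇ-true {i} {j} eq = ≡ᵇ⇒≡ i j (subst T (sym eq) tt)

≈-refl : ∀ {s} → s ≈ s
≈-refl = (λ _ → refl) , refl

≈-sym : ∀ {s s′} → s ≈ s′ → s′ ≈ s
≈-sym (r , o) = (λ i → sym (r i)) , sym o

≈-trans : ∀ {s s′ s″} → s ≈ s′ → s′ ≈ s″ → s ≈ s″
≈-trans (r , o) (r′ , o′) = (λ i → trans (r i) (r′ i)) , trans o o′

opaque
  unfolding setReg

  get-set : ∀ i v s → regs (setReg i v s) i ≡ v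
  get-set i v s rewrite ≡ᵇ-refl i = refl

  get-other : ∀ {i j} v s → j ≢ i → regs (setReg i v s) j ≡ regs s j
  get-other v s ne rewrite ≢⇒≡ᵇ ne = refl

  set-cong : ∀ {i u v s s′} → u ≡ v → s ≈ s′ → setReg i u s ≈ setReg i v s′
  set-cong {i} refl (r , o) = (λ j → cong (if j ≡ᵇ i then _ else_) (r j)) , o

  set-set : ∀ {i u v s} → setReg i u (setReg i v s) ≈ setReg i u s
  set-set {i} {u} {v} {s} = at-reg , refl
    where
    at-reg : ∀ j → regs (setReg i u (setReg i v s)) j ≡ regs (setReg i u s) j
    at-reg j with j ≡ᵇ i
    ... | true  = refl
    ... | false = refl

  set-comm : ∀ {i j u v s} → i ≢ j → setReg i u (setReg j v s) ≈ setReg j v (setReg i u s)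
  set-comm {i} {j} {u} {v} {s} ne = at-reg , refl
    where
    at-reg : ∀ k → regs (setReg i u (setReg j v s)) k ≡ regs (setReg j v (setReg i u s)) k
    at-reg k with k ≡ᵇ i in ei | k ≡ᵇ j in ej
    ... | true  | true  = contradiction (trans (sym (≡ᵇ-true {k} ei)) (≡ᵇ-true {k} ej)) ne
    ... | true  | false = refl
    ... | false | true  = refl
    ... | false | false = refl

  set-id : ∀ {i v s} → regs s i ≡ v → setReg i v s ≈ s
  set-id {i} {v} {s} eq = at-reg , refl
    where
    at-reg : ∀ j → regs (setReg i v s) j ≡ regs s j
    at-reg j with j ≡ᵇ i in e
    ... | true  = trans (sym eq) (cong (regs s) (sym (≡ᵇ-true {j} e)))
    ... | false = refl

push-cong : ∀ {o s s′} → s ≈ s′ → push o s ≈ push o s′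
push-cong {o} (r , e) = r , cong (o ++_) e

clear : ℕ → Prog
clear i = while i (dec i)

transfer : ℕ → ℕ → Prog
transfer a b = while a (dec a ⨾ inc b)

module _ {w : Bits} where

  run-resp : ∀ {P s₁ s t s′ s″} → s₁ ≈ s → s′ ≈ s″ → Run w P s t s′ → Run w P s₁ t s″
  run-resp e e′ (skipR q) = skipR (≈-trans e (≈-trans q e′))
  run-resp {inc i} e e′ (incR q) = incR (≈-trans (set-cong (cong suc (proj₁ e i)) e) (≈-trans q e′))
  run-resp {dec i} e e′ (decR eq q) = decR (trans (proj₁ e i) eq) (≈-trans (set-cong refl e) (≈-trans q e′))
  run-resp e e′ (emitR q) = emitR (≈-trans (push-cong e) (≈-trans q e′))
  run-resp e e′ (seqR r r′) = seqR (run-resp e ≈-refl r) (run-resp ≈-refl e′ r′)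
  run-resp {ite i f P Q} e e′ (thenR q r) = thenR (trans (cong (f ∘ cell w i) (proj₁ e i)) q) (run-resp e e′ r)
  run-resp {ite i f P Q} e e′ (elseR q r) = elseR (trans (cong (f ∘ cell w i) (proj₁ e i)) q) (run-resp e e′ r)
  run-resp {while i P} e e′ (doneR q h) = doneR (trans (proj₁ e i) q) (≈-trans e (≈-trans h e′))
  run-resp {while i P} e e′ (againR q r r′) = againR (trans (proj₁ e i) q) (run-resp e ≈-refl r) (run-resp ≈-refl e′ r′)
  run-resp e e′ (weaken le r) = weaken le (run-resp e e′ r)

  -- The loop invariant is the family σ, indexed by the value still left in the counter; the run
  -- goes from `σ n` down to `σ 0`.
  forR : ∀ {i P b} (σ : ℕ → St) n → (∀ m → regs (σ m) i ≡ m) →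
         (∀ m → m < n → Run w P (σ (suc m)) b (σ m)) → Run w (while i P) (σ n) (suc (n * suc b)) (σ 0)
  forR σ zero    ctr body = doneR (ctr 0) ≈-refl
  forR {b = b} σ (suc n) ctr body =
    weaken (≤-reflexive (cong suc (+-suc b (n * suc b))))
      (againR (ctr (suc n)) (body n ≤-refl) (forR σ n ctr (λ m lt → body m (m<n⇒m<1+n lt))))

  clearR : ∀ {i v b s s′} → regs s i ≡ v → v ≤ b → setReg i 0 s ≈ s′ → Run w (clear i) s (suc (b * 2)) s′
  clearR {i} {v} {b} {s} eq le e = weaken (s≤s (*-monoˡ-≤ 2 le))
    (run-resp (≈-sym (set-id eq)) e
      (forR (λ k → setReg i k s) v (λ k → get-set i k s) (λ k _ → decR (get-set i (suc k) s) set-set)))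

  transferR : ∀ {a b u v c s s′} → a ≢ b → regs s a ≡ v → regs s b ≡ u → v ≤ c →
              setReg a 0 (setReg b (v + u) s) ≈ s′ → Run w (transfer a b) s (suc (c * 3)) s′
  transferR {a} {b} {u} {v} {c} {s} ne eqa eqb le e = weaken (s≤s (*-monoˡ-≤ 3 le))
    (run-resp
      (≈-sym (≈-trans (set-cong refl (set-id (trans eqb (cong (_+ u) (sym (n∸n≡0 v)))))) (set-id eqa)))
      e (forR σ v (λ k → get-set a k _) body))
    where
    σ : ℕ → St
    σ k = setReg a k (setReg b ((v ∸ k) + u) s)
    body : ∀ k → k < v → Run w (dec a ⨾ inc b) (σ (suc k)) 2 (σ k)
    body k k<v = seqR {s′ = setReg a k (setReg b ((v ∸ suc k) + u) s)}
      (decR (get-set a (suc k) _) set-set)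
      (incR (≈-trans (set-comm (ne ∘ sym)) (set-cong refl (≈-trans set-set
        (set-cong (trans (cong suc (trans (get-other k _ (ne ∘ sym)) (get-set b _ s)))
                         (cong (_+ u) (sym (+-∸-assoc 1 k<v)))) ≈-refl)))))

-- Functions computed by counter programs

infixr 5 _▹_
_▹_ : ∀ {n} → ℕ → (Fin n → ℕ) → Fin (suc n) → ℕ
(x ▹ ρ) zero    = x
(x ▹ ρ) (suc j) = ρ j

Fun : ℕ → Set
Fun n = Bits → (Fin n → ℕ) → ℕ

-- The program of a function keeps its arguments in the registers ls, may use
-- the registers from m on, which are 0, and leaves the value in register m.
record Layout (w : Bits) {n} (ls ρ : Fin n → ℕ) (m : ℕ) (s : St) : Set where
  field
    head≡0  : regs s 0 ≡ 0
    length≡ : regs s 1 ≡ length w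
    2≤m     : 2 ≤ m
    free    : ∀ {i} → m ≤ i → regs s i ≡ 0
    below   : ∀ j → ls j < m
    holds   : ∀ j → regs s (ls j) ≡ ρ j
open Layout

record Bounded (w : Bits) {n} (ρ : Fin n → ℕ) (B : ℕ) : Set where
  field
    length≤ : length w ≤ B
    args≤   : ∀ j → ρ j ≤ B
open Bounded

-- One polynomial bounds both value and running time in terms of a bound on the input length and on
-- all arguments. The value bound of one function thus serves as argument bound of the next.
record Comp {n} (f : Fun n) : Set where
  field
    prog   : (Fin n → ℕ) → ℕ → Prog
    bound  : ℕ → ℕ
    poly   : PB bound
    value≤ : ∀ {w ρ B} → Bounded w ρ B → f w ρ ≤ bound B
    runs   : ∀ {w ρ B ls m s} → Bounded w ρ B → Layout w ls ρ m s →
             Run w (prog ls m) s (bound B) (setReg m (f w ρ) s)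
open Comp

raise : ∀ {w n ls ρ m s} v → Layout w {n} ls ρ m s → Layout w ls ρ (suc m) (setReg m v s)
raise {m = m} {s} v L = record
  { head≡0  = trans (get-other v s (<⇒≢ (≤-trans (s≤s z≤n) (2≤m L)))) (head≡0 L)
  ; length≡ = trans (get-other v s (<⇒≢ (2≤m L))) (length≡ L)
  ; 2≤m     = m≤n⇒m≤1+n (2≤m L)
  ; free    = λ lt → trans (get-other v s (>⇒≢ lt)) (free L (<⇒≤ lt))
  ; below   = λ j → m<n⇒m<1+n (below L j)
  ; holds   = λ j → trans (get-other v s (<⇒≢ (below L j))) (holds L j)
  }

adjoin : ∀ {w n ls ρ m s l v} → l < m → regs s l ≡ v → Layout w {n} ls ρ m s → Layout w (l ▹ ls) (v ▹ ρ) m s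
adjoin lt eq L = record
  { head≡0 = head≡0 L ; length≡ = length≡ L ; 2≤m = 2≤m L ; free = free L
  ; below = λ { zero → lt ; (suc j) → below L j } ; holds = λ { zero → eq ; (suc j) → holds L j } }

extend : ∀ {w n ls ρ m s} v → Layout w {n} ls ρ m s → Layout w (m ▹ ls) (v ▹ ρ) (suc m) (setReg m v s)
extend {m = m} {s} v L = adjoin ≤-refl (get-set m v s) (raise v L)

-- Rearrangements of arguments, given as functions that compute definitionally
-- on lists of the form x ▹ y ▹ … ▹ ρ.
record Selection (n n′ : ℕ) : Set where
  constructor selection
  field
    select   : (Fin n′ → ℕ) → (Fin n → ℕ)
    source   : Fin n → Fin n′
    selects  : ∀ ρ j → select ρ j ≡ ρ (source j)
open Selection

rename : ∀ {w n n′ ls ρ m s} (θ : Selection n n′) → Layout w ls ρ m s → Layout w (select θ ls) (select θ ρ) m s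
rename {ls = ls} {ρ} {s = s} θ L = record
  { head≡0 = head≡0 L ; length≡ = length≡ L ; 2≤m = 2≤m L ; free = free L
  ; below = λ j → subst (_< _) (sym (selects θ ls j)) (below L (source θ j))
  ; holds = λ j → trans (cong (regs s) (selects θ ls j)) (trans (holds L (source θ j)) (sym (selects θ ρ j))) }

bounded-▹ : ∀ {w n ρ B v b} → Bounded w {n} ρ B → v ≤ b → Bounded w (v ▹ ρ) (B + b)
bounded-▹ {B = B} {b = b} bd le = record
  { length≤ = ≤-trans (length≤ bd) (m≤m+n B b)
  ; args≤   = λ { zero → ≤-trans le (m≤n+m b B) ; (suc j) → ≤-trans (args≤ bd j) (m≤m+n B b) } }

bounded-select : ∀ {w n n′ ρ B} (θ : Selection n n′) → Bounded w ρ B → Bounded w (select θ ρ) B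
bounded-select {ρ = ρ} θ bd = record
  { length≤ = length≤ bd ; args≤ = λ j → subst (_≤ _) (sym (selects θ ρ j)) (args≤ bd (source θ j)) }

congC : ∀ {n} {f g : Fun n} → (∀ w ρ → f w ρ ≡ g w ρ) → Comp f → Comp g
congC eq F = record
  { prog = prog F ; bound = bound F ; poly = poly F
  ; value≤ = λ bd → subst (_≤ _) (eq _ _) (value≤ F bd)
  ; runs = λ {w} {ρ} {m = m} {s} bd L → subst (λ v → Run w _ s _ (setReg m v s)) (eq w ρ) (runs F bd L) }

renC : ∀ {n n′} {f : Fun n} (θ : Selection n n′) → Comp f → Comp (λ w ρ → f w (select θ ρ))
renC θ F = record
  { prog = λ ls → prog F (select θ ls) ; bound = bound F ; poly = poly F
  ; value≤ = λ bd → value≤ F (bounded-select θ bd)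
  ; runs = λ bd L → runs F (bounded-select θ bd) (rename θ L) }

zeroC : ∀ {n} → Comp {n} (λ w ρ → 0)
zeroC = record
  { prog = λ _ _ → skip ; bound = λ _ → 1 ; poly = pb-const 1 ; value≤ = λ _ → z≤n
  ; runs = λ bd L → skipR (≈-sym (set-id (free L ≤-refl))) }

sucC : ∀ {n} {f : Fun n} → Comp f → Comp (λ w ρ → suc (f w ρ))
sucC F = record
  { prog = λ ls m → prog F ls m ⨾ inc m ; bound = λ B → bound F B + 1 ; poly = pb-+ (poly F) (pb-const 1)
  ; value≤ = λ bd → ≤-trans (s≤s (value≤ F bd)) (≤-reflexive (+-comm 1 _))
  ; runs = λ {m = m} {s} bd L → seqR (runs F bd L)
      (incR (≈-trans set-set (set-cong (cong suc (get-set m _ s)) ≈-refl))) }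

-- A register is copied by moving it to m and m+1 and back.
copyReg : ℕ → ℕ → Prog
copyReg a m = while a (dec a ⨾ inc m ⨾ inc (suc m)) ⨾ transfer (suc m) a

copyRegR : ∀ {w a m v b s} → a < m → regs s a ≡ v → regs s m ≡ 0 → regs s (suc m) ≡ 0 → v ≤ b →
           Run w (copyReg a m) s (suc (b * 4) + suc (b * 3)) (setReg m v s)
copyRegR {w} {a} {m} {v} {b} {s} a<m eqa eqm eqm′ le = seqR
  (weaken (s≤s (*-monoˡ-≤ 4 le))
    (run-resp start ≈-refl (forR σ v (λ k → get-set a k _) body)))
  (transferR (a≢m′ ∘ sym) (trans (get-other 0 _ (a≢m′ ∘ sym)) (get-set (suc m) v _))
    (get-set a 0 _) le finish)
  where
  a≢m : a ≢ m
  a≢m = <⇒≢ a<m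
  a≢m′ : a ≢ suc m
  a≢m′ = <⇒≢ (m<n⇒m<1+n a<m)
  σ : ℕ → St
  σ k = setReg a k (setReg (suc m) (v ∸ k) (setReg m (v ∸ k) s))
  start : s ≈ σ v
  start = ≈-sym (≈-trans
    (set-cong refl (≈-trans (set-cong refl (set-id (trans eqm (sym (n∸n≡0 v)))))
                            (set-id (trans eqm′ (sym (n∸n≡0 v)))))) (set-id eqa))
  body : ∀ k → k < v → Run w (dec a ⨾ inc m ⨾ inc (suc m)) (σ (suc k)) 3 (σ k)
  body k k<v =
    seqR {s′ = setReg a k (setReg (suc m) x (setReg m x s))} (decR (get-set a _ _) set-set) (seqR
      {s′ = setReg a k (setReg (suc m) x (setReg m y s))}
      (incR (≈-trans (set-comm (a≢m ∘ sym)) (set-cong refl (≈-trans (set-comm (<⇒≢ (n<1+n m)))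
        (set-cong refl (≈-trans set-set (set-cong (trans (cong suc (trans (get-other k _ (a≢m ∘ sym))
          (trans (get-other x _ (<⇒≢ (n<1+n m))) (get-set m x s)))) x+1) ≈-refl)))))))
      (incR (≈-trans (set-comm (a≢m′ ∘ sym)) (set-cong refl (≈-trans set-set
        (set-cong (trans (cong suc (trans (get-other k _ (a≢m′ ∘ sym)) (get-set (suc m) x _))) x+1) ≈-refl))))))
    where
    x = v ∸ suc k
    y = v ∸ k
    x+1 : suc x ≡ y
    x+1 = sym (+-∸-assoc 1 k<v)
  finish : setReg (suc m) 0 (setReg a (v + 0) (σ 0)) ≈ setReg m v s
  finish =
    ≈-trans (set-cong refl set-set) (≈-trans (set-comm (a≢m′ ∘ sym))
    (≈-trans (set-cong (+-identityʳ v) (≈-trans set-set (set-id (trans (get-other v s (>⇒≢ (n<1+n m))) eqm′))))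
    (set-id (trans (get-other v s a≢m) eqa))))

regC : ∀ {n} {f : Fun n} (reg : (Fin n → ℕ) → ℕ) →
       (∀ {w ls ρ m s} → Layout w ls ρ m s → reg ls < m × regs s (reg ls) ≡ f w ρ) →
       (∀ {w ρ B} → Bounded w ρ B → f w ρ ≤ B) → Comp f
regC reg spec le = record
  { prog = λ ls m → copyReg (reg ls) m
  ; bound = λ B → suc (B * 4) + suc (B * 3)
  ; poly = pb-+ (pb-suc (pb-* pb-id (pb-const 4))) (pb-suc (pb-* pb-id (pb-const 3)))
  ; value≤ = λ {_} {_} {B} bd → ≤-trans (le bd) (≤-trans (m≤m*n B 4) (≤-trans (n≤1+n _) (m≤m+n _ _)))
  ; runs = λ bd L → let (lt , eq) = spec L in copyRegR lt eq (free L ≤-refl) (free L (n≤1+n _)) (le bd) }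

varC : ∀ {n} (j : Fin n) → Comp (λ w ρ → ρ j)
varC j = regC (λ ls → ls j) (λ L → below L j , holds L j) (λ bd → args≤ bd j)

lengthC : ∀ {n} → Comp {n} (λ w ρ → length w)
lengthC = regC (λ _ → 1) (λ L → 2≤m L , length≡ L) length≤

bindC : ∀ {n} {f : Fun n} {g : Fun (suc n)} → Comp f → Comp g → Comp (λ w ρ → g w (f w ρ ▹ ρ))
bindC {n} {f} {g} F G = record
  { prog   = λ ls m → prog F ls m ⨾ prog G (m ▹ ls) (suc m) ⨾ clear m ⨾ transfer (suc m) m
  ; bound  = bnd
  ; poly   = pb-+ (poly F) (pb-+ pbG (pb-+ (pb-suc (pb-* (poly F) (pb-const 2))) (pb-suc (pb-* pbG (pb-const 3)))))
  ; value≤ = λ bd → ≤-trans (value≤ G (bounded-▹ bd (value≤ F bd)))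
                      (≤-trans (m≤m+n _ _) (m≤n+m _ (bound F _)))
  ; runs   = λ {w} {ρ} {B} {ls} {m} {s} bd L →
      let bd′ = bounded-▹ bd (value≤ F bd)
          u = f w ρ
          v = g w (u ▹ ρ)
          m≢ = <⇒≢ (n<1+n m)
      in seqR (runs F bd L) (seqR (runs G bd′ (extend u L)) (seqR
           {s′ = setReg (suc m) v (setReg m 0 s)}
           (clearR (trans (get-other v _ m≢) (get-set m u s)) (value≤ F bd)
             (≈-trans (set-comm m≢) (set-cong refl set-set)))
           (transferR (m≢ ∘ sym) (get-set (suc m) v _) (trans (get-other v _ m≢) (get-set m 0 s)) (value≤ G bd′)
             (≈-trans (set-comm (m≢ ∘ sym)) (≈-trans (set-cong (+-identityʳ v) (≈-trans set-set
               (set-id (trans (get-other 0 s (m≢ ∘ sym)) (free L (n≤1+n m))))))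
               set-set)))))
  }
  where
  pbG : PB (λ B → bound G (B + bound F B))
  pbG = pb-∘ (poly G) (pb-+ pb-id (poly F))
  bnd : ℕ → ℕ
  bnd B = bound F B + (bound G (B + bound F B) + (suc (bound F B * 2) + suc (bound G (B + bound F B) * 3)))

b2n : Bool → ℕ
b2n b = if b then 1 else 0

b2n≤1 : ∀ b → b2n b ≤ 1
b2n≤1 true  = ≤-refl
b2n≤1 false = z≤n

isTrue : Sym → Bool
isTrue (bit b) = b
isTrue _       = false

isTrue-nth : ∀ w v → isTrue (nth blank (map bit w) v) ≡ nth false w v
isTrue-nth []      v       = refl
isTrue-nth (b ∷ w) zero    = refl
isTrue-nth (b ∷ w) (suc v) = isTrue-nth w v

-- Register 0 is set to 1 + v, which puts its head on bit v of the input; after the test it returns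
-- to 0. Beyond the input the head scans a blank, which counts as `false`.
bitC : ∀ {n} {f : Fun n} → Comp f → Comp (λ w ρ → b2n (nth false w (f w ρ)))
bitC {n} {f} F = record
  { prog   = λ ls m → prog F ls m ⨾ inc 0 ⨾ transfer m 0 ⨾ ite 0 isTrue (clear 0 ⨾ inc m) (clear 0)
  ; bound  = bnd
  ; poly   = pb-+ (poly F) (pb-+ (pb-const 1) (pb-+ (pb-suc (pb-* (poly F) (pb-const 3)))
               (pb-suc (pb-+ (pb-suc (pb-* (pb-suc (poly F)) (pb-const 2))) (pb-const 1)))))
  ; value≤ = λ {w} {ρ} {B} bd → ≤-trans (b2n≤1 (nth false w (f w ρ)))
      (≤-trans (m≤m+n 1 _) (m≤n+m _ (bound F B)))
  ; runs   = λ {w} {ρ} {B} {ls} {m} {s} bd L →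
      let v = f w ρ
          0≢m = <⇒≢ (≤-trans (s≤s z≤n) (2≤m L))
          s₁ = setReg 0 1 (setReg m v s)
          s₂ = setReg 0 (v + 1) s
          final : ∀ {u} → setReg m u (setReg 0 0 s₂) ≈ setReg m u s
          final = set-cong refl (≈-trans set-set (set-id (head≡0 L)))
          m≡0 : regs s₂ m ≡ 0
          m≡0 = trans (get-other _ s (0≢m ∘ sym)) (free L ≤-refl)
          le : v + 1 ≤ suc (bound F B)
          le = ≤-trans (≤-reflexive (+-comm v 1)) (s≤s (value≤ F bd))
          symbol : isTrue (cell w 0 (regs s₂ 0)) ≡ nth false w v
          symbol = trans (cong (isTrue ∘ cell w 0) (trans (get-set 0 _ s) (+-comm v 1))) (isTrue-nth w v)
      in seqR (runs F bd L) (seqR {s′ = s₁}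
           (incR (set-cong (cong suc (trans (get-other v s 0≢m) (head≡0 L))) ≈-refl))
           (seqR {s′ = s₂}
             (transferR (0≢m ∘ sym) (trans (get-other 1 _ (0≢m ∘ sym)) (get-set m v s)) (get-set 0 1 _) (value≤ F bd)
               (≈-trans (set-cong refl set-set) (≈-trans (set-comm (0≢m ∘ sym))
                 (set-cong refl (≈-trans set-set (set-id (free L ≤-refl)))))))
             (branch 0≢m (get-set 0 (v + 1) s) symbol m≡0 le final)))
  }
  where
  bnd : ℕ → ℕ
  bnd B = bound F B + (1 + (suc (bound F B * 3) + suc (suc (suc (bound F B) * 2) + 1)))
  branch : ∀ {w c m v b s s₂} → 0 ≢ m → regs s₂ 0 ≡ v + 1 → isTrue (cell w 0 (regs s₂ 0)) ≡ b → regs s₂ m ≡ 0 → v + 1 ≤ c →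
           (∀ {u} → setReg m u (setReg 0 0 s₂) ≈ setReg m u s) →
           Run w (ite 0 isTrue (clear 0 ⨾ inc m) (clear 0)) s₂ (suc (suc (c * 2) + 1)) (setReg m (b2n b) s)
  branch {m = m} {b = true} {s₂ = s₂} 0≢m eq sy m≡0 le final = thenR sy (seqR (clearR eq le ≈-refl)
    (incR (≈-trans (set-cong (cong suc (trans (get-other 0 s₂ (0≢m ∘ sym)) m≡0)) ≈-refl) final)))
  branch {m = m} {b = false} {s₂ = s₂} 0≢m eq sy m≡0 le final = elseR sy (weaken (m≤m+n _ 1) (clearR eq le
    (≈-trans (≈-sym (set-id (trans (get-other 0 s₂ (0≢m ∘ sym)) m≡0))) final)))

natrec : (ℕ → ℕ → ℕ) → ℕ → ℕ → ℕ
natrec g a zero    = a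
natrec g a (suc i) = g i (natrec g a i)

natrec-≤ : ∀ g a b n → (∀ i x → i < n → g i x ≤ x + b) → natrec g a n ≤ a + n * b
natrec-≤ g a b zero    h = m≤m+n a 0
natrec-≤ g a b (suc n) h = begin
  g n (natrec g a n)  ≤⟨ h n _ ≤-refl ⟩
  natrec g a n + b    ≤⟨ +-monoˡ-≤ b (natrec-≤ g a b n (λ i x lt → h i x (m<n⇒m<1+n lt))) ⟩
  a + n * b + b       ≡⟨ trans (+-assoc a (n * b) b) (cong (a +_) (+-comm (n * b) b)) ⟩
  a + (b + n * b)     ∎
  where open ≤-Reasoning

-- The additive bound h on the growth keeps the values of the recursion
-- polynomial.
recC : ∀ {n} {ini cnt : Fun n} {body : Fun (2 + n)} {h : Fun (suc n)} →
       Comp ini → Comp cnt → Comp body → Comp h →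
       (∀ w ρ i a → body w (i ▹ a ▹ ρ) ≤ a + h w (i ▹ ρ)) →
       Comp (λ w ρ → natrec (λ i a → body w (i ▹ a ▹ ρ)) (ini w ρ) (cnt w ρ))
recC {n} {ini} {cnt} {body} {h} I C F H growth = record
  { prog = λ ls m → prog I ls m ⨾ prog C ls (1 + m) ⨾ while (1 + m) (loop ls m) ⨾ clear (2 + m)
  ; bound = bnd
  ; poly = pb-+ (poly I) (pb-+ (poly C) (pb-+
      (pb-suc (pb-* (poly C) (pb-suc pbLoop))) (pb-suc (pb-+ (pb-* (poly C) (pb-const 2)) pbAcc))))
  ; value≤ = λ {w} {ρ} {B} bd → ≤-trans (acc≤ bd (cnt w ρ) ≤-refl)
      (≤-trans (m≤n+m (accB B) (bound C B * 2)) (≤-trans (n≤1+n _) (≤-trans (m≤n+m _ (suc (bound C B * suc (loopB B))))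
      (≤-trans (m≤n+m _ (bound C B)) (m≤n+m _ (bound I B))))))
  ; runs = runRec
  }
  where
  -- Register m holds the accumulator, 1 + m the number of remaining steps, 2 + m the index and 3 +
  -- m the new value. The index needs its own register because the recursion counts up while the
  -- loop counts down.
  loop : (Fin n → ℕ) → ℕ → Prog
  loop ls m = dec (1 + m) ⨾ prog F (2 + m ▹ m ▹ ls) (3 + m) ⨾ clear m ⨾ transfer (3 + m) m ⨾ inc (2 + m)
  envB accB envB′ loopB bnd : ℕ → ℕ
  envB B = B + bound C B
  accB B = bound I B + bound C B * bound H (envB B)
  envB′ B = B + accB B + bound C B
  loopB B = 1 + (bound F (envB′ B) + (suc (accB B * 2) + (suc (bound F (envB′ B) * 3) + 1)))
  bnd B = bound I B + (bound C B + (suc (bound C B * suc (loopB B)) + suc (bound C B * 2 + accB B)))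
  pbAcc : PB accB
  pbAcc = pb-+ (poly I) (pb-* (poly C) (pb-∘ (poly H) (pb-+ pb-id (poly C))))
  pbF : PB (λ B → bound F (envB′ B))
  pbF = pb-∘ (poly F) (pb-+ (pb-+ pb-id pbAcc) (poly C))
  pbLoop : PB loopB
  pbLoop = pb-suc (pb-+ pbF (pb-+ (pb-suc (pb-* pbAcc (pb-const 2))) (pb-+ (pb-suc (pb-* pbF (pb-const 3))) (pb-const 1))))

  acc : Bits → (Fin n → ℕ) → ℕ → ℕ
  acc w ρ = natrec (λ i a → body w (i ▹ a ▹ ρ)) (ini w ρ)

  acc≤ : ∀ {w ρ B} → Bounded w ρ B → ∀ i → i ≤ cnt w ρ → acc w ρ i ≤ accB B
  acc≤ {w} {ρ} {B} bd i le = ≤-trans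
    (natrec-≤ _ (ini w ρ) (bound H (envB B)) i (λ k x lt → ≤-trans (growth w ρ k x)
      (+-monoʳ-≤ x (value≤ H (bounded-▹ bd (≤-trans (<⇒≤ lt) (≤-trans le (value≤ C bd))))))))
    (+-mono-≤ (value≤ I bd) (*-monoˡ-≤ _ (≤-trans le (value≤ C bd))))

  runRec : ∀ {w ρ B ls m s} → Bounded w ρ B → Layout w ls ρ m s →
           Run w (prog I ls m ⨾ prog C ls (1 + m) ⨾ while (1 + m) (loop ls m) ⨾ clear (2 + m)) s (bnd B)
             (setReg m (acc w ρ (cnt w ρ)) s)
  runRec {w} {ρ} {B} {ls} {m} {s} bd L =
    seqR (runs I bd L) (seqR (runs C bd (raise (ini w ρ) L)) (seqR
      (weaken (s≤s (*-monoˡ-≤ (suc (loopB B)) (value≤ C bd)))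
        (run-resp start ≈-refl (forR σ c (λ k → trans (get-other _ _ 1≢2) (get-set (1 + m) k _)) body-runs)))
      (weaken (s≤s (m≤m+n _ (accB B)))
        (clearR (get-set (2 + m) c _) (value≤ C bd)
          (≈-trans set-set (≈-trans (set-id (trans (get-other 0 _ 2≢1) (trans (get-other _ s 2≢0) (free L (m≤n+m m 2)))))
            (set-id (trans (get-other _ s 1≢0) (free L (n≤1+n m))))))))))
    where
    c = cnt w ρ
    A = acc w ρ
    0≢1 : m ≢ 1 + m
    0≢1 = <⇒≢ (n<1+n m)
    1≢0 = 0≢1 ∘ sym
    0≢2 : m ≢ 2 + m
    0≢2 = <⇒≢ (m<n⇒m<1+n (n<1+n m))
    2≢0 = 0≢2 ∘ sym
    1≢2 : 1 + m ≢ 2 + m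
    1≢2 = 0≢1 ∘ suc-injective
    2≢1 = 1≢2 ∘ sym
    0≢3 : m ≢ 3 + m
    0≢3 = <⇒≢ (m≤n+m (suc m) 2)
    2≢3 : 2 + m ≢ 3 + m
    2≢3 = 1≢2 ∘ suc-injective
    N : ℕ → ℕ → ℕ → St
    N a r x = setReg (2 + m) x (setReg (1 + m) r (setReg m a s))
    set₀ : ∀ {a a′ r x} → setReg m a′ (N a r x) ≈ N a′ r x
    set₀ = ≈-trans (set-comm 0≢2) (set-cong refl (≈-trans (set-comm 0≢1) (set-cong refl set-set)))
    get₀ : ∀ {a r x} → regs (N a r x) m ≡ a
    get₀ = trans (get-other _ _ 0≢2) (trans (get-other _ _ 0≢1) (get-set m _ s))
    get₃ : ∀ {a r x} → regs (N a r x) (3 + m) ≡ 0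
    get₃ = trans (get-other _ _ (2≢3 ∘ sym)) (trans (get-other _ _ (0≢2 ∘ sym ∘ suc-injective))
             (trans (get-other _ s (0≢3 ∘ sym)) (free L (m≤n+m m 3))))
    σ : ℕ → St
    σ k = N (A (c ∸ k)) k (c ∸ k)
    start : setReg (1 + m) c (setReg m (ini w ρ) s) ≈ σ c
    start rewrite n∸n≡0 c = ≈-sym (set-id (trans (get-other c _ 2≢1) (trans (get-other _ s 2≢0) (free L (m≤n+m m 2)))))
    body-runs : ∀ k → k < c → Run w (loop ls m) (σ (suc k)) (loopB B) (σ k)
    body-runs k k<c =
      seqR {s′ = N a k x} (decR (trans (get-other x _ 1≢2) (get-set (1 + m) (suc k) _))
        (≈-trans (set-comm 1≢2) (set-cong refl set-set)))
      (seqR (runs F bd′ layout)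
      (seqR {s′ = setReg (3 + m) a′ (N 0 k x)}
        (clearR (trans (get-other a′ _ 0≢3) get₀) (acc≤ bd x (m∸n≤m c (suc k)))
          (≈-trans (set-comm 0≢3) (set-cong refl set₀)))
      (seqR {s′ = N a′ k x}
        (transferR (0≢3 ∘ sym) (get-set (3 + m) a′ _) (trans (get-other a′ _ 0≢3) get₀) (value≤ F bd′)
          (≈-trans (set-comm (0≢3 ∘ sym)) (≈-trans (set-cong (+-identityʳ a′) (≈-trans set-set (set-id get₃))) set₀)))
        (incR (≈-trans set-set (≈-trans (set-cong (cong suc (get-set (2 + m) x _)) ≈-refl)
          (subst (λ y → N a′ k (suc x) ≈ N (A y) k y) (sym (+-∸-assoc 1 k<c)) ≈-refl)))))))
      where
      x = c ∸ suc k
      a = A x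
      a′ = body w (x ▹ a ▹ ρ)
      layout : Layout w (2 + m ▹ m ▹ ls) (x ▹ a ▹ ρ) (3 + m) (N a k x)
      layout = adjoin ≤-refl (get-set (2 + m) x _) (adjoin (m≤n+m (suc m) 2) get₀ (raise x (raise k (raise a L))))
      bd′ : Bounded w (x ▹ a ▹ ρ) (envB′ B)
      bd′ = bounded-▹ (bounded-▹ bd (acc≤ bd x (m∸n≤m c (suc k)))) (≤-trans (m∸n≤m c (suc k)) (value≤ C bd))

-- Functions to bit strings, written back to front

OutFun : ℕ → Set
OutFun n = Bits → (Fin n → ℕ) → Bits

record Out {n} (F : OutFun n) : Set where
  field
    oprog  : (Fin n → ℕ) → ℕ → Prog
    obound : ℕ → ℕ
    opoly  : PB obound
    oruns  : ∀ {w ρ B ls m s} → Bounded w ρ B → Layout w ls ρ m s →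
             Run w (oprog ls m) s (obound B) (push (F w ρ) s)
open Out

push-layout : ∀ {w n ls ρ m s} o → Layout w {n} ls ρ m s → Layout w ls ρ m (push o s)
push-layout o L = record
  { head≡0 = head≡0 L ; length≡ = length≡ L ; 2≤m = 2≤m L ; free = free L ; below = below L ; holds = holds L }

push-push : ∀ {o o′ s} → push o (push o′ s) ≈ push (o ++ o′) s
push-push {o} {o′} {s} = (λ _ → refl) , sym (Listₚ.++-assoc o o′ (out s))

opaque
  unfolding setReg

  push-set : ∀ {o i v s} → setReg i v (push o s) ≈ push o (setReg i v s)
  push-set = (λ _ → refl) , refl

  out-set : ∀ {i v s} → out (setReg i v s) ≡ out s
  out-set = refl

congO : ∀ {n} {F G : OutFun n} → (∀ w ρ → F w ρ ≡ G w ρ) → Out F → Out G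
congO eq O = record
  { oprog = oprog O ; obound = obound O ; opoly = opoly O
  ; oruns = λ {w} {ρ} {s = s} bd L → subst (λ o → Run w _ s _ (push o s)) (eq w ρ) (oruns O bd L) }

nilO : ∀ {n} → Out {n} (λ w ρ → [])
nilO = record { oprog = λ _ _ → skip ; obound = λ _ → 1 ; opoly = pb-const 1 ; oruns = λ _ _ → skipR ≈-refl }

emitO : ∀ {n} b → Out {n} (λ w ρ → b ∷ [])
emitO b = record { oprog = λ _ _ → emit b ; obound = λ _ → 2 ; opoly = pb-const 2 ; oruns = λ _ _ → emitR ≈-refl }

infixr 5 _++O_
_++O_ : ∀ {n} {F G : OutFun n} → Out F → Out G → Out (λ w ρ → F w ρ ++ G w ρ)
_++O_ {F = F} {G} P Q = record
  { oprog = λ ls m → oprog Q ls m ⨾ oprog P ls m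
  ; obound = λ B → obound Q B + obound P B
  ; opoly = pb-+ (opoly Q) (opoly P)
  ; oruns = λ {w} {ρ} bd L → seqR (oruns Q bd L)
      (run-resp ≈-refl (push-push {F w ρ}) (oruns P bd (push-layout (G w ρ) L))) }

bindO : ∀ {n} {f : Fun n} {F : OutFun (suc n)} → Comp f → Out F → Out (λ w ρ → F w (f w ρ ▹ ρ))
bindO {f = f} C P = record
  { oprog = λ ls m → prog C ls m ⨾ oprog P (m ▹ ls) (suc m) ⨾ clear m
  ; obound = λ B → bound C B + (obound P (B + bound C B) + suc (bound C B * 2))
  ; opoly = pb-+ (poly C) (pb-+ (pb-∘ (opoly P) (pb-+ pb-id (poly C))) (pb-suc (pb-* (poly C) (pb-const 2))))
  ; oruns = λ {w} {ρ} {m = m} {s} bd L → seqR (runs C bd L) (seqR (oruns P (bounded-▹ bd (value≤ C bd)) (extend (f w ρ) L))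
      (clearR (get-set m (f w ρ) s) (value≤ C bd)
        (≈-trans push-set (push-cong (≈-trans set-set (set-id (free L ≤-refl))))))) }

condO : ∀ {n} {c : Bits → (Fin n → ℕ) → Bool} {F G : OutFun n} → Comp (λ w ρ → b2n (c w ρ)) → Out F → Out G →
        Out (λ w ρ → if c w ρ then F w ρ else G w ρ)
condO {n} {c} {F} {G} C P Q = record
  { oprog = λ ls m → prog C ls m ⨾ ite m nonzero (oprog P ls (suc m)) (oprog Q ls (suc m)) ⨾ clear m
  ; obound = λ B → bound C B + (suc (obound P B + obound Q B) + suc (bound C B * 2))
  ; opoly = pb-+ (poly C) (pb-+ (pb-suc (pb-+ (opoly P) (opoly Q))) (pb-suc (pb-* (poly C) (pb-const 2))))
  ; oruns = λ {w} {ρ} {B} {ls} {m} {s} bd L → seqR (runs C bd L) (seqR (branch bd L (c w ρ) (get-set m _ s))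
      (clearR (get-set m (b2n (c w ρ)) s) (value≤ C bd)
        (≈-trans push-set (push-cong (≈-trans set-set (set-id (free L ≤-refl))))))) }
  where
  nonzero-mark : ∀ w m v → 2 ≤ m → nonzero (cell w m (b2n v)) ≡ v
  nonzero-mark w (suc m) true  _ = refl
  nonzero-mark w (suc m) false _ = refl
  branch : ∀ {w ρ B ls m s} → Bounded w ρ B → Layout w ls ρ m s → ∀ b → regs (setReg m (b2n b) s) m ≡ b2n b →
    Run w (ite m nonzero (oprog P ls (suc m)) (oprog Q ls (suc m))) (setReg m (b2n b) s)
      (suc (obound P B + obound Q B)) (push (if b then F w ρ else G w ρ) (setReg m (b2n b) s))
  branch {w} {m = m} bd L true eq = thenR (trans (cong (nonzero ∘ cell w m) eq) (nonzero-mark w m true (2≤m L)))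
    (weaken (m≤m+n _ _) (oruns P bd (raise 1 L)))
  branch {w} {m = m} bd L false eq = elseR (trans (cong (nonzero ∘ cell w m) eq) (nonzero-mark w m false (2≤m L)))
    (weaken (m≤n+m _ _) (oruns Q bd (raise 0 L)))

concatUpTo : (ℕ → Bits) → ℕ → Bits
concatUpTo G n = concat (applyUpTo G n)

concatUpTo-suc : ∀ G n → concatUpTo G (suc n) ≡ concatUpTo G n ++ G n
concatUpTo-suc G zero    = Listₚ.++-identityʳ (G 0)
concatUpTo-suc G (suc n) = trans (cong (G 0 ++_) (concatUpTo-suc (G ∘ suc) n)) (sym (Listₚ.++-assoc (G 0) _ _))

-- The counter runs down while output is prepended, so the pieces come out in increasing order.
forO : ∀ {n} {c : Fun n} {F : OutFun (suc n)} → Comp c → Out F →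
       Out (λ w ρ → concatUpTo (λ i → F w (i ▹ ρ)) (c w ρ))
forO {n} {c} {F} C P = record
  { oprog = λ ls m → prog C ls m ⨾ while m (dec m ⨾ oprog P (m ▹ ls) (suc m))
  ; obound = λ B → bound C B + suc (bound C B * suc (1 + obound P (B + bound C B)))
  ; opoly = pb-+ (poly C) (pb-suc (pb-* (poly C) (pb-suc (pb-suc (pb-∘ (opoly P) (pb-+ pb-id (poly C)))))))
  ; oruns = λ {w} {ρ} {B} {m = m} {s} bd L → seqR (runs C bd L)
      (weaken (s≤s (*-monoˡ-≤ (suc (1 + obound P (B + bound C B))) (value≤ C bd)))
        (run-resp ≈-refl (≈-trans ((λ _ → refl) , cong (_++ out (setReg m 0 s)) (Listₚ.++-identityʳ _))
            (push-cong (set-id (free L ≤-refl)))) (loop bd L (c w ρ) [] (value≤ C bd)))) }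
  where
  loop : ∀ {w ρ B ls m s} → Bounded w ρ B → Layout w ls ρ m s → ∀ k o → k ≤ bound C B →
    Run w (while m (dec m ⨾ oprog P (m ▹ ls) (suc m))) (push o (setReg m k s))
      (suc (k * suc (1 + obound P (B + bound C B)))) (push (concatUpTo (λ i → F w (i ▹ ρ)) k ++ o) (setReg m 0 s))
  loop {m = m} {s} bd L zero o le = doneR (get-set m 0 s) ≈-refl
  loop {w} {ρ} {B} {ls} {m} {s} bd L (suc k) o le =
    weaken (≤-reflexive (cong suc (+-suc (1 + obound P (B + bound C B)) _)))
      (againR (get-set m (suc k) s)
        (seqR {s′ = push o (setReg m k s)}
          (decR (get-set m (suc k) s) (≈-trans push-set (push-cong set-set)))
          (run-resp ≈-refl (push-push {F w (k ▹ ρ)})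
            (oruns P (bounded-▹ bd (≤-trans (n≤1+n k) le)) (push-layout o (extend k L)))))
        (run-resp ≈-refl ((λ _ → refl) , cong (_++ out (setReg m 0 s)) regroup)
          (loop bd L k (F w (k ▹ ρ) ++ o) (≤-trans (n≤1+n k) le))))
    where
    G = λ i → F w (i ▹ ρ)
    regroup : concatUpTo G k ++ G k ++ o ≡ concatUpTo G (suc k) ++ o
    regroup = trans (sym (Listₚ.++-assoc (concatUpTo G k) (G k) o)) (cong (_++ o) (sym (concatUpTo-suc G k)))

noArgs : Fin 0 → ℕ
noArgs ()

out⇒PolyTime : {F : OutFun 0} → Out F → PolyTime (λ w → F w noArgs)
out⇒PolyTime {F} O = M , proj₁ pb , λ w →
  let (d , halts , eq) = run⇒halts {w} (seqR
        -- Copying leaves the head of register 0 behind the last bit, at 1 + length w, whereas a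
        -- layout wants it at 0.
        (clearR {v = suc (length w)} refl ≤-refl ≈-refl)
        (oruns O {ls = noArgs} {m = 2} (record { length≤ = ≤-refl ; args≤ = λ () }) (layout w)))
  in d , halts-≤ (proj₂ pb (length w)) halts , trans eq (trans (cong (F w noArgs ++_) out-set) (Listₚ.++-identityʳ _))
  where
  open Machine (clear 0 ⨾ oprog O noArgs 2)
  pb : PB (λ n → 2 + n + (suc (suc n * 2) + obound O n))
  pb = pb-+ (pb-+ (pb-const 2) pb-id) (pb-+ (pb-suc (pb-* (pb-suc pb-id) (pb-const 2))) (opoly O))
  halts-≤ : ∀ {t t′ c d} → t ≤ t′ → HaltsWithin M t c d → HaltsWithin M t′ c d
  halts-≤ le       (halted e) = halted e
  halts-≤ (s≤s le) (next e h) = next e (halts-≤ le h)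
  layout : ∀ w → Layout w {0} noArgs noArgs 2 (setReg 0 0 (copySt w []))
  layout w = record
    { head≡0 = get-set 0 0 _ ; length≡ = get-other 0 _ (λ ()) ; 2≤m = ≤-refl
    ; free = λ { {suc zero} (s≤s ()) ; {suc (suc i)} _ → get-other 0 _ (λ ()) } ; below = λ () ; holds = λ () }

-- Arithmetic

weak : ∀ {n} → Selection n (suc n)
weak = selection (λ ρ j → ρ (suc j)) suc (λ _ _ → refl)

-- Hides the accumulator, which is the second argument of a recursion step.
dropSecond : ∀ {n} → Selection (suc n) (2 + n)
dropSecond = selection (λ ρ → ρ zero ▹ (λ j → ρ (suc (suc j))))
  (λ { zero → zero ; (suc j) → suc (suc j) }) (λ { ρ zero → refl ; ρ (suc j) → refl })

first : ∀ {n} → Selection 1 (suc n)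
first = selection (λ ρ _ → ρ zero) (λ _ → zero) (λ _ _ → refl)

-- `app₂` binds its second argument last, which puts it in front; the selection restores the order.
firstTwo : ∀ {n} → Selection 2 (2 + n)
firstTwo = selection (λ ρ → ρ (suc zero) ▹ ρ zero ▹ (λ ()))
  (λ { zero → suc zero ; (suc zero) → zero }) (λ { ρ zero → refl ; ρ (suc zero) → refl })

pattern #0 = zero
pattern #1 = suc zero
pattern #2 = suc (suc zero)
pattern #3 = suc (suc (suc zero))

wkC : ∀ {n} {f : Fun n} → Comp f → Comp {suc n} (λ w ρ → f w (λ j → ρ (suc j)))
wkC = renC weak

app₁ : ∀ {n} {g : Bits → ℕ → ℕ} {f : Fun n} → Comp {1} (λ w ρ → g w (ρ #0)) → Comp f → Comp (λ w ρ → g w (f w ρ))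
app₁ G F = bindC F (renC first G)

app₂ : ∀ {n} {g : Bits → ℕ → ℕ → ℕ} {f₁ f₂ : Fun n} → Comp {2} (λ w ρ → g w (ρ #0) (ρ #1)) →
       Comp f₁ → Comp f₂ → Comp (λ w ρ → g w (f₁ w ρ) (f₂ w ρ))
app₂ G F₁ F₂ = bindC F₁ (bindC (wkC F₂) (renC firstTwo G))

litC : ∀ {n} k → Comp {n} (λ w ρ → k)
litC zero    = zeroC
litC (suc k) = sucC (litC k)

infixl 6 _+C_ _∸C_
infixl 7 _*C_

_+C_ : ∀ {n} {f g : Fun n} → Comp f → Comp g → Comp (λ w ρ → f w ρ + g w ρ)
_+C_ = app₂ {g = λ _ → _+_} (congC (λ w ρ → iterate-suc (ρ #0) (ρ #1))
  (recC (varC #1) (varC #0) (sucC (varC #1)) (litC 1) (λ w ρ i a → ≤-reflexive (+-comm 1 a))))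
  where
  iterate-suc : ∀ m n → natrec (λ _ a → suc a) n m ≡ m + n
  iterate-suc zero    n = refl
  iterate-suc (suc m) n = cong suc (iterate-suc m n)

_*C_ : ∀ {n} {f g : Fun n} → Comp f → Comp g → Comp (λ w ρ → f w ρ * g w ρ)
_*C_ = app₂ {g = λ _ → _*_} (congC (λ w ρ → iterate-+ (ρ #0) (ρ #1))
  (recC zeroC (varC #0) (varC #3 +C varC #1) (varC #2) (λ w ρ i a → ≤-reflexive (+-comm (ρ #1) a))))
  where
  iterate-+ : ∀ m n → natrec (λ _ a → n + a) 0 m ≡ m * n
  iterate-+ zero    n = refl
  iterate-+ (suc m) n = cong (n +_) (iterate-+ m n)

predC : ∀ {n} {f : Fun n} → Comp f → Comp (λ w ρ → pred (f w ρ))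
predC = app₁ {g = λ _ → pred} (congC (λ w ρ → last-index (ρ #0))
  (recC zeroC (varC #0) (varC #0) (varC #0) (λ w ρ i a → m≤n+m i a)))
  where
  last-index : ∀ m → natrec (λ i _ → i) 0 m ≡ pred m
  last-index zero    = refl
  last-index (suc m) = refl

_∸C_ : ∀ {n} {f g : Fun n} → Comp f → Comp g → Comp (λ w ρ → f w ρ ∸ g w ρ)
_∸C_ = app₂ {g = λ _ → _∸_} (congC (λ w ρ → iterate-pred (ρ #0) (ρ #1))
  (recC (varC #0) (varC #1) (predC (varC #1)) zeroC (λ w ρ i a → ≤-trans pred[n]≤n (m≤m+n a 0))))
  where
  iterate-pred : ∀ m n → natrec (λ _ a → pred a) m n ≡ m ∸ n
  iterate-pred m zero    = refl
  iterate-pred m (suc n) = trans (cong pred (iterate-pred m n)) (pred[m∸n]≡m∸[1+n] m n)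

sumTo : (ℕ → ℕ) → ℕ → ℕ
sumTo f = natrec (λ i a → f i + a) 0

sumC : ∀ {n} {c : Fun n} {f : Fun (suc n)} → Comp c → Comp f → Comp (λ w ρ → sumTo (λ i → f w (i ▹ ρ)) (c w ρ))
sumC C F = recC zeroC C (renC dropSecond F +C varC #1) F (λ w ρ i a → ≤-reflexive (+-comm _ a))

evalC : ∀ {n} {f : Fun n} p → Comp f → Comp (λ w ρ → eval p (f w ρ))
evalC []      F = zeroC
evalC (a ∷ p) F = litC a +C F *C evalC p F

-- Boolean functions

BFun : ℕ → Set
BFun n = Bits → (Fin n → ℕ) → Bool

CompB : ∀ {n} → BFun n → Set
CompB f = Comp (λ w ρ → b2n (f w ρ))

bitB : ∀ {n} {f : Fun n} → Comp f → CompB (λ w ρ → nth false w (f w ρ))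
bitB = bitC

constB : ∀ {n} b → CompB {n} (λ w ρ → b)
constB b = litC (b2n b)

notB : ∀ {n} {f : BFun n} → CompB f → CompB (λ w ρ → not (f w ρ))
notB {f = f} F = congC (λ w ρ → lemma (f w ρ)) (litC 1 ∸C F)
  where
  lemma : ∀ b → 1 ∸ b2n b ≡ b2n (not b)
  lemma true  = refl
  lemma false = refl

infixr 6 _∧B_
infixr 5 _∨B_ _⇒B_
infixr 5 _⇒ᵇ_

_∧B_ : ∀ {n} {f g : BFun n} → CompB f → CompB g → CompB (λ w ρ → f w ρ ∧ g w ρ)
_∧B_ {f = f} {g} F G = congC (λ w ρ → lemma (f w ρ) (g w ρ)) (F *C G)
  where
  lemma : ∀ a b → b2n a * b2n b ≡ b2n (a ∧ b)
  lemma true  b = +-identityʳ (b2n b)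
  lemma false b = refl

_∨B_ : ∀ {n} {f g : BFun n} → CompB f → CompB g → CompB (λ w ρ → f w ρ ∨ g w ρ)
_∨B_ {f = f} {g} F G = congC (λ w ρ → lemma (f w ρ) (g w ρ)) (notB (notB F ∧B notB G))
  where
  lemma : ∀ a b → b2n (not (not a ∧ not b)) ≡ b2n (a ∨ b)
  lemma true  b     = refl
  lemma false true  = refl
  lemma false false = refl

_⇒ᵇ_ : Bool → Bool → Bool
true  ⇒ᵇ b = b
false ⇒ᵇ b = true

_⇒B_ : ∀ {n} {f g : BFun n} → CompB f → CompB g → CompB (λ w ρ → f w ρ ⇒ᵇ g w ρ)
_⇒B_ {f = f} {g} F G = congC (λ w ρ → lemma (f w ρ) (g w ρ)) (notB F ∨B G)
  where
  lemma : ∀ a b → b2n (not a ∨ b) ≡ b2n (a ⇒ᵇ b)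
  lemma true  b = refl
  lemma false b = refl

_<B_ : ∀ {n} {f g : Fun n} → Comp f → Comp g → CompB (λ w ρ → f w ρ <ᵇ g w ρ)
_<B_ {f = f} {g} F G = congC (λ w ρ → lemma (f w ρ) (g w ρ)) (litC 1 ∸C (litC 1 ∸C (G ∸C F)))
  where
  lemma : ∀ a b → 1 ∸ (1 ∸ (b ∸ a)) ≡ b2n (a <ᵇ b)
  lemma zero    zero    = refl
  lemma (suc a) zero    = refl
  lemma zero    (suc b) = cong (1 ∸_) (0∸n≡0 b)
  lemma (suc a) (suc b) = lemma a b

_≡B_ : ∀ {n} {f g : Fun n} → Comp f → Comp g → CompB (λ w ρ → f w ρ ≡ᵇ g w ρ)
_≡B_ {f = f} {g} F G = congC (λ w ρ → lemma (f w ρ) (g w ρ)) (litC 1 ∸C ((G ∸C F) +C (F ∸C G)))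
  where
  lemma : ∀ a b → 1 ∸ ((b ∸ a) + (a ∸ b)) ≡ b2n (a ≡ᵇ b)
  lemma zero    zero    = refl
  lemma (suc a) zero    = 0∸n≡0 a
  lemma zero    (suc b) = 0∸n≡0 (b + 0)
  lemma (suc a) (suc b) = lemma a b

infix 7 _<B_ _≡B_

-- A case distinction is a recursion of length 0 or 1 whose step ignores the accumulator.
ifC : ∀ {n} {c : BFun n} {f g : Fun n} → CompB c → Comp f → Comp g → Comp (λ w ρ → if c w ρ then f w ρ else g w ρ)
ifC {c = c} C F G = congC (λ w ρ → lemma (c w ρ))
  (recC G C (wkC (wkC F)) (wkC F) (λ w ρ i a → m≤n+m _ a))
  where
  lemma : ∀ {x y} b → natrec (λ _ _ → x) y (b2n b) ≡ (if b then x else y)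
  lemma true  = refl
  lemma false = refl

ifB : ∀ {n} {c f g : BFun n} → CompB c → CompB f → CompB g → CompB (λ w ρ → if c w ρ then f w ρ else g w ρ)
ifB {c = c} C F G = congC (λ w ρ → lemma (c w ρ)) (ifC C F G)
  where
  lemma : ∀ {x y} b → (if b then b2n x else b2n y) ≡ b2n (if b then x else y)
  lemma true  = refl
  lemma false = refl

allTo : (ℕ → Bool) → ℕ → Bool
allTo f zero    = true
allTo f (suc n) = f n ∧ allTo f n

allB : ∀ {n} {c : Fun n} {f : BFun (suc n)} → Comp c → CompB f → CompB (λ w ρ → allTo (λ i → f w (i ▹ ρ)) (c w ρ))
allB {c = c} {f} C F = congC (λ w ρ → lemma (λ i → f w (i ▹ ρ)) (c w ρ))
  (recC (litC 1) C (renC dropSecond F *C varC #1) zeroC (λ w ρ i a → shrink (f w (i ▹ ρ)) a))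
  where
  shrink : ∀ b a → b2n b * a ≤ a + 0
  shrink true  a = ≤-refl
  shrink false a = z≤n
  lemma : ∀ g n → natrec (λ i a → b2n (g i) * a) 1 n ≡ b2n (allTo g n)
  lemma g zero    = refl
  lemma g (suc n) rewrite lemma g n with g n
  ... | true  = +-identityʳ _
  ... | false = refl

-- Division and parity

oddᵇ : ℕ → Bool
oddᵇ zero    = false
oddᵇ (suc n) = not (oddᵇ n)

oddB : ∀ {n} {f : Fun n} → Comp f → CompB (λ w ρ → oddᵇ (f w ρ))
oddB = app₁ {g = λ _ n → b2n (oddᵇ n)} (congC (λ w ρ → lemma (ρ #0))
  (recC zeroC (varC #0) (litC 1 ∸C varC #1) (litC 1) (λ w ρ i a → ≤-trans (m∸n≤m 1 a) (m≤n+m 1 a))))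
  where
  lemma : ∀ n → natrec (λ _ a → 1 ∸ a) 0 n ≡ b2n (oddᵇ n)
  lemma zero    = refl
  lemma (suc n) rewrite lemma n with oddᵇ n
  ... | true  = refl
  ... | false = refl

-- There are ⌊n/2⌋ odd numbers below n.
halfC : ∀ {n} {f : Fun n} → Comp f → Comp (λ w ρ → ⌊ f w ρ /2⌋)
halfC = app₁ {g = λ _ n → ⌊ n /2⌋} (congC (λ w ρ → lemma (ρ #0)) (sumC (varC #0) (oddB (varC #0))))
  where
  odd-even : ∀ n → b2n (oddᵇ (suc n)) + b2n (oddᵇ n) ≡ 1
  odd-even n with oddᵇ n
  ... | true  = refl
  ... | false = refl
  lemma : ∀ n → sumTo (λ i → b2n (oddᵇ i)) n ≡ ⌊ n /2⌋
  lemma zero          = refl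
  lemma (suc zero)    = refl
  lemma (suc (suc n)) = trans (sym (+-assoc (b2n (oddᵇ (suc n))) _ _)) (cong₂ _+_ (odd-even n) (lemma n))

-- The quotient is raised as long as the next multiple of d does not exceed n. For positive d the
-- quotient is at most n, so n attempts are enough.
div mod : ℕ → ℕ → ℕ
div n d = natrec (λ _ q → if suc q * d <ᵇ suc n then suc q else q) 0 n
mod n d = n ∸ div n d * d

step≤ : ∀ c a b → (if c then b + a else a) ≤ a + b
step≤ true  a b = ≤-reflexive (+-comm b a)
step≤ false a b = m≤m+n a b

divC : ∀ {n} {f g : Fun n} → Comp f → Comp g → Comp (λ w ρ → div (f w ρ) (g w ρ))
divC = app₂ {g = λ _ → div} (recC zeroC (varC #0)
  (ifC ((sucC (varC #1) *C varC #3) <B sucC (varC #2)) (sucC (varC #1)) (varC #1)) (litC 1)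
  (λ w ρ i a → step≤ (suc a * ρ #1 <ᵇ suc (ρ #0)) a 1))

modC : ∀ {n} {f g : Fun n} → Comp f → Comp g → Comp (λ w ρ → mod (f w ρ) (g w ρ))
modC F G = F ∸C divC F G *C G

<ᵇ-true : ∀ {m n} → m < n → (m <ᵇ n) ≡ true
<ᵇ-true {m} {n} lt with m <ᵇ n in eq
... | true  = refl
... | false = contradiction (<⇒<ᵇ lt) (subst T eq)

<ᵇ-false : ∀ {m n} → n ≤ m → (m <ᵇ n) ≡ false
<ᵇ-false {m} {n} le with m <ᵇ n in eq
... | true  = contradiction (<ᵇ⇒< m n (subst T (sym eq) tt)) (≤⇒≯ le)
... | false = refl

true-<ᵇ : ∀ {m n} → (m <ᵇ n) ≡ true → m < n
true-<ᵇ {m} {n} eq = <ᵇ⇒< m n (subst T (sym eq) tt)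

div-spec : ∀ q {d r} → r < d → div (q * d + r) d ≡ q
div-spec q {d} {r} r<d = trans (steps n) (m≥n⇒m⊓n≡n q≤n)
  where
  n = q * d + r
  q≤n : q ≤ n
  q≤n = ≤-trans (≤-trans (≤-reflexive (sym (*-identityʳ q))) (*-monoʳ-≤ q (≤-trans (s≤s z≤n) r<d))) (m≤m+n (q * d) r)
  steps : ∀ i → natrec (λ _ q → if suc q * d <ᵇ suc n then suc q else q) 0 i ≡ i ⊓ q
  steps zero = refl
  steps (suc i) rewrite steps i with i <? q
  ... | yes i<q rewrite m≤n⇒m⊓n≡m (<⇒≤ i<q) | m≤n⇒m⊓n≡m i<q
                      | <ᵇ-true (s≤s (≤-trans (*-monoˡ-≤ d i<q) (m≤m+n (q * d) r))) = refl
  ... | no  i≮q rewrite m≥n⇒m⊓n≡n (≮⇒≥ i≮q) | m≥n⇒m⊓n≡n (m≤n⇒m≤1+n (≮⇒≥ i≮q))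
                      | <ᵇ-false {suc q * d} {suc n} (≤-trans (≤-reflexive (sym (+-suc (q * d) r)))
                          (≤-trans (+-monoʳ-≤ (q * d) r<d) (≤-reflexive (+-comm (q * d) d)))) = refl

mod-spec : ∀ q {d r} → r < d → mod (q * d + r) d ≡ r
mod-spec q {d} {r} r<d rewrite div-spec q r<d = m+n∸m≡n (q * d) r

-- Finite tables

-- A recursion that forgets its accumulator distinguishes zero from `suc i` and hands over i. A
-- fixed table is a nest of such distinctions, one for each entry.
nthB : ∀ {n} {f : Fun n} (l : List Bool) → Comp f → CompB (λ w ρ → nth false l (f w ρ))
nthB l = app₁ {g = λ _ i → b2n (nth false l i)} (table l)
  where
  unfold : ∀ x l i → natrec (λ i _ → b2n (nth false l i)) (b2n x) i ≡ b2n (nth false (x ∷ l) i)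
  unfold x l zero    = refl
  unfold x l (suc i) = refl
  table : ∀ l → Comp {1} (λ w ρ → b2n (nth false l (ρ #0)))
  table []      = zeroC
  table (x ∷ l) = congC (λ w ρ → unfold x l (ρ #0))
    (recC (constB x) (varC #0) (renC first (table l)) (renC first (table l)) (λ w ρ i a → m≤n+m _ a))

nthB₂ : ∀ {n} {f g : Fun n} (ll : List (List Bool)) → Comp f → Comp g →
        CompB (λ w ρ → nth false (nth [] ll (f w ρ)) (g w ρ))
nthB₂ ll = app₂ {g = λ _ i j → b2n (nth false (nth [] ll i) j)} (table ll)
  where
  unfold : ∀ l ll i j → natrec (λ i _ → b2n (nth false (nth [] ll i) j)) (b2n (nth false l j)) i ≡
                        b2n (nth false (nth [] (l ∷ ll) i) j)
  unfold l ll zero    j = refl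
  unfold l ll (suc i) j = refl
  swap : ∀ {n} → Selection 2 (3 + n)
  swap = selection (λ ρ → ρ #0 ▹ ρ #2 ▹ (λ ())) (λ { #0 → #0 ; #1 → #2 })
    (λ { ρ #0 → refl ; ρ #1 → refl })
  keep : Selection 2 4
  keep = selection (λ ρ → ρ #0 ▹ ρ #3 ▹ (λ ())) (λ { #0 → #0 ; #1 → #3 })
    (λ { ρ #0 → refl ; ρ #1 → refl })
  table : ∀ ll → Comp {2} (λ w ρ → b2n (nth false (nth [] ll (ρ #0)) (ρ #1)))
  table []       = zeroC
  table (l ∷ ll) = congC (λ w ρ → unfold l ll (ρ #0) (ρ #1))
    (recC (nthB l (varC #1)) (varC #0) (renC keep (table ll)) (renC swap (table ll)) (λ w ρ i a → m≤n+m _ a))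

nth-tabulate : ∀ {A : Set} (d : A) {n} (f : Fin n → A) i → nth d (tabulate f) (toℕ i) ≡ f i
nth-tabulate d f zero    = refl
nth-tabulate d f (suc i) = nth-tabulate d (f ∘ suc) i

-- Output of numbers

bitO : ∀ {n} {c : BFun n} → CompB c → Out (λ w ρ → c w ρ ∷ [])
bitO {c = c} C = congO (λ w ρ → lemma (c w ρ)) (condO C (emitO true) (emitO false))
  where
  lemma : ∀ b → (if b then true ∷ [] else false ∷ []) ≡ b ∷ []
  lemma true  = refl
  lemma false = refl

-- In bijective base 2 the last digit of m > 0 is 1 for odd and 2 for even m, and removing it leaves
-- ⌊(m - 1)/2⌋.
quotient : ℕ → ℕ → ℕ
quotient m = natrec (λ _ a → ⌊ pred a /2⌋) m

digitAt : ℕ → ℕ → Bits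
digitAt m i = if 0 <ᵇ quotient m i then true ∷ not (oddᵇ (quotient m i)) ∷ [] else []

quotient-suc : ∀ m i → quotient m (suc i) ≡ quotient ⌊ pred m /2⌋ i
quotient-suc m zero    = refl
quotient-suc m (suc i) = cong (λ a → ⌊ pred a /2⌋) (quotient-suc m i)

concatUpTo-cong : ∀ {F G} n → (∀ i → i < n → F i ≡ G i) → concatUpTo F n ≡ concatUpTo G n
concatUpTo-cong zero    h = refl
concatUpTo-cong (suc n) h = cong₂ _++_ (h 0 (s≤s z≤n)) (concatUpTo-cong n (λ i lt → h (suc i) (s≤s lt)))

digitAt-suc : ∀ {m m′} → ⌊ pred m /2⌋ ≡ m′ → ∀ n → concatUpTo (digitAt m ∘ suc) n ≡ concatUpTo (digitAt m′) n
digitAt-suc {m} refl n = concatUpTo-cong n λ i _ →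
  cong (λ q → if 0 <ᵇ q then true ∷ not (oddᵇ q) ∷ [] else []) (quotient-suc m i)

odd-double : ∀ m → oddᵇ (2 * m) ≡ false
odd-double zero    = refl
odd-double (suc m) rewrite +-suc m (m + 0) | odd-double m = refl

half-double : ∀ m → ⌊ 2 * m /2⌋ ≡ m
half-double m = trans (cong (λ k → ⌊ m + k /2⌋) (+-identityʳ m)) (sym (n≡⌊n+n/2⌋ m))

half-double′ : ∀ m → ⌊ suc (2 * m) /2⌋ ≡ m
half-double′ zero    = refl
half-double′ (suc m) rewrite +-suc m (m + 0) = cong suc (half-double′ m)

-- Rounds after the last digit emit nothing, so every sufficiently large number of rounds gives the
-- same word. The number itself can serve as the count, and no logarithm has to be computed.
delimit-digits : ∀ b n → ℕᵇ.toℕ b ≤ n → concatUpTo (digitAt (ℕᵇ.toℕ b)) n ++ false ∷ [] ≡ delimit (digits b)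
delimit-digits zero n le = trans (cong (_++ false ∷ []) (none n)) refl
  where
  zeros : ∀ i → quotient 0 i ≡ 0
  zeros zero    = refl
  zeros (suc i) rewrite zeros i = refl
  none : ∀ n → concatUpTo (digitAt 0) n ≡ []
  none zero    = refl
  none (suc n) = trans (concatUpTo-suc (digitAt 0) n)
    (cong₂ _++_ (none n) (cong (λ q → if 0 <ᵇ q then true ∷ not (oddᵇ q) ∷ [] else []) (zeros n)))
delimit-digits 2[1+ b ] (suc n) (s≤s le)
  rewrite odd-double (suc (ℕᵇ.toℕ b)) =
  cong (λ l → true ∷ true ∷ l) (trans
    (cong (_++ false ∷ []) (digitAt-suc {2 * suc m} {m} (trans (cong (λ k → ⌊ k /2⌋) (+-suc m (m + 0))) (half-double′ m)) n))
    (delimit-digits b n (≤-trans (m≤m+n m _) le)))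
  where m = ℕᵇ.toℕ b
delimit-digits 1+[2 b ] (suc n) (s≤s le)
  rewrite odd-double (ℕᵇ.toℕ b) =
  cong (λ l → true ∷ false ∷ l) (trans
    (cong (_++ false ∷ []) (digitAt-suc {suc (2 * m)} {m} (half-double m) n))
    (delimit-digits b n (≤-trans (m≤m+n m _) le)))
  where m = ℕᵇ.toℕ b

numberO : ∀ {n} {f : Fun n} → Comp f → Out (λ w ρ → encodeNumber (f w ρ))
numberO {f = f} F = bindO F (congO (λ w ρ → sound (ρ #0))
  (forO (varC #0) (condO (litC 0 <B quot) (emitO true ++O bitO (notB (oddB quot))) nilO) ++O emitO false))
  where
  quot : ∀ {n} → Comp {2 + n} (λ w ρ → quotient (ρ #1) (ρ #0))
  quot = recC (varC #1) (varC #0) (halfC (predC (varC #1))) zeroC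
    (λ w ρ i a → ≤-trans (⌊n/2⌋≤n (pred a)) (≤-trans pred[n]≤n (m≤m+n a 0)))
  sound : ∀ m → concatUpTo (digitAt m) m ++ false ∷ [] ≡ encodeNumber m
  sound m = subst (λ k → concatUpTo (digitAt k) k ++ false ∷ [] ≡ encodeNumber m) (ℕᵇₚ.toℕ-fromℕ m)
    (delimit-digits (ℕᵇ.fromℕ m) _ ≤-refl)

-- Finite sums

module _ where
  open ≡-Reasoning

  sumTo-cong : ∀ {f g} n → (∀ i → i < n → f i ≡ g i) → sumTo f n ≡ sumTo g n
  sumTo-cong zero    h = refl
  sumTo-cong (suc n) h = cong₂ _+_ (h n ≤-refl) (sumTo-cong n (λ i lt → h i (m<n⇒m<1+n lt)))

  sumTo-mono : ∀ {f g} n → (∀ i → i < n → f i ≤ g i) → sumTo f n ≤ sumTo g n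
  sumTo-mono zero    h = z≤n
  sumTo-mono (suc n) h = +-mono-≤ (h n ≤-refl) (sumTo-mono n (λ i lt → h i (m<n⇒m<1+n lt)))

  sumTo-split : ∀ f m n → sumTo f (m + n) ≡ sumTo f m + sumTo (λ i → f (m + i)) n
  sumTo-split f m zero    = trans (cong (sumTo f) (+-identityʳ m)) (sym (+-identityʳ _))
  sumTo-split f m (suc n) = begin
    sumTo f (m + suc n)                                      ≡⟨ cong (sumTo f) (+-suc m n) ⟩
    f (m + n) + sumTo f (m + n)                              ≡⟨ cong (f (m + n) +_) (sumTo-split f m n) ⟩
    f (m + n) + (sumTo f m + sumTo (λ i → f (m + i)) n)      ≡⟨ lemma (f (m + n)) (sumTo f m) _ ⟩
    sumTo f m + (f (m + n) + sumTo (λ i → f (m + i)) n)      ∎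
    where
    lemma : ∀ a b c → a + (b + c) ≡ b + (a + c)
    lemma = solve-∀

  sumTo-front : ∀ f n → sumTo f (suc n) ≡ f 0 + sumTo (f ∘ suc) n
  sumTo-front f n = trans (sumTo-split f 1 n) (cong (_+ sumTo (f ∘ suc) n) (+-identityʳ (f 0)))

  sumTo-nest : ∀ f m n → sumTo f (m * n) ≡ sumTo (λ a → sumTo (λ b → f (a * n + b)) n) m
  sumTo-nest f zero    n = refl
  sumTo-nest f (suc m) n = begin
    sumTo f (n + m * n)                                       ≡⟨ cong (sumTo f) (+-comm n (m * n)) ⟩
    sumTo f (m * n + n)                                       ≡⟨ sumTo-split f (m * n) n ⟩
    sumTo f (m * n) + sumTo (λ b → f (m * n + b)) n           ≡⟨ +-comm (sumTo f (m * n)) _ ⟩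
    sumTo (λ b → f (m * n + b)) n + sumTo f (m * n)           ≡⟨ cong (sumTo (λ b → f (m * n + b)) n +_) (sumTo-nest f m n) ⟩
    sumTo (λ a → sumTo (λ b → f (a * n + b)) n) (suc m)       ∎

  sumTo-const : ∀ c n → sumTo (λ _ → c) n ≡ n * c
  sumTo-const c zero    = refl
  sumTo-const c (suc n) = cong (c +_) (sumTo-const c n)

  sumTo-zero : ∀ {f} n → (∀ i → i < n → f i ≡ 0) → sumTo f n ≡ 0
  sumTo-zero n h = trans (sumTo-cong n h) (trans (sumTo-const 0 n) (*-zeroʳ n))

  sumTo-+ : ∀ f g n → sumTo (λ i → f i + g i) n ≡ sumTo f n + sumTo g n
  sumTo-+ f g zero    = refl
  sumTo-+ f g (suc n) rewrite sumTo-+ f g n = lemma (f n) (g n) (sumTo f n) (sumTo g n)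
    where
    lemma : ∀ a b c d → a + b + (c + d) ≡ a + c + (b + d)
    lemma = solve-∀

  sumTo-*ʳ : ∀ f c n → sumTo (λ i → f i * c) n ≡ sumTo f n * c
  sumTo-*ʳ f c zero    = refl
  sumTo-*ʳ f c (suc n) = trans (cong (f n * c +_) (sumTo-*ʳ f c n)) (sym (*-distribʳ-+ c (f n) (sumTo f n)))

  sumTo-*ˡ : ∀ f c n → sumTo (λ i → c * f i) n ≡ c * sumTo f n
  sumTo-*ˡ f c n = trans (sumTo-cong n (λ i _ → *-comm c (f i))) (trans (sumTo-*ʳ f c n) (*-comm (sumTo f n) c))

  -- A deficit in one term could not be made up by the others. This is how reaching a maximal total
  -- yields information about each single term.
  sumTo-tight : ∀ {f g} n → (∀ i → i < n → f i ≤ g i) → sumTo g n ≤ sumTo f n → ∀ i → i < n → f i ≡ g i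
  sumTo-tight {f} {g} (suc n) h le i i<n with i ≟ n
  ... | yes refl = ≤-antisym (h n ≤-refl) (+-cancelʳ-≤ (sumTo g n) (g n) (f n)
          (≤-trans le (+-monoʳ-≤ (f n) (sumTo-mono n (λ i lt → h i (m<n⇒m<1+n lt))))))
  ... | no  i≢n  = sumTo-tight n (λ i lt → h i (m<n⇒m<1+n lt))
          (+-cancelˡ-≤ (g n) _ _ (≤-trans le (+-monoˡ-≤ (sumTo f n) (h n ≤-refl)))) i (≤∧≢⇒< (s≤s⁻¹ i<n) i≢n)

mixed-radix : ∀ {a b m n} → a < m → b < n → a * n + b < m * n
mixed-radix {a} {b} {m} {n} a<m b<n = begin-strict
  a * n + b     <⟨ +-monoʳ-< (a * n) b<n ⟩
  a * n + n     ≡⟨ +-comm (a * n) n ⟩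
  suc a * n     ≤⟨ *-monoˡ-≤ n a<m ⟩
  m * n         ∎
  where open ≤-Reasoning

-- Profits and satisfaction

∈⇒lookup : ∀ {n v} {X : Subset n} → v ∈ X → lookup X v ≡ true
∈⇒lookup = Vecₚ.[]=⇒lookup

lookup⇒∈ : ∀ {n v} {X : Subset n} → lookup X v ≡ true → v ∈ X
lookup⇒∈ {v = v} {X} = Vecₚ.lookup⇒[]= v X

∈∁⇒lookup : ∀ {n v} {X : Subset n} → v ∈ ∁ X → lookup X v ≡ false
∈∁⇒lookup {v = v} {X} v∈ with lookup X v in eq
... | false = refl
... | true  = contradiction (lookup⇒∈ eq) (x∈∁p⇒x∉p v∈)

profit-sum : ∀ {n} (p : Fin n → ℕ) (X : Subset n) (h : ℕ → ℕ) →
             (∀ v → b2n (lookup X v) * p v ≡ h (toℕ v)) → profit p X ≡ sumTo h n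
profit-sum {n} p X h eq = go n id h eq
  where
  go : ∀ m (g : Fin m → Fin n) h → (∀ j → b2n (lookup X (g j)) * p (g j) ≡ h (toℕ j)) →
       List.foldr _+_ 0 (map p (List.filter (_∈? X) (tabulate g))) ≡ sumTo h m
  go zero    g h eq = refl
  go (suc m) g h eq with g zero ∈? X
  ... | yes v∈X = begin
          p (g zero) + _                       ≡⟨ cong₂ _+_ (trans (sym term) (eq zero))
                                                            (go m (g ∘ suc) (h ∘ suc) (eq ∘ suc)) ⟩
          h 0 + sumTo (h ∘ suc) m              ≡⟨ sumTo-front h m ⟨
          sumTo h (suc m)                      ∎
    where
    open ≡-Reasoning
    term : b2n (lookup X (g zero)) * p (g zero) ≡ p (g zero)
    term rewrite ∈⇒lookup v∈X = *-identityˡ _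
  ... | no  v∉X = begin
          _                                    ≡⟨ go m (g ∘ suc) (h ∘ suc) (eq ∘ suc) ⟩
          sumTo (h ∘ suc) m                    ≡⟨ cong (_+ sumTo (h ∘ suc) m) (trans (sym zero-term) (eq zero)) ⟩
          h 0 + sumTo (h ∘ suc) m              ≡⟨ sumTo-front h m ⟨
          sumTo h (suc m)                      ∎
    where
    open ≡-Reasoning
    zero-term : b2n (lookup X (g zero)) * p (g zero) ≡ 0
    zero-term with lookup X (g zero) in e
    ... | true  = contradiction (lookup⇒∈ e) v∉X
    ... | false = refl

minimum-glb : ∀ {k q} (f : Fin (suc k) → ℕ) → (∀ j → q ≤ f j) → q ≤ minimum f
minimum-glb {zero}  f h = h zero
minimum-glb {suc k} f h = ⊓-glb (h zero) (minimum-glb (f ∘ suc) (h ∘ suc))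

minimum-lower : ∀ {k q} (f : Fin (suc k) → ℕ) → q ≤ minimum f → ∀ j → q ≤ f j
minimum-lower {zero}  f le zero    = le
minimum-lower {suc k} f le zero    = m≤n⊓o⇒m≤n (f zero) _ le
minimum-lower {suc k} f le (suc j) = minimum-lower (f ∘ suc) (m≤n⊓o⇒m≤o (f zero) _ le) j

-- From cliques to fair division

if-true : ∀ {A : Set} {b} {x y : A} → b ≡ true → (if b then x else y) ≡ x
if-true refl = refl

if-false : ∀ {A : Set} {b} {x y : A} → b ≡ false → (if b then x else y) ≡ y
if-false refl = refl

∧-true : ∀ {a b} → (a ∧ b) ≡ true → a ≡ true × b ≡ true
∧-true {true} eq = refl , eq

∨-true : ∀ {a b} → (a ∨ b) ≡ true → a ≡ true ⊎ b ≡ true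
∨-true {true}  _  = inj₁ refl
∨-true {false} eq = inj₂ eq

not-true : ∀ {b} → not b ≡ true → b ≡ false
not-true {false} _ = refl

T⇒true : ∀ {b} → T b → b ≡ true
T⇒true {true} _ = refl

sumTo-not : ∀ (c : ℕ → Bool) n → sumTo (λ i → b2n (c i)) n + sumTo (λ i → b2n (not (c i))) n ≡ n
sumTo-not c n = trans (sym (sumTo-+ _ _ n)) (trans (sumTo-cong n (λ i _ → one (c i))) (trans (sumTo-const 1 n) (*-identityʳ n)))
  where
  one : ∀ b → b2n b + b2n (not b) ≡ 1
  one true  = refl
  one false = refl

-- The case a = b is included in pairwise, so that compat can also exclude
-- single vertices.
record IsClique (N K : ℕ) (compat : ℕ → ℕ → Bool) (c : ℕ → Bool) : Set where
  field
    size     : sumTo (λ i → b2n (c i)) N ≡ K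
    pairwise : ∀ {a b} → a < N → b < N → c a ≡ true → c b ≡ true → compat a b ≡ true

module Clique (N K : ℕ) (compat : ℕ → ℕ → Bool) (k′ : ℕ) where

  -- The vertices are the N given ones, all ordered pairs of them, and one
  -- private vertex for each colour except the first.
  R n M q : ℕ
  R = suc k′
  n = N + (N * N + R)
  M = suc (N * N)
  q = (N ∸ K) * M + K * K

  fst snd : ℕ → ℕ
  fst v = div (v ∸ N) N
  snd v = mod (v ∸ N) N

  isVertex isPair : ℕ → Bool
  isVertex v = v <ᵇ N
  isPair v = not (v <ᵇ N) ∧ (v ∸ N <ᵇ N * N)

  edge adj : ℕ → ℕ → Bool
  edge u v = isVertex u ∧ (isPair v ∧ ((u ≡ᵇ fst v) ∨ (u ≡ᵇ snd v)))
  adj u v = edge u v ∨ edge v u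

  colour : ℕ → ℕ → ℕ → ℕ → ℕ
  colour zero          x y z = x
  colour (suc zero)    x y z = y
  colour (suc (suc j)) x y z = z

  -- Colour 0 earns M for a vertex and 1 for a compatible pair. Colour 1 earns 1 for a vertex and
  -- lacks exactly K besides its private vertex. Every further colour reaches q by its private
  -- vertex alone.
  prof : ℕ → ℕ → ℕ
  prof j v = if isVertex v then colour j M 1 0 else
             if isPair v then colour j (b2n (compat (fst v) (snd v))) 0 0 else
             (if j ≡ᵇ suc (v ∸ N ∸ N * N) then colour j 0 (q ∸ K) q else 0)

  pair : ℕ → ℕ → ℕ
  pair a b = N + (a * N + b)

  private′ : ℕ → ℕ
  private′ i = N + (N * N + i)

  pair<n : ∀ {a b} → a < N → b < N → pair a b < n
  pair<n a<N b<N = +-monoʳ-< N (≤-trans (mixed-radix a<N b<N) (m≤m+n (N * N) R))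

  not-vertex : ∀ i → isVertex (N + i) ≡ false
  not-vertex i = <ᵇ-false (m≤m+n N i)

  isPair-pair : ∀ {i} → i < N * N → isPair (N + i) ≡ true
  isPair-pair {i} lt rewrite not-vertex i | m+n∸m≡n N i = <ᵇ-true lt

  not-pair-private : ∀ i → isPair (private′ i) ≡ false
  not-pair-private i rewrite not-vertex (N * N + i) | m+n∸m≡n N (N * N + i) = <ᵇ-false (m≤m+n (N * N) i)

  fst-pair : ∀ {a b} → b < N → fst (pair a b) ≡ a
  fst-pair {a} {b} b<N rewrite m+n∸m≡n N (a * N + b) = div-spec a b<N

  snd-pair : ∀ {a b} → b < N → snd (pair a b) ≡ b
  snd-pair {a} {b} b<N rewrite m+n∸m≡n N (a * N + b) = mod-spec a b<N

  prof-vertex : ∀ j {v} → v < N → prof j v ≡ colour j M 1 0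
  prof-vertex j lt = if-true (<ᵇ-true lt)

  prof-pair : ∀ j {a b} → a < N → b < N → prof j (pair a b) ≡ colour j (b2n (compat a b)) 0 0
  prof-pair j {a} {b} a<N b<N = trans (if-false (not-vertex (a * N + b))) (trans (if-true (isPair-pair (mixed-radix a<N b<N)))
    (cong₂ (λ x y → colour j (b2n (compat x y)) 0 0) (fst-pair {a} b<N) (snd-pair {a} b<N)))

  prof-private : ∀ j i → prof j (private′ i) ≡ (if j ≡ᵇ suc i then colour j 0 (q ∸ K) q else 0)
  prof-private j i = trans (if-false (not-vertex (N * N + i))) (trans (if-false (not-pair-private i))
    (cong (λ x → if j ≡ᵇ suc x then colour j 0 (q ∸ K) q else 0)
      (trans (cong (_∸ N * N) (m+n∸m≡n N (N * N + i))) (m+n∸m≡n (N * N) i))))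

  total : (ℕ → Bool) → ℕ → ℕ
  total x j = sumTo (λ v → b2n (x v) * prof j v) n

  total-sections : ∀ x j → total x j ≡
    sumTo (λ i → b2n (x i)) N * colour j M 1 0 +
    (sumTo (λ a → sumTo (λ b → b2n (x (pair a b)) * colour j (b2n (compat a b)) 0 0) N) N +
     sumTo (λ i → b2n (x (private′ i)) * (if j ≡ᵇ suc i then colour j 0 (q ∸ K) q else 0)) R)
  total-sections x j = trans (sumTo-split f N (N * N + R)) (cong₂ _+_
    (trans (sumTo-cong N (λ i lt → cong (b2n (x i) *_) (prof-vertex j lt))) (sumTo-*ʳ (λ i → b2n (x i)) _ N))
    (trans (sumTo-split (λ i → f (N + i)) (N * N) R) (cong₂ _+_
      (trans (sumTo-nest (λ i → f (N + i)) N N)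
        (sumTo-cong N (λ a a<N → sumTo-cong N (λ b b<N → cong (b2n (x (pair a b)) *_) (prof-pair j a<N b<N)))))
      (sumTo-cong R (λ i _ → cong (b2n (x (private′ i)) *_) (prof-private j i))))))
    where f = λ v → b2n (x v) * prof j v

  -- Since K ≤ K². It makes `q ∸ K` a true difference.
  K≤q : K ≤ q
  K≤q = ≤-trans (square K) (m≤n+m (K * K) _)
    where
    square : ∀ k → k ≤ k * k
    square zero    = z≤n
    square (suc k) = m≤m*n (suc k) (suc k)

  -- The second colour needs K vertices, so the first gets at most N - K of
  -- them; as M exceeds the profit of all pairs it needs that many, and then
  -- its pairs lie among the K others and must all be compatible.
  colouring⇒clique : (x y : ℕ → Bool) →
    (∀ {v} → v < N → x v ≡ true → y v ≡ true → ⊥) →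
    (∀ {a b} → a < N → b < N → x (pair a b) ≡ true → x a ≡ false × x b ≡ false) →
    q ≤ total x 0 → q ≤ total y 1 → IsClique N K compat (not ∘ x)
  colouring⇒clique x y disj indep qx qy = record { size = Y≡K ; pairwise = compatible }
    where
    open ≤-Reasoning
    c = not ∘ x
    X₀ = sumTo (λ i → b2n (x i)) N
    X₁ = sumTo (λ i → b2n (y i)) N
    Y  = sumTo (λ i → b2n (c i)) N
    pairs weights : ℕ → ℕ → ℕ
    pairs a b = b2n (c a) * b2n (c b) * b2n (compat a b)
    weights a b = b2n (c a) * b2n (c b)
    P Q : ℕ
    P = sumTo (λ a → sumTo (λ b → b2n (x (pair a b)) * b2n (compat a b)) N) N
    Q = sumTo (λ a → sumTo (pairs a) N) N
    total₀ : total x 0 ≡ X₀ * M + P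
    total₀ = trans (total-sections x 0) (cong (X₀ * M +_)
      (trans (cong (P +_) (sumTo-zero R (λ i _ → *-zeroʳ (b2n (x (private′ i)))))) (+-identityʳ P)))
    total₁ : total y 1 ≤ X₁ + (q ∸ K)
    total₁ = begin
      total y 1             ≡⟨ total-sections y 1 ⟩
      X₁ * 1 + (sumTo _ N + sumTo f₁ R)  ≡⟨ cong₂ (λ a b → a + (b + sumTo f₁ R)) (*-identityʳ X₁)
                                  (sumTo-zero N (λ a _ → sumTo-zero N (λ b _ → *-zeroʳ (b2n (y (pair a b)))))) ⟩
      X₁ + sumTo f₁ R       ≡⟨ cong (X₁ +_) (sumTo-front f₁ k′) ⟩
      X₁ + (f₁ 0 + sumTo (f₁ ∘ suc) k′)  ≡⟨ cong (λ r → X₁ + (f₁ 0 + r)) (sumTo-zero k′ (λ i _ → *-zeroʳ (b2n (y (private′ (suc i)))))) ⟩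
      X₁ + (f₁ 0 + 0)       ≡⟨ cong (X₁ +_) (+-identityʳ (f₁ 0)) ⟩
      X₁ + b2n (y (private′ 0)) * (q ∸ K)     ≤⟨ +-monoʳ-≤ X₁ (*-monoˡ-≤ (q ∸ K) (b2n≤1 (y (private′ 0)))) ⟩
      X₁ + 1 * (q ∸ K)      ≡⟨ cong (X₁ +_) (*-identityˡ (q ∸ K)) ⟩
      X₁ + (q ∸ K)          ∎
      where
      f₁ = λ i → b2n (y (private′ i)) * (if 1 ≡ᵇ suc i then q ∸ K else 0)
    K≤X₁ : K ≤ X₁
    K≤X₁ = +-cancelʳ-≤ (q ∸ K) K X₁ (≤-trans (≤-reflexive (m+[n∸m]≡n K≤q)) (≤-trans qy total₁))
    X₀+K≤N : X₀ + K ≤ N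
    X₀+K≤N = begin
      X₀ + K                                   ≤⟨ +-monoʳ-≤ X₀ K≤X₁ ⟩
      X₀ + X₁                                  ≡⟨ sumTo-+ _ _ N ⟨
      sumTo (λ i → b2n (x i) + b2n (y i)) N    ≤⟨ sumTo-mono N (λ i lt → atMostOne (x i) (y i) (disj lt)) ⟩
      sumTo (λ _ → 1) N                        ≡⟨ trans (sumTo-const 1 N) (*-identityʳ N) ⟩
      N                                        ∎
      where
      atMostOne : ∀ a b → (a ≡ true → b ≡ true → ⊥) → b2n a + b2n b ≤ 1
      atMostOne true  true  h = ⊥-elim (h refl refl)
      atMostOne true  false h = ≤-refl
      atMostOne false b     h = b2n≤1 b
    -- A pair in the first class conflicts with its ends, so both ends lie in the complement c.
    P≤Q : P ≤ Q
    P≤Q = sumTo-mono N (λ a a<N → sumTo-mono N (λ b b<N →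
      *-monoˡ-≤ (b2n (compat a b)) (covered (x (pair a b)) (indep a<N b<N))))
      where
      covered : ∀ {a b} p → (p ≡ true → x a ≡ false × x b ≡ false) → b2n p ≤ b2n (c a) * b2n (c b)
      covered false h = z≤n
      covered {a} {b} true h rewrite proj₁ (h refl) | proj₂ (h refl) = ≤-refl
    weights-sum : sumTo (λ a → sumTo (weights a) N) N ≡ Y * Y
    weights-sum = trans (sumTo-cong N (λ a _ → sumTo-*ˡ (λ b → b2n (c b)) (b2n (c a)) N)) (sumTo-*ʳ (λ a → b2n (c a)) Y N)
    pairs≤weights : ∀ a b → pairs a b ≤ weights a b
    pairs≤weights a b = ≤-trans (*-monoʳ-≤ (weights a b) (b2n≤1 (compat a b))) (≤-reflexive (*-identityʳ _))
    Q≤YY : Q ≤ Y * Y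
    Q≤YY = ≤-trans (sumTo-mono N (λ a _ → sumTo-mono N (λ b _ → pairs≤weights a b))) (≤-reflexive weights-sum)
    Y≤N : Y ≤ N
    Y≤N = ≤-trans (m≤n+m Y X₀) (≤-reflexive (sumTo-not x N))
    q≤ : q ≤ X₀ * M + P
    q≤ = ≤-trans qx (≤-reflexive total₀)
    N∸K≤X₀ : N ∸ K ≤ X₀
    N∸K≤X₀ = ≮⇒≥ λ X₀<N∸K → <-irrefl refl (begin-strict
      X₀ * M + P          ≤⟨ +-monoʳ-≤ (X₀ * M) (≤-trans P≤Q (≤-trans Q≤YY (*-mono-≤ Y≤N Y≤N))) ⟩
      X₀ * M + N * N      <⟨ +-monoʳ-< (X₀ * M) (n<1+n (N * N)) ⟩
      X₀ * M + M          ≡⟨ +-comm (X₀ * M) M ⟩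
      suc X₀ * M          ≤⟨ *-monoˡ-≤ M X₀<N∸K ⟩
      (N ∸ K) * M         ≤⟨ m≤m+n _ (K * K) ⟩
      q                   ≤⟨ q≤ ⟩
      X₀ * M + P          ∎)
    X₀≡ : X₀ ≡ N ∸ K
    X₀≡ = ≤-antisym (≤-trans (≤-reflexive (sym (m+n∸n≡m X₀ K))) (∸-monoˡ-≤ K X₀+K≤N)) N∸K≤X₀
    Y≡K : Y ≡ K
    Y≡K = +-cancelˡ-≡ X₀ Y K (trans (sumTo-not x N)
      (sym (trans (cong (_+ K) X₀≡) (m∸n+n≡m (m+n≤o⇒n≤o X₀ X₀+K≤N)))))
    -- With exactly N - K vertices in the first class, the remaining K² of the threshold must come
    -- from pairs, and c has only K² ordered pairs.
    YY≤Q : sumTo (λ a → sumTo (weights a) N) N ≤ Q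
    YY≤Q = begin
      sumTo (λ a → sumTo (weights a) N) N  ≡⟨ trans weights-sum (cong₂ _*_ Y≡K Y≡K) ⟩
      K * K                                ≤⟨ +-cancelˡ-≤ (X₀ * M) (K * K) P (≤-trans (≤-reflexive (cong (λ z → z * M + K * K) X₀≡)) q≤) ⟩
      P                                    ≤⟨ P≤Q ⟩
      Q                                    ∎
    compatible : ∀ {a b} → a < N → b < N → c a ≡ true → c b ≡ true → compat a b ≡ true
    compatible {a} {b} a<N b<N ca cb = one (trans (sym simp) (trans tight simp′))
      where
      -- Tightness is used twice: among the rows, and then within row a.
      row : sumTo (pairs a) N ≡ sumTo (weights a) N
      row = sumTo-tight N (λ a _ → sumTo-mono N (λ b _ → pairs≤weights a b)) YY≤Q a a<N
      tight : pairs a b ≡ weights a b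
      tight = sumTo-tight N (λ b _ → pairs≤weights a b) (≤-reflexive (sym row)) b b<N
      simp : pairs a b ≡ b2n (compat a b)
      simp rewrite ca | cb = *-identityˡ _
      simp′ : weights a b ≡ 1
      simp′ rewrite ca | cb = refl
      one : ∀ {b} → b2n b ≡ 1 → b ≡ true
      one {true} _ = refl

  -- The two flags are arguments so that disjointness and independence can be proved by matching on
  -- them.
  pick : (ℕ → Bool) → ℕ → ℕ → Bool → Bool → Bool
  pick c v zero          vertex? pair? = if vertex? then not (c v) else pair? ∧ (c (fst v) ∧ c (snd v))
  pick c v (suc zero)    vertex? pair? = if vertex? then c v else not pair? ∧ (0 ≡ᵇ v ∸ N ∸ N * N)
  pick c v (suc (suc j)) vertex? pair? = not vertex? ∧ (not pair? ∧ (suc j ≡ᵇ v ∸ N ∸ N * N))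

  member : (ℕ → Bool) → ℕ → ℕ → Bool
  member c j v = pick c v j (isVertex v) (isPair v)

  member-vertex : ∀ c {v} → v < N → member c 0 v ≡ not (c v) × member c 1 v ≡ c v
  member-vertex c lt = if-true (<ᵇ-true lt) , if-true (<ᵇ-true lt)

  member-pair : ∀ c {a b} → a < N → b < N → member c 0 (pair a b) ≡ (c a ∧ c b)
  member-pair c {a} {b} a<N b<N = trans (if-false (not-vertex (a * N + b)))
    (trans (cong (_∧ (c (fst (pair a b)) ∧ c (snd (pair a b)))) (isPair-pair (mixed-radix a<N b<N)))
      (cong₂ (λ x y → c x ∧ c y) (fst-pair {a} b<N) (snd-pair {a} b<N)))

  member-private : ∀ c j → member c (suc j) (private′ j) ≡ true
  member-private c zero rewrite not-pair-private 0 | not-vertex (N * N + 0) | m+n∸m≡n N (N * N + 0)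
                              | m+n∸m≡n (N * N) 0 = refl
  member-private c (suc j) rewrite not-pair-private (suc j) | not-vertex (N * N + suc j) | m+n∸m≡n N (N * N + suc j)
                              | m+n∸m≡n (N * N) (suc j) = ≡ᵇ-refl j

  member-disjoint : ∀ c i j v → member c i v ≡ true → member c j v ≡ true → i ≡ j
  member-disjoint c i j v = go i j (isVertex v) (isPair v)
    where
    go : ∀ i j V P → pick c v i V P ≡ true → pick c v j V P ≡ true → i ≡ j
    go zero          zero          V     P     hi hj = refl
    go (suc zero)    (suc zero)    V     P     hi hj = refl
    go zero          (suc zero)    true  P     hi hj = contradiction (trans (sym hj) (not-true hi)) λ ()
    go zero          (suc zero)    false true  hi ()
    go zero          (suc zero)    false false () hj
    go zero          (suc (suc j)) true  P     hi ()
    go zero          (suc (suc j)) false true  hi ()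
    go zero          (suc (suc j)) false false () hj
    go (suc zero)    zero          true  P     hi hj = contradiction (trans (sym hi) (not-true hj)) λ ()
    go (suc zero)    zero          false true  () hj
    go (suc zero)    zero          false false hi ()
    go (suc (suc i)) zero          true  P     () hj
    go (suc (suc i)) zero          false true  () hj
    go (suc (suc i)) zero          false false hi ()
    go (suc zero)    (suc (suc j)) true  P     hi ()
    go (suc zero)    (suc (suc j)) false true  () hj
    go (suc zero)    (suc (suc j)) false false hi hj =
      contradiction (trans (≡ᵇ-true {0} {v ∸ N ∸ N * N} hi) (sym (≡ᵇ-true {suc j} {v ∸ N ∸ N * N} hj))) λ ()
    go (suc (suc i)) (suc zero)    true  P     () hj
    go (suc (suc i)) (suc zero)    false true  () hj
    go (suc (suc i)) (suc zero)    false false hi hj =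
      contradiction (trans (≡ᵇ-true {0} {v ∸ N ∸ N * N} hj) (sym (≡ᵇ-true {suc i} {v ∸ N ∸ N * N} hi))) λ ()
    go (suc (suc i)) (suc (suc j)) true  P     () hj
    go (suc (suc i)) (suc (suc j)) false true  () hj
    go (suc (suc i)) (suc (suc j)) false false hi hj =
      cong suc (trans (≡ᵇ-true {suc i} {v ∸ N ∸ N * N} hi) (sym (≡ᵇ-true {suc j} {v ∸ N ∸ N * N} hj)))

  member-independent : ∀ c j u v → member c j u ≡ true → member c j v ≡ true → edge u v ≡ true → ⊥
  member-independent c j u v hu hv e with ∧-true {isVertex u} e
  ... | uV , e′ with ∧-true {isPair v} e′
  ...   | vP , ends = go j uV vV vP hu hv
    where
    vV : isVertex v ≡ false
    vV = not-true (proj₁ (∧-true {not (isVertex v)} vP))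
    at-end : c (fst v) ≡ true → c (snd v) ≡ true → c u ≡ true
    at-end cf cs with ∨-true {u ≡ᵇ fst v} ends
    ... | inj₁ eq = trans (cong c (≡ᵇ-true {u} eq)) cf
    ... | inj₂ eq = trans (cong c (≡ᵇ-true {u} eq)) cs
    go : ∀ j {Vu Pu Vv Pv} → Vu ≡ true → Vv ≡ false → Pv ≡ true →
         pick c u j Vu Pu ≡ true → pick c v j Vv Pv ≡ true → ⊥
    go zero refl refl refl hu hv =
      let (cf , cs) = ∧-true {c (fst v)} hv in
      contradiction (trans (sym (at-end cf cs)) (not-true hu)) λ ()
    go (suc zero)    refl refl refl hu ()
    go (suc (suc j)) refl refl refl hu ()

  clique⇒profits : ∀ {c} → IsClique N K compat c → ∀ j → j < 2 + k′ → q ≤ total (member c j) j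
  clique⇒profits {c} cl j j<k = ≤-trans (enough j j<k) (≤-reflexive (sym (total-sections (member c j) j)))
    where
    open IsClique cl
    open ≤-Reasoning
    private-term : ∀ {f : ℕ → ℕ} j → j < R → f j ≤ sumTo f R
    private-term {f} j j<R = go R j<R
      where
      go : ∀ r → j < r → f j ≤ sumTo f r
      go (suc r) lt with j ≟ r
      ... | yes refl = m≤m+n (f j) _
      ... | no  j≢r  = ≤-trans (go r (≤∧≢⇒< (s≤s⁻¹ lt) j≢r)) (m≤n+m _ (f r))
    private-value : ∀ j x → b2n (member c (suc j) (private′ j)) * (if j ≡ᵇ j then x else 0) ≡ x
    private-value j x rewrite member-private c j | ≡ᵇ-refl j = *-identityˡ x
    enough : ∀ j → j < 2 + k′ → q ≤
      sumTo (λ i → b2n (member c j i)) N * colour j M 1 0 +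
      (sumTo (λ a → sumTo (λ b → b2n (member c j (pair a b)) * colour j (b2n (compat a b)) 0 0) N) N +
       sumTo (λ i → b2n (member c j (private′ i)) * (if j ≡ᵇ suc i then colour j 0 (q ∸ K) q else 0)) R)
    enough zero _ = +-mono-≤ (≤-reflexive (cong (_* M) (sym outside))) (≤-trans (≤-reflexive (sym inside)) (m≤m+n _ _))
      where
      outside : sumTo (λ i → b2n (member c 0 i)) N ≡ N ∸ K
      outside = trans (sumTo-cong N (λ i lt → cong b2n (proj₁ (member-vertex c lt))))
        (trans (sym (m+n∸m≡n K _)) (cong (_∸ K) (trans (cong (_+ sumTo (λ i → b2n (not (c i))) N) (sym size)) (sumTo-not c N))))
      term : ∀ {a b} → a < N → b < N → b2n (member c 0 (pair a b)) * b2n (compat a b) ≡ b2n (c a) * b2n (c b)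
      term {a} {b} a<N b<N rewrite member-pair c a<N b<N with c a in ca | c b in cb
      ... | true  | true  rewrite pairwise a<N b<N ca cb = refl
      ... | true  | false = refl
      ... | false | _     = refl
      inside : sumTo (λ a → sumTo (λ b → b2n (member c 0 (pair a b)) * b2n (compat a b)) N) N ≡ K * K
      inside = trans (sumTo-cong N (λ a a<N → trans (sumTo-cong N (λ b b<N → term a<N b<N))
          (sumTo-*ˡ (λ b → b2n (c b)) (b2n (c a)) N)))
        (trans (sumTo-*ʳ (λ a → b2n (c a)) _ N) (cong₂ _*_ size size))
    enough (suc zero) _ = begin
      q                                  ≡⟨ m+[n∸m]≡n K≤q ⟨
      K + (q ∸ K)                        ≡⟨ cong (_+ (q ∸ K)) (sym size₁) ⟩
      S * 1 + (q ∸ K)                    ≤⟨ +-monoʳ-≤ (S * 1) (≤-trans (≤-reflexive (sym (private-value 0 (q ∸ K)))) (private-term {f₁} 0 (s≤s z≤n))) ⟩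
      S * 1 + sumTo f₁ R                 ≤⟨ +-monoʳ-≤ (S * 1) (m≤n+m (sumTo f₁ R)
                                           (sumTo (λ a → sumTo (λ b → b2n (member c 1 (pair a b)) * 0) N) N)) ⟩
      _                                  ∎
      where
      S = sumTo (λ i → b2n (member c 1 i)) N
      f₁ = λ i → b2n (member c 1 (private′ i)) * (if 0 ≡ᵇ i then q ∸ K else 0)
      size₁ : S * 1 ≡ K
      size₁ = trans (*-identityʳ S) (trans (sumTo-cong N (λ i lt → cong b2n (proj₂ (member-vertex c lt)))) size)
    enough (suc (suc j)) (s≤s j<R) = ≤-trans (≤-reflexive (sym (private-value (suc j) q)))
      (≤-trans (private-term {λ i → b2n (member c (2 + j) (private′ i)) * (if suc j ≡ᵇ i then q else 0)} (suc j) j<R)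
        (≤-trans (m≤n+m _ (sumTo (λ a → sumTo (λ b → b2n (member c (2 + j) (pair a b)) * 0) N) N))
          (m≤n+m _ (sumTo (λ i → b2n (member c (2 + j) i)) N * 0))))

  conflictGraph : Graph n
  conflictGraph = record
    { adjacent  = λ u v → adj (toℕ u) (toℕ v)
    ; symmetric = λ u v → Boolₚ.∨-comm (edge (toℕ u) (toℕ v)) _
    ; loopless  = λ v → no-loop (toℕ v) }
    where
    no-loop : ∀ v → adj v v ≡ false
    no-loop v with isVertex v
    ... | true  = refl
    ... | false = refl

  instance′ : FairInstance (2 + k′)
  instance′ = record { n = n ; G = conflictGraph ; p = λ j v → prof (toℕ j) (toℕ v) ; q = q }

  bipartite : Bipartite conflictGraph
  bipartite = A , indepA , indepB
    where
    A : Subset n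
    A = Vec.tabulate (λ v → isVertex (toℕ v))
    in-A : ∀ {v} → v ∈ A → isVertex (toℕ v) ≡ true
    in-A {v} v∈A = trans (sym (Vecₚ.lookup∘tabulate (λ v → isVertex (toℕ v)) v)) (∈⇒lookup v∈A)
    not-in-A : ∀ {v} → v ∈ ∁ A → isVertex (toℕ v) ≡ false
    not-in-A {v} v∈∁A = trans (sym (Vecₚ.lookup∘tabulate (λ v → isVertex (toℕ v)) v)) (∈∁⇒lookup v∈∁A)
    no-edge : ∀ {u v} → isVertex u ≡ isVertex v → edge u v ≡ false
    no-edge {u} {v} eq rewrite eq with isVertex v
    ... | true  = refl
    ... | false = refl
    no-adj : ∀ {u v} → isVertex u ≡ isVertex v → ¬ T (adj u v)
    no-adj {u} {v} eq rewrite no-edge {u} {v} eq | no-edge {v} {u} (sym eq) = id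
    indepA : Independent conflictGraph A
    indepA u v u∈ v∈ = no-adj {toℕ u} {toℕ v} (trans (in-A u∈) (sym (in-A v∈)))
    indepB : Independent conflictGraph (∁ A)
    indepB u v u∈ v∈ = no-adj {toℕ u} {toℕ v} (trans (not-in-A u∈) (sym (not-in-A v∈)))

  Yes : Set
  Yes = DecisionProblem.Yes (FairDivision (2 + k′)) instance′

  clique⇒yes : ∀ {c} → IsClique N K compat c → Yes
  clique⇒yes {c} cl = colouring , minimum-glb (λ j → profit (λ v → prof (toℕ j) (toℕ v)) (X j)) λ j →
    subst (q ≤_) (sym (profit-sum _ (X j) _ λ v →
      cong (λ b → b2n b * prof (toℕ j) (toℕ v)) (Vecₚ.lookup∘tabulate (λ v → member c (toℕ j) (toℕ v)) v)))
      (clique⇒profits cl (toℕ j) (Finₚ.toℕ<n j))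
    where
    X : Fin (2 + k′) → Subset n
    X j = Vec.tabulate (λ v → member c (toℕ j) (toℕ v))
    in-X : ∀ j {v} → v ∈ X j → member c (toℕ j) (toℕ v) ≡ true
    in-X j {v} v∈ = trans (sym (Vecₚ.lookup∘tabulate (λ v → member c (toℕ j) (toℕ v)) v)) (∈⇒lookup v∈)
    colouring : PartialColoring (2 + k′) conflictGraph
    colouring = record
      { X = X
      ; independent = λ j u v u∈ v∈ t → [ member-independent c (toℕ j) (toℕ u) (toℕ v) (in-X j u∈) (in-X j v∈)
                                        , member-independent c (toℕ j) (toℕ v) (toℕ u) (in-X j v∈) (in-X j u∈) ]′
                                        (∨-true {edge (toℕ u) (toℕ v)} (T⇒true t))
      ; disjoint = λ i j i≢j (v , v∈) → let (v∈i , v∈j) = x∈p∩q⁻ (X i) (X j) v∈ in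
          i≢j (Finₚ.toℕ-injective (member-disjoint c (toℕ i) (toℕ j) (toℕ v) (in-X i v∈i) (in-X j v∈j))) }

  -- The clique consists of the vertices that the first class leaves out. It need not be the second
  -- class, which only keeps K vertices away from the first.
  yes⇒clique : Yes → ∃ (IsClique N K compat)
  yes⇒clique (C , sat) = _ , colouring⇒clique (x zero) (x (suc zero)) disj indep (profits zero) (profits (suc zero))
    where
    open PartialColoring C
    x : Fin (2 + k′) → ℕ → Bool
    x j = nth false (Vec.toList (X j))
    profits : ∀ j → q ≤ total (x j) (toℕ j)
    profits j = subst (q ≤_) (profit-sum _ (X j) _ λ v → cong (λ b → b2n b * prof (toℕ j) (toℕ v)) (sym (nth-toList false (X j) v)))
      (minimum-lower (λ j → profit (λ v → prof (toℕ j) (toℕ v)) (X j)) sat j)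
    x⇒∈ : ∀ {j v} (v<n : v < n) → x j v ≡ true → Fin.fromℕ< v<n ∈ X j
    x⇒∈ {j} {v} v<n eq = lookup⇒∈ (trans (sym (nth-toList false (X j) _)) (trans (cong (x j) (Finₚ.toℕ-fromℕ< v<n)) eq))
    vertex<n : ∀ {v} → v < N → v < n
    vertex<n lt = ≤-trans lt (m≤m+n N _)
    disj : ∀ {v} → v < N → x zero v ≡ true → x (suc zero) v ≡ true → ⊥
    disj lt h₀ h₁ = disjoint zero (suc zero) (λ ())
      (_ , x∈p∩q⁺ (x⇒∈ (vertex<n lt) h₀ , x⇒∈ (vertex<n lt) h₁))
    adjacent-end : ∀ {u a b} → u < N → a < N → b < N → u ≡ a ⊎ u ≡ b → T (adj u (pair a b))
    adjacent-end {u} {a} {b} u<N a<N b<N e = subst (λ z → T (z ∨ edge (pair a b) u)) (sym (cong₂ _∧_ (<ᵇ-true u<N)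
      (cong₂ _∧_ (isPair-pair (mixed-radix a<N b<N)) (trans
        (cong₂ (λ x y → (u ≡ᵇ x) ∨ (u ≡ᵇ y)) (fst-pair {a} b<N) (snd-pair {a} b<N)) (end e))))) tt
      where
      end : u ≡ a ⊎ u ≡ b → ((u ≡ᵇ a) ∨ (u ≡ᵇ b)) ≡ true
      end (inj₁ refl) rewrite ≡ᵇ-refl u = refl
      end (inj₂ refl) rewrite ≡ᵇ-refl u = Boolₚ.∨-zeroʳ _
    avoids : ∀ {u a b} → u < N → a < N → b < N → u ≡ a ⊎ u ≡ b → x zero (pair a b) ≡ true → x zero u ≡ false
    avoids {u} {a} {b} u<N a<N b<N e h with x zero u in eq
    ... | false = refl
    ... | true  = ⊥-elim (independent zero _ _ (x⇒∈ (vertex<n u<N) eq) (x⇒∈ (pair<n a<N b<N) h)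
      (subst₂ (λ s t → T (adj s t)) (sym (Finₚ.toℕ-fromℕ< (vertex<n u<N))) (sym (Finₚ.toℕ-fromℕ< (pair<n a<N b<N)))
        (adjacent-end u<N a<N b<N e)))
    indep : ∀ {a b} → a < N → b < N → x zero (pair a b) ≡ true → x zero a ≡ false × x zero b ≡ false
    indep a<N b<N h = avoids a<N a<N b<N (inj₁ refl) h , avoids b<N a<N b<N (inj₂ refl) h

-- The encoding of the instance of a clique problem

concat-tabulate : ∀ (F : ℕ → Bits) n → concat (tabulate {n = n} (λ u → F (toℕ u))) ≡ concatUpTo F n
concat-tabulate F zero    = refl
concat-tabulate F (suc n) = cong (F 0 ++_) (concat-tabulate (F ∘ suc) n)

tabulate-bits : ∀ (f : ℕ → Bool) n → tabulate {n = n} (λ v → f (toℕ v)) ≡ concatUpTo (λ v → f v ∷ []) n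
tabulate-bits f zero    = refl
tabulate-bits f (suc n) = cong (f 0 ∷_) (tabulate-bits (f ∘ suc) n)

replicate-true : ∀ n → replicate n true ≡ concatUpTo (λ _ → true ∷ []) n
replicate-true zero    = refl
replicate-true (suc n) = cong (true ∷_) (replicate-true n)

encodeNumbers : List ℕ → Bits
encodeNumbers ns = concat (map encodeNumber ns)

encodeNumbers-++ : ∀ xs ys → encodeNumbers (xs ++ ys) ≡ encodeNumbers xs ++ encodeNumbers ys
encodeNumbers-++ []       ys = refl
encodeNumbers-++ (x ∷ xs) ys =
  trans (cong (encodeNumber x ++_) (encodeNumbers-++ xs ys)) (sym (Listₚ.++-assoc (encodeNumber x) _ _))

encodeNumbers-tabulate : ∀ (f : ℕ → ℕ) n →
  encodeNumbers (tabulate {n = n} (λ v → f (toℕ v))) ≡ concatUpTo (λ v → encodeNumber (f v)) n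
encodeNumbers-tabulate f zero    = refl
encodeNumbers-tabulate f (suc n) = cong (encodeNumber (f 0) ++_) (encodeNumbers-tabulate (f ∘ suc) n)

encodeNumbers-table : ∀ (f : ℕ → ℕ → ℕ) k n →
  encodeNumbers (concat (tabulate {n = k} λ j → tabulate {n = n} λ v → f (toℕ j) (toℕ v))) ≡
  concatUpTo (λ j → concatUpTo (λ v → encodeNumber (f j v)) n) k
encodeNumbers-table f zero    n = refl
encodeNumbers-table f (suc k) n = trans (encodeNumbers-++ (tabulate {n = n} λ v → f 0 (toℕ v)) _)
  (cong₂ _++_ (encodeNumbers-tabulate (f 0) n) (encodeNumbers-table (f ∘ suc) k n))

length-concat-tabulate : ∀ {A : Set} {m n} (F : Fin m → List A) → (∀ u → length (F u) ≡ n) →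
                         length (concat (tabulate F)) ≡ m * n
length-concat-tabulate {m = zero}  F h = refl
length-concat-tabulate {m = suc m} F h = trans (Listₚ.length-++ (F zero))
  (cong₂ _+_ (h zero) (length-concat-tabulate (F ∘ suc) (h ∘ suc)))

length-encodeGraph : ∀ {n} (G : Graph n) → length (encodeGraph G) ≡ n + suc (n * n)
length-encodeGraph {n} G = trans (Listₚ.length-++ (replicate n true)) (cong₂ _+_ (Listₚ.length-replicate n)
  (cong suc (length-concat-tabulate (λ u → tabulate (adjacent G u)) (λ u → Listₚ.length-tabulate (adjacent G u)))))

encodeFair : ∀ {k} → FairInstance k → Bits
encodeFair {k} = DecisionProblem.encode (FairDivision k)

module CliqueReduction (N K : Bits → ℕ) (compat : Bits → ℕ → ℕ → Bool) (k′ : ℕ)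
                       (NC : ∀ {n} → Comp {n} (λ w ρ → N w)) (KC : ∀ {n} → Comp {n} (λ w ρ → K w))
                       (compatB : Comp {2} (λ w ρ → b2n (compat w (ρ #0) (ρ #1)))) where

  module C (w : Bits) = Clique (N w) (K w) (compat w) k′

  nC : ∀ {n} → Comp {n} (λ w ρ → C.n w)
  nC = NC +C (NC *C NC +C litC (suc k′))

  MC : ∀ {n} → Comp {n} (λ w ρ → C.M w)
  MC = sucC (NC *C NC)

  qC : ∀ {n} → Comp {n} (λ w ρ → C.q w)
  qC = (NC ∸C KC) *C MC +C KC *C KC

  module _ {n : ℕ} {f : Fun n} (F : Comp f) where

    fstC : Comp (λ w ρ → C.fst w (f w ρ))
    fstC = divC (F ∸C NC) NC

    sndC : Comp (λ w ρ → C.snd w (f w ρ))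
    sndC = modC (F ∸C NC) NC

    isVertexB : CompB (λ w ρ → C.isVertex w (f w ρ))
    isVertexB = F <B NC

    isPairB : CompB (λ w ρ → C.isPair w (f w ρ))
    isPairB = notB (F <B NC) ∧B (F ∸C NC) <B (NC *C NC)

  edgeB : ∀ {n} {f g : Fun n} → Comp f → Comp g → CompB (λ w ρ → C.edge w (f w ρ) (g w ρ))
  edgeB F G = isVertexB F ∧B (isPairB G ∧B (F ≡B fstC G ∨B F ≡B sndC G))

  adjB : ∀ {n} {f g : Fun n} → Comp f → Comp g → CompB (λ w ρ → C.adj w (f w ρ) (g w ρ))
  adjB F G = edgeB F G ∨B edgeB G F

  colourC : ∀ {n} {j x y z : Fun n} → Comp j → Comp x → Comp y → Comp z →
            Comp (λ w ρ → C.colour w (j w ρ) (x w ρ) (y w ρ) (z w ρ))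
  colourC {j = j} J X Y Z = congC (λ w ρ → lemma w (j w ρ)) (ifC (J ≡B litC 0) X (ifC (J ≡B litC 1) Y Z))
    where
    lemma : ∀ w j {x y z} → (if j ≡ᵇ 0 then x else if j ≡ᵇ 1 then y else z) ≡ C.colour w j x y z
    lemma w zero          = refl
    lemma w (suc zero)    = refl
    lemma w (suc (suc j)) = refl

  profC : ∀ {n} {j v : Fun n} → Comp j → Comp v → Comp (λ w ρ → C.prof w (j w ρ) (v w ρ))
  profC J V = ifC (isVertexB V) (colourC J MC (litC 1) (litC 0))
    (ifC (isPairB V) (colourC J (app₂ {g = λ w a b → b2n (compat w a b)} compatB (fstC V) (sndC V)) (litC 0) (litC 0))
      (ifC (J ≡B sucC (V ∸C NC ∸C NC *C NC)) (colourC J (litC 0) (qC ∸C KC) qC) (litC 0)))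

  I : Bits → FairInstance (2 + k′)
  I w = C.instance′ w

  encodeO : Out {0} (λ w ρ → encodeFair (I w))
  encodeO = congO (λ w ρ → sym (layout w))
    ((forO nC (emitO true) ++O emitO false ++O forO nC (forO nC (bitO (adjB (varC #1) (varC #0))))) ++O
     numberO qC ++O forO (litC (2 + k′)) (forO nC (numberO (profC (varC #1) (varC #0)))))
    where
    layout : ∀ w → let open C w in encodeFair (I w) ≡
      (concatUpTo (λ _ → true ∷ []) n ++ (false ∷ []) ++ concatUpTo (λ u → concatUpTo (λ v → adj u v ∷ []) n) n) ++
      encodeNumber q ++ concatUpTo (λ j → concatUpTo (λ v → encodeNumber (prof j v)) n) (2 + k′)
    layout w = cong₂ _++_
      (cong₂ _++_ (replicate-true n) (cong (false ∷_)
        (trans (concat-tabulate (λ u → tabulate {n = n} λ v → adj u (toℕ v)) n)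
          (concatUpTo-cong n (λ u _ → tabulate-bits (adj u) n)))))
      (cong (encodeNumber q ++_) (encodeNumbers-table prof (2 + k′) n))
      where open C w

  -- As n ≥ N + N² + 1, the square n² exceeds M and, since K ≤ N, also q. These n² are already among
  -- the bits of the encoded graph.
  numbers≤ : ∀ w → K w ≤ N w → NumbersBounded (FairDivision (2 + k′)) (0 ∷ 1 ∷ []) (I w)
  numbers≤ w K≤N = bounded q≤ ∷ Allₚ.concat⁺ (Allₚ.tabulate⁺ {n = 2 + k′} {f = λ j → tabulate {n = n} λ v → prof (toℕ j) (toℕ v)}
    λ j → Allₚ.tabulate⁺ {f = λ v → prof (toℕ j) (toℕ v)} λ v → bounded (prof≤ (toℕ j) (toℕ v)))
    where
    open C w
    open ≤-Reasoning
    s = N w + (N w * N w + 1)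
    s≤n : s ≤ n
    s≤n = +-monoʳ-≤ (N w) (+-monoʳ-≤ (N w * N w) (s≤s z≤n))
    expand : ∀ x → (x + (x * x + 1)) * (x + (x * x + 1)) ≡ x * suc (x * x) + x * x + (x * x * (x * x) + x * x * x + x * x + x + suc (x * x))
    expand = solve-∀
    big≤ : N w * M + N w * N w ≤ n * n
    big≤ = ≤-trans (≤-trans (m≤m+n _ _) (≤-reflexive (sym (expand (N w))))) (*-mono-≤ s≤n s≤n)
    M≤ : M ≤ n * n
    M≤ = ≤-trans (≤-trans (m≤n+m M (N w * N w * (N w * N w) + N w * N w * N w + N w * N w + N w))
      (≤-trans (m≤n+m _ (N w * M + N w * N w)) (≤-reflexive (sym (expand (N w)))))) (*-mono-≤ s≤n s≤n)
    q≤ : q ≤ n * n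
    q≤ = ≤-trans (+-mono-≤ (*-monoˡ-≤ M (m∸n≤m (N w) (K w))) (*-mono-≤ K≤N K≤N)) big≤
    1≤ : 1 ≤ n * n
    1≤ = ≤-trans (s≤s z≤n) M≤
    if≤ : ∀ b {x y z} → x ≤ z → y ≤ z → (if b then x else y) ≤ z
    if≤ true  hx hy = hx
    if≤ false hx hy = hy
    colour≤ : ∀ j {x y z} → x ≤ n * n → y ≤ n * n → z ≤ n * n → colour j x y z ≤ n * n
    colour≤ zero          hx hy hz = hx
    colour≤ (suc zero)    hx hy hz = hy
    colour≤ (suc (suc j)) hx hy hz = hz
    prof≤ : ∀ j v → prof j v ≤ n * n
    prof≤ j v = if≤ (isVertex v) (colour≤ j M≤ 1≤ z≤n) (if≤ (isPair v)
      (colour≤ j (≤-trans (b2n≤1 (compat w (fst v) (snd v))) 1≤) z≤n z≤n)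
      (if≤ (j ≡ᵇ suc (v ∸ N w ∸ N w * N w)) (colour≤ j z≤n (≤-trans (m∸n≤m q (K w)) q≤) q≤) z≤n))
    bounded : ∀ {x} → x ≤ n * n → x ≤ eval (0 ∷ 1 ∷ []) (length (encodeFair (I w)))
    bounded {x} le = begin
      x                                                    ≤⟨ le ⟩
      n * n                                                ≤⟨ n≤1+n _ ⟩
      suc (n * n)                                          ≤⟨ m≤n+m _ n ⟩
      n + suc (n * n)                                      ≡⟨ length-encodeGraph conflictGraph ⟨
      length (encodeGraph conflictGraph)                   ≤⟨ m≤m+n _ _ ⟩
      length (encodeGraph conflictGraph) + _               ≡⟨ Listₚ.length-++ (encodeGraph conflictGraph) ⟨
      length (encodeFair (I w))                            ≤⟨ proj₂ pb-id _ ⟩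
      eval (0 ∷ 1 ∷ []) (length (encodeFair (I w)))        ∎

-- The tableau of a computation

eqF : ∀ {A : Set} → Finite A → A → A → Bool
eqF F a b = toℕ (code F a) ≡ᵇ toℕ (code F b)

eqF-refl : ∀ {A : Set} (F : Finite A) {a b} → a ≡ b → eqF F a b ≡ true
eqF-refl F {a} refl = ≡ᵇ-refl (toℕ (code F a))

eqF-sound : ∀ {A : Set} (F : Finite A) {a b} → eqF F a b ≡ true → a ≡ b
eqF-sound F {a} {b} eq = trans (sym (decode∘code F a))
  (trans (cong (decode F) (Finₚ.toℕ-injective (≡ᵇ-true eq))) (decode∘code F b))

Move-finite : Finite Move
Move-finite = retract-finite (λ { left → nothing ; stay → just true ; right → just false })
  (maybe (λ b → if b then stay else right) left) (λ { left → refl ; stay → refl ; right → refl })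
  (Maybe-finite Bool-finite)

allF : ∀ {n} → (Fin n → Bool) → Bool
allF {zero}  f = true
allF {suc n} f = f zero ∧ allF (f ∘ suc)

∧-intro : ∀ {a b} → a ≡ true → b ≡ true → (a ∧ b) ≡ true
∧-intro refl refl = refl

⇒-intro : ∀ {a b} → (a ≡ true → b ≡ true) → (a ⇒ᵇ b) ≡ true
⇒-intro {true}  h = h refl
⇒-intro {false} h = refl

⇒-elim : ∀ a {b} → (a ⇒ᵇ b) ≡ true → a ≡ true → b ≡ true
⇒-elim true h refl = h

and-elim : ∀ l → and l ≡ true → ∀ i → nth true l i ≡ true
and-elim []          h i       = refl
and-elim (true ∷ l)  h zero    = refl
and-elim (true ∷ l)  h (suc i) = and-elim l h i

and-intro : ∀ {l} → All (_≡ true) l → and l ≡ true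
and-intro []       = refl
and-intro (h ∷ hs) = ∧-intro h (and-intro hs)

allF-intro : ∀ {n} {f : Fin n → Bool} → (∀ j → f j ≡ true) → allF f ≡ true
allF-intro {zero}  h = refl
allF-intro {suc n} h = ∧-intro (h zero) (allF-intro (h ∘ suc))

allF-elim : ∀ {n} {f : Fin n → Bool} → allF f ≡ true → ∀ j → f j ≡ true
allF-elim {suc n} {f} h zero    = proj₁ (∧-true {f zero} h)
allF-elim {suc n} {f} h (suc j) = allF-elim (proj₂ (∧-true {f zero} h)) j

vec-ext : ∀ {A : Set} {n} {u v : Vec A n} → (∀ j → lookup u j ≡ lookup v j) → u ≡ v
vec-ext {u = []}    {[]}    h = refl
vec-ext {u = x ∷ u} {y ∷ v} h = cong₂ _∷_ (h zero) (vec-ext (h ∘ suc))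

rel-+ : ∀ v e → rel (v + e) v ≡ ⁺ e
rel-+ zero    e = refl
rel-+ (suc v) e = rel-+ v e

rel-< : ∀ {p v} → p < v → ∃ λ i → rel p v ≡ -[1+ i ]
rel-< {zero}  {suc v} lt       = v , refl
rel-< {suc p} {suc v} (s≤s lt) = rel-< lt

-- Old and new offset of a cell when the head moves.
data Moves : Move → ℕ → ℕ → Set where
  leftwards  : ∀ {d} → Moves left d (suc d)
  inPlace    : ∀ {d} → Moves stay d d
  rightwards : ∀ {d} → Moves right (suc d) d

-- Seen from the head, a step shifts the whole tape by the head move and changes only the symbol
-- that was at index D, the place of the head.
at-step : ∀ {a m d d′} D (t : Tape a) s → Moves m d d′ →
          at (move m (write s t)) (rel d′ D) ≡ (if d ≡ᵇ D then s else at t (rel d D))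
at-step {m = m} {d} {d′} D t s mv = trans (at-move m (write s t) (rel d′ D))
  (trans (cong (at (write s t)) (shifted mv)) written)
  where
  shifted : ∀ {m d d′} → Moves m d d′ → shift m (rel d′ D) ≡ rel d D
  shifted (leftwards {d})  = shift-left-rel (suc d) D
  shifted inPlace          = refl
  shifted (rightwards {d}) = shift-right-rel (suc d) D
  written : at (write s t) (rel d D) ≡ (if d ≡ᵇ D then s else at t (rel d D))
  written with d ≡ᵇ D in eq
  ... | true  rewrite ≡ᵇ-true {d} {D} eq = at-write-here t s D
  ... | false = at-write-rel t s {d} {D} λ { refl → contradiction (trans (sym (≡ᵇ-refl d)) eq) λ () }

module _ (M : TM) where
  open TM M

  perhaps : Config M → Maybe (Config M) → Config M
  perhaps c = maybe id c

  -- A halted configuration is repeated, so the result can be inspected at one fixed time even if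
  -- the machine halts earlier.
  advance : Config M → Config M
  advance c = perhaps c (step M c)

  run : Config M → ℕ → Config M
  run c zero    = c
  run c (suc t) = advance (run c t)

  run-front : ∀ c t → run c (suc t) ≡ run (advance c) t
  run-front c zero    = refl
  run-front c (suc t) = cong advance (run-front c t)

  halts⇒run : ∀ {t c d} → HaltsWithin M t c d → ∀ t′ → t ≤ t′ → run c t′ ≡ d
  halts⇒run (halted e) t′ le = stuck t′
    where
    stuck : ∀ t → run _ t ≡ _
    stuck zero    = refl
    stuck (suc t) rewrite stuck t | e = refl
  halts⇒run {c = c} (next e h) (suc t′) (s≤s le) = trans (run-front c t′)
    (trans (cong (λ m → run (perhaps c m) t′) e) (halts⇒run h t′ le))

length-delimit : ∀ x → length (delimit x) ≡ suc (2 * length x)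
length-delimit []      = refl
length-delimit (b ∷ x) = cong suc (trans (cong suc (length-delimit x)) (sym (+-suc (suc (length x)) (length x + 0))))

-- In the delimited form the odd positions carry x, while the even positions say whether another bit
-- follows.
delimitBit : Bits → ℕ → Bool
delimitBit x e = if oddᵇ e then nth false x ⌊ e /2⌋ else ⌊ e /2⌋ <ᵇ length x

nth-delimit : ∀ x e → nth false (delimit x) e ≡ delimitBit x e
nth-delimit []      zero          = refl
nth-delimit []      (suc e) with oddᵇ (suc e)
... | true  = refl
... | false = sym (<ᵇ-false {⌊ suc e /2⌋} z≤n)
nth-delimit (b ∷ x) zero          = refl
nth-delimit (b ∷ x) (suc zero)    = refl
nth-delimit (b ∷ x) (suc (suc e)) rewrite nth-delimit x e | Boolₚ.not-involutive (oddᵇ e) = refl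

nth-map : ∀ {A B : Set} (f : A → B) {d d′} l {i} → i < length l → nth d (map f l) i ≡ f (nth d′ l i)
nth-map f (x ∷ l) {zero}  lt       = refl
nth-map f (x ∷ l) {suc i} (s≤s lt) = nth-map f l lt

nth-beyond : ∀ {A : Set} {d : A} l {i} → length l ≤ i → nth d l i ≡ d
nth-beyond []      le       = refl
nth-beyond (x ∷ l) {suc i} (s≤s le) = nth-beyond l le

nth-++ˡ : ∀ {A : Set} {d : A} l r {i} → i < length l → nth d (l ++ r) i ≡ nth d l i
nth-++ˡ (x ∷ l) r {zero}  lt       = refl
nth-++ˡ (x ∷ l) r {suc i} (s≤s lt) = nth-++ˡ l r lt

nth-++ʳ : ∀ {A : Set} {d : A} l r i → nth d (l ++ r) (length l + i) ≡ nth d r i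
nth-++ʳ []      r i = refl
nth-++ʳ (x ∷ l) r i = nth-++ʳ l r i

module Tableau (M : TM) (r p : Polynomial) where
  open TM M

  ntapes : ℕ
  ntapes = suc workTapes

  Cell : Set
  Cell = Symbol auxSymbols

  -- State and scanned symbols at some time, and the symbols on all tapes at
  -- some offset from the heads.
  Φ : Set
  Φ = Fin states × (Vec Cell ntapes × Vec Cell ntapes)

  Cells-finite : Finite (Vec Cell ntapes)
  Cells-finite = Vec-finite ntapes (Symbol-finite auxSymbols)

  Φ-finite : Finite Φ
  Φ-finite = ×-finite (Fin-finite states) (×-finite Cells-finite Cells-finite)

  F : ℕ
  F = card Φ-finite

  stateOf : Φ → Fin states
  stateOf = proj₁

  scannedOf contents : Φ → Vec Cell ntapes
  scannedOf = proj₁ ∘ proj₂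
  contents = proj₂ ∘ proj₂

  -- A halted machine idles.
  transition : Fin states → Vec Cell ntapes → Fin states × Vec (Cell × Move) ntapes
  transition s σ = Maybe.fromMaybe (s , Vec.map (λ c → c , stay) σ) (δ s σ)

  actions : Φ → Vec (Cell × Move) ntapes
  actions φ = proj₂ (transition (stateOf φ) (scannedOf φ))

  onlyFirst : Cell → Vec Cell ntapes
  onlyFirst c = c ∷ Vec.replicate workTapes blank

  sameControl nextState blankNext : Φ → Φ → Bool
  sameControl φ φ′ = eqF (Fin-finite states) (stateOf φ) (stateOf φ′) ∧ eqF Cells-finite (scannedOf φ) (scannedOf φ′)
  nextState φ φ′ = eqF (Fin-finite states) (proj₁ (transition (stateOf φ) (scannedOf φ))) (stateOf φ′)
  blankNext φ φ′ = eqF Cells-finite (contents φ) (onlyFirst blank) ⇒ᵇ eqF Cells-finite (contents φ′) (onlyFirst blank)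

  -- Each tape has its own move, so the rule for m speaks only of the tapes whose head makes this
  -- move. The flag h tells that the old cell is the scanned one, which has been overwritten.
  moved : Move → Bool → Φ → Φ → Bool
  moved m h φ φ′ = allF λ j → eqF Move-finite (proj₂ (lookup (actions φ) j)) m ⇒ᵇ
    eqF (Symbol-finite auxSymbols) (lookup (contents φ′) j)
      (if h then proj₁ (lookup (actions φ) j) else lookup (contents φ) j)

  atHead isStart accepts : Φ → Bool
  atHead φ = eqF Cells-finite (contents φ) (scannedOf φ)
  isStart φ = eqF (Fin-finite states) (stateOf φ) start
  accepts φ = eqF (Symbol-finite auxSymbols) (lookup (scannedOf φ) zero) (bit true)

  is : Cell → Φ → Bool
  is c φ = eqF Cells-finite (contents φ) (onlyFirst c)

  table₁ : (Φ → Bool) → List Bool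
  table₁ P = tabulate λ i → P (decode Φ-finite i)

  table₂ : (Φ → Φ → Bool) → List (List Bool)
  table₂ P = tabulate λ i → table₁ (P (decode Φ-finite i))

  opaque
    -- Opaque, so that tables over all contents stay folded during type checking.
    tab₁ : (Φ → Bool) → ℕ → Bool
    tab₁ P f = nth false (table₁ P) f

    tab₂ : (Φ → Φ → Bool) → ℕ → ℕ → Bool
    tab₂ P f f′ = nth false (nth [] (table₂ P) f) f′

  module Input (x : Bits) where

    -- E is the length of the delimited x, Y bounds the certificate, `len` the verifier's whole
    -- input and T′ its time. The window has the heads at index D; the radius D = T′ + len holds the
    -- input and keeps the rim more than T′ steps away.
    E Y len T′ D W K N : ℕ
    E = suc (2 * length x)
    Y = eval p (length x)
    len = E + Y
    T′ = eval r len
    D = T′ + len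
    W = suc (D + D)
    K = suc T′ * W
    N = K * F

    initialRule : ℕ → ℕ → Bool
    initialRule d f =
      if d <ᵇ D then tab₁ (is blank) f else
      if d <ᵇ D + E then (if delimitBit x (d ∸ D) then tab₁ (is (bit true)) f else tab₁ (is (bit false)) f) else
      if d <ᵇ D + len then tab₁ (is blank) f ∨ (tab₁ (is (bit true)) f ∨ tab₁ (is (bit false)) f) else
      tab₁ (is blank) f

    movedRule : Move → ℕ → ℕ → ℕ → Bool
    movedRule m d f f′ = if d ≡ᵇ D then tab₂ (moved m true) f f′ else tab₂ (moved m false) f f′

    ruleList : ℕ → ℕ → ℕ → ℕ → ℕ → ℕ → List Bool
    ruleList t d f t′ d′ f′ =
      -- Two contents of one cell exclude each other. As there are K cells, a clique of size K then
      -- uses every cell exactly once.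
      (((t ≡ᵇ t′) ∧ (d ≡ᵇ d′)) ⇒ᵇ (f ≡ᵇ f′)) ∷
      ((t ≡ᵇ t′) ⇒ᵇ tab₂ sameControl f f′) ∷
      ((suc t ≡ᵇ t′) ⇒ᵇ tab₂ nextState f f′) ∷
      (((suc t ≡ᵇ t′) ∧ (suc d ≡ᵇ d′)) ⇒ᵇ movedRule left d f f′) ∷
      (((suc t ≡ᵇ t′) ∧ (d ≡ᵇ d′)) ⇒ᵇ movedRule stay d f f′) ∷
      (((suc t ≡ᵇ t′) ∧ (d ≡ᵇ suc d′)) ⇒ᵇ movedRule right d f f′) ∷
      ((d ≡ᵇ D) ⇒ᵇ tab₁ atHead f) ∷
      ((t ≡ᵇ 0) ⇒ᵇ tab₁ isStart f) ∷
      ((t ≡ᵇ 0) ⇒ᵇ initialRule d f) ∷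
      -- From the certificate on, a blank is followed by blanks only; without gaps the guessed
      -- symbols form a bit string.
      (((t ≡ᵇ 0) ∧ ((t′ ≡ᵇ 0) ∧ ((suc d ≡ᵇ d′) ∧ not (d <ᵇ D + E)))) ⇒ᵇ tab₂ blankNext f f′) ∷
      ((t ≡ᵇ T′) ⇒ᵇ tab₁ accepts f) ∷ []

    rules : ℕ → ℕ → ℕ → ℕ → ℕ → ℕ → Bool
    rules t d f t′ d′ f′ = and (ruleList t d f t′ d′ f′)

    time offset content : ℕ → ℕ
    time u = div (div u F) W
    offset u = mod (div u F) W
    content u = mod u F

    compat : ℕ → ℕ → Bool
    compat u u′ = rules (time u) (offset u) (content u) (time u′) (offset u′) (content u′)

  open Input public

  EC : ∀ {n} → Comp {n} (λ w ρ → E w)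
  EC = sucC (litC 2 *C lengthC)

  lenC : ∀ {n} → Comp {n} (λ w ρ → len w)
  lenC = EC +C evalC p lengthC

  TC : ∀ {n} → Comp {n} (λ w ρ → T′ w)
  TC = evalC r lenC

  DC : ∀ {n} → Comp {n} (λ w ρ → D w)
  DC = TC +C lenC

  WC : ∀ {n} → Comp {n} (λ w ρ → W w)
  WC = sucC (DC +C DC)

  KC : ∀ {n} → Comp {n} (λ w ρ → K w)
  KC = sucC TC *C WC

  NC : ∀ {n} → Comp {n} (λ w ρ → N w)
  NC = KC *C litC F

  opaque
    unfolding tab₁

    tab₁B : ∀ {n} {f : Fun n} P → Comp f → CompB (λ w ρ → tab₁ P (f w ρ))
    tab₁B P = nthB (table₁ P)

    tab₂B : ∀ {n} {f g : Fun n} P → Comp f → Comp g → CompB (λ w ρ → tab₂ P (f w ρ) (g w ρ))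
    tab₂B P = nthB₂ (table₂ P)

  delimitBitB : ∀ {n} {e : Fun n} → Comp e → CompB (λ w ρ → delimitBit w (e w ρ))
  delimitBitB e = ifB (oddB e) (bitB (halfC e)) (halfC e <B lengthC)

  initialB : ∀ {n} {d f : Fun n} → Comp d → Comp f → CompB (λ w ρ → initialRule w (d w ρ) (f w ρ))
  initialB d f =
    ifB (d <B DC) (tab₁B (is blank) f)
    (ifB (d <B (DC +C EC)) (ifB (delimitBitB (d ∸C DC)) (tab₁B (is (bit true)) f) (tab₁B (is (bit false)) f))
    (ifB (d <B (DC +C lenC)) (tab₁B (is blank) f ∨B (tab₁B (is (bit true)) f ∨B tab₁B (is (bit false)) f))
    (tab₁B (is blank) f)))

  movedB : ∀ {n} {d f f′ : Fun n} m → Comp d → Comp f → Comp f′ →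
           CompB (λ w ρ → movedRule w m (d w ρ) (f w ρ) (f′ w ρ))
  movedB m d f f′ = ifB (d ≡B DC) (tab₂B (moved m true) f f′) (tab₂B (moved m false) f f′)

  rulesB : ∀ {n} {t d f t′ d′ f′ : Fun n} → Comp t → Comp d → Comp f → Comp t′ → Comp d′ → Comp f′ →
           CompB (λ w ρ → rules w (t w ρ) (d w ρ) (f w ρ) (t′ w ρ) (d′ w ρ) (f′ w ρ))
  rulesB t d f t′ d′ f′ =
    ((t ≡B t′ ∧B d ≡B d′) ⇒B f ≡B f′) ∧B
    (t ≡B t′ ⇒B tab₂B sameControl f f′) ∧B
    (sucC t ≡B t′ ⇒B tab₂B nextState f f′) ∧B
    ((sucC t ≡B t′ ∧B sucC d ≡B d′) ⇒B movedB left d f f′) ∧B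
    ((sucC t ≡B t′ ∧B d ≡B d′) ⇒B movedB stay d f f′) ∧B
    ((sucC t ≡B t′ ∧B d ≡B sucC d′) ⇒B movedB right d f f′) ∧B
    (d ≡B DC ⇒B tab₁B atHead f) ∧B
    (t ≡B litC 0 ⇒B tab₁B isStart f) ∧B
    (t ≡B litC 0 ⇒B initialB d f) ∧B
    ((t ≡B litC 0 ∧B (t′ ≡B litC 0 ∧B (sucC d ≡B d′ ∧B notB (d <B (DC +C EC))))) ⇒B tab₂B blankNext f f′) ∧B
    (t ≡B TC ⇒B tab₁B accepts f) ∧B
    constB true

  compatB : Comp {2} (λ w ρ → b2n (compat w (ρ #0) (ρ #1)))
  compatB = rulesB (timeC (varC #0)) (offsetC (varC #0)) (contentC (varC #0))
                   (timeC (varC #1)) (offsetC (varC #1)) (contentC (varC #1))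
    where
    timeC : {f : Fun 2} → Comp f → Comp (λ w ρ → time w (f w ρ))
    timeC u = divC (divC u (litC F)) WC
    offsetC : {f : Fun 2} → Comp f → Comp (λ w ρ → offset w (f w ρ))
    offsetC u = modC (divC u (litC F)) WC
    contentC : {f : Fun 2} → Comp f → Comp (λ w ρ → content w (f w ρ))
    contentC u = modC u (litC F)

-- Cliques in the tableau are computations

unique-≤1 : ∀ (c : ℕ → Bool) n → (∀ {i j} → i < n → j < n → c i ≡ true → c j ≡ true → i ≡ j) →
            sumTo (λ i → b2n (c i)) n ≤ 1
unique-≤1 c zero    h = z≤n
unique-≤1 c (suc n) h with c n in eq
... | false = unique-≤1 c n (λ i<n j<n → h (m<n⇒m<1+n i<n) (m<n⇒m<1+n j<n))
... | true  = ≤-reflexive (cong suc (sumTo-zero n λ i i<n → cong b2n (others i i<n)))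
  where
  others : ∀ i → i < n → c i ≡ false
  others i i<n with c i in e
  ... | false = refl
  ... | true  = contradiction (h (m<n⇒m<1+n i<n) ≤-refl e eq) (<⇒≢ i<n)

positive⇒∃ : ∀ (c : ℕ → Bool) n → sumTo (λ i → b2n (c i)) n ≡ 1 → ∃ λ i → i < n × c i ≡ true
positive⇒∃ c (suc n) eq with c n in e
... | true  = n , ≤-refl , e
... | false = let (i , i<n , ci) = positive⇒∃ c n eq in i , m<n⇒m<1+n i<n , ci

sumTo-indicator : ∀ {j} n → j < n → sumTo (λ i → b2n (i ≡ᵇ j)) n ≡ 1
sumTo-indicator {j} (suc n) j<n with n ≟ j
... | yes refl rewrite ≡ᵇ-refl n = cong suc (sumTo-zero n λ i i<n → cong b2n (≢⇒≡ᵇ (<⇒≢ i<n)))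
... | no  n≢j rewrite ≢⇒≡ᵇ n≢j = sumTo-indicator n (≤∧≢⇒< (s≤s⁻¹ j<n) (n≢j ∘ sym))

at-input : ∀ M w e → at (inputTape M w) (⁺ e) ≡ nth blank (map bit w) e
at-input M []      zero    = refl
at-input M []      (suc e) = refl
at-input M (b ∷ w) zero    = refl
at-input M (b ∷ w) (suc e) = refl

at-input-left : ∀ M w i → at (inputTape M w) -[1+ i ] ≡ blank
at-input-left M []      i = refl
at-input-left M (b ∷ w) i = refl

at-blank : ∀ {a} z → at (tape {a} [] blank []) z ≡ blank
at-blank (⁺ zero)  = refl
at-blank (⁺ suc i) = refl
at-blank -[1+ i ]  = refl

module ReadOff {a : ℕ} (g : ℕ → Symbol a) (Y : ℕ)
  (symbol : ∀ {e} → e < Y → g e ≡ blank ⊎ ∃ λ b → g e ≡ bit b)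
  (next-blank : ∀ {e} → suc e < Y → g e ≡ blank → g (suc e) ≡ blank) where

  prepend : Symbol a → Bits → Bits
  prepend (bit b) l = b ∷ l
  prepend _       l = []

  readY : ℕ → ℕ → Bits
  readY e zero    = []
  readY e (suc k) = prepend (g e) (readY (suc e) k)

  length-readY : ∀ e k → length (readY e k) ≤ k
  length-readY e zero    = z≤n
  length-readY e (suc k) with g e
  ... | bit b = s≤s (length-readY (suc e) k)
  ... | blank = z≤n
  ... | aux _ = z≤n

  -- Reading stops at the first blank. As only blanks follow, the string padded with blanks still
  -- agrees with g everywhere.
  nth-readY : ∀ k e → e + k ≤ Y → ∀ j → j < k → nth blank (map bit (readY e k)) j ≡ g (e + j)
  nth-readY (suc k) e le j j<k with symbol {e} (≤-trans (≤-reflexive (+-comm 1 e)) (≤-trans (+-monoʳ-≤ e (s≤s z≤n)) le))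
  nth-readY (suc k) e le zero j<k | inj₂ (b , eq) rewrite eq = trans (sym eq) (cong g (sym (+-identityʳ e)))
  nth-readY (suc k) e le (suc j) (s≤s j<k) | inj₂ (b , eq) rewrite eq =
    trans (nth-readY k (suc e) (≤-trans (≤-reflexive (sym (+-suc e k))) le) j j<k) (cong g (sym (+-suc e j)))
  nth-readY (suc k) e le j j<k | inj₁ eq rewrite eq = sym (blanks j j<k)
    where
    blanks : ∀ j → j < suc k → g (e + j) ≡ blank
    blanks zero    _  = trans (cong g (+-identityʳ e)) eq
    blanks (suc j) lt = trans (cong g (+-suc e j)) (next-blank
      (≤-trans (≤-reflexive (cong suc (sym (+-suc e j)))) (≤-trans (+-monoʳ-< e lt) le)) (blanks j (<⇒≤ lt)))

-- The zones of the initial tape: left of the input, the delimited x, the room for a certificate,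
-- and everything to the right of it.
data Place (D E Y : ℕ) : ℕ → Set where
  before  : ∀ {d} → d < D → Place D E Y d
  within  : ∀ {e} → e < E → Place D E Y (D + e)
  certify : ∀ {e} → e < Y → Place D E Y (D + (E + e))
  beyond  : ∀ {e} → Y ≤ e → Place D E Y (D + (E + e))

place : ∀ D E Y d → Place D E Y d
place D E Y d with d <? D
... | yes d<D = before d<D
... | no  d≮D with d ∸ D | m+[n∸m]≡n (≮⇒≥ d≮D)
...   | e | refl with e <? E
...     | yes e<E = within e<E
...     | no  e≮E with e ∸ E | m+[n∸m]≡n (≮⇒≥ e≮E)
...       | e′ | refl with e′ <? Y
...         | yes e′<Y = certify e′<Y
...         | no  e′≮Y = beyond (≮⇒≥ e′≮Y)

module Correct (M : TM) (r p : Polynomial) (verify : Bits → Bool)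
  (computes : ∀ w → ∃ λ c → HaltsWithin M (eval r (length w)) (initial M w) c × output M c ≡ verify w ∷ [])
  (x : Bits) where

  open TM M
  open Tableau M r p hiding (E; Y; len; T′; D; W; K; N; initialRule; movedRule; ruleList; rules;
                             time; offset; content; compat)
  open Tableau.Input M r p x

  opaque
    unfolding tab₁

    φ : Fin F → Φ
    φ = decode Φ-finite

    φ-code : ∀ v → φ (code Φ-finite v) ≡ v
    φ-code = decode∘code Φ-finite

    tab₁-at : ∀ P i → tab₁ P (toℕ i) ≡ P (φ i)
    tab₁-at P i = nth-tabulate false (λ i → P (φ i)) i

    tab₂-at : ∀ P i j → tab₂ P (toℕ i) (toℕ j) ≡ P (φ i) (φ j)
    tab₂-at P i j = trans (cong (λ l → nth false l (toℕ j)) (nth-tabulate [] (λ i → table₁ (P (φ i))) i))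
      (nth-tabulate false (λ j → P (φ i) (φ j)) j)

  vertex : ℕ → ℕ → ℕ → ℕ
  vertex t d f = (t * W + d) * F + f

  vertex<N : ∀ {t d f} → t ≤ T′ → d < W → f < F → vertex t d f < N
  vertex<N t≤T d<W f<F = mixed-radix (mixed-radix (s≤s t≤T) d<W) f<F

  decode-vertex : ∀ {t d f} → d < W → f < F →
    time (vertex t d f) ≡ t × offset (vertex t d f) ≡ d × content (vertex t d f) ≡ f
  decode-vertex {t} {d} d<W f<F =
    trans (cong (λ e → div e W) (div-spec (t * W + d) f<F)) (div-spec t d<W) ,
    trans (cong (λ e → mod e W) (div-spec (t * W + d) f<F)) (mod-spec t d<W) ,
    mod-spec (t * W + d) f<F

  len≤D : len ≤ D
  len≤D = m≤n+m len T′

  D<W : D < W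
  D<W = s≤s (m≤m+n D D)

  snap : Config M → ℕ → Φ
  snap (config s ts) d = s , (Vec.map scanned ts , Vec.map (λ t → at t (rel d D)) ts)

  snap-head : ∀ c d → contents (snap c D) ≡ scannedOf (snap c d)
  snap-head (config s ts) d rewrite rel-refl D = refl

  apply : Cell × Move → Tape auxSymbols → Tape auxSymbols
  apply (c , m) t = move m (write c t)

  advance-config : ∀ s ts → let τ = transition s (Vec.map scanned ts) in
    advance M (config s ts) ≡ config (proj₁ τ) (Vec.zipWith apply (proj₂ τ) ts)
  advance-config s ts with δ s (Vec.map scanned ts)
  ... | just _  = refl
  ... | nothing = cong (config s) (sym (unchanged ts))
    where
    unchanged : ∀ {n} (ts : Vec (Tape auxSymbols) n) →
                Vec.zipWith apply (Vec.map (λ c → c , stay) (Vec.map scanned ts)) ts ≡ ts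
    unchanged []       = refl
    unchanged (t ∷ ts) = cong (t ∷_) (unchanged ts)

  snap-state : ∀ c d d′ → let φ₁ = snap c d in
    proj₁ (transition (stateOf φ₁) (scannedOf φ₁)) ≡ stateOf (snap (advance M c) d′)
  snap-state (config s ts) d d′ rewrite advance-config s ts = refl

  snap-moved : ∀ c {d d′} j → Moves (proj₂ (lookup (actions (snap c d)) j)) d d′ →
    lookup (contents (snap (advance M c) d′)) j ≡
    (if d ≡ᵇ D then proj₁ (lookup (actions (snap c d)) j) else lookup (contents (snap c d)) j)
  snap-moved (config s ts) {d} {d′} j mv
    rewrite advance-config s ts
          | Vecₚ.lookup-map j (λ t → at t (rel d′ D)) (Vec.zipWith apply (proj₂ (transition s (Vec.map scanned ts))) ts)
          | Vecₚ.lookup-zipWith apply j (proj₂ (transition s (Vec.map scanned ts))) ts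
          | Vecₚ.lookup-map j (λ t → at t (rel d D)) ts = at-step D (lookup ts j) _ mv

  initial-contents : ∀ w d → contents (snap (initial M w) d) ≡ onlyFirst (at (inputTape M w) (rel d D))
  initial-contents w d = cong (at (inputTape M w) (rel d D) ∷_) (trans
    (Vecₚ.map-replicate (λ t → at t (rel d D)) (tape [] blank []) workTapes)
    (cong (Vec.replicate workTapes) (at-blank (rel d D))))

  module WithCertificate (y : Bits) (y≤Y : length y ≤ Y) where

    w : Bits
    w = ⟨ x , y ⟩

    c₀ : ℕ → Config M
    c₀ = run M (initial M w)

    length-w : length w ≤ len
    length-w = ≤-trans (≤-reflexive (trans (Listₚ.length-++ (delimit x)) (cong (_+ length y) (length-delimit x))))
      (+-monoʳ-≤ E y≤Y)

    final : output M (c₀ T′) ≡ verify w ∷ []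
    final = let (c , halts , out≡) = computes w in
      trans (cong (output M) (halts⇒run M halts T′ (eval-mono r length-w))) out≡

    inputSym : ℕ → Cell
    inputSym d = at (inputTape M w) (rel d D)

    input-left : ∀ {d} → d < D → inputSym d ≡ blank
    input-left d<D = let (i , eq) = rel-< d<D in trans (cong (at (inputTape M w)) eq) (at-input-left M w i)

    input-right : ∀ e → inputSym (D + e) ≡ nth blank (map bit w) e
    input-right e = trans (cong (at (inputTape M w)) (rel-+ D e)) (at-input M w e)

    map-w : map (bit {auxSymbols}) w ≡ map bit (delimit x) ++ map bit y
    map-w = Listₚ.map-++ bit (delimit x) y

    length-map-delimit : length (map (bit {auxSymbols}) (delimit x)) ≡ E
    length-map-delimit = trans (Listₚ.length-map bit (delimit x)) (length-delimit x)

    input-x : ∀ {e} → e < E → inputSym (D + e) ≡ bit (delimitBit x e)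
    input-x {e} e<E = trans (input-right e) (trans (cong (λ l → nth blank l e) map-w)
      (trans (nth-++ˡ (map bit (delimit x)) (map bit y) (subst (e <_) (sym length-map-delimit) e<E))
      (trans (nth-map bit (delimit x) (subst (e <_) (sym (length-delimit x)) e<E)) (cong bit (nth-delimit x e)))))

    input-y : ∀ e → inputSym (D + (E + e)) ≡ nth blank (map bit y) e
    input-y e = trans (input-right (E + e)) (trans (cong₂ (nth blank) map-w (cong (_+ e) (sym length-map-delimit)))
      (nth-++ʳ (map bit (delimit x)) (map bit y) e))

    input-beyond : ∀ {e} → Y ≤ e → inputSym (D + (E + e)) ≡ blank
    input-beyond {e} Y≤e = trans (input-y e)
      (nth-beyond (map bit y) (≤-trans (≤-reflexive (Listₚ.length-map bit y)) (≤-trans y≤Y Y≤e)))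

  -- The output begins at the head of the first tape, so an answer of one bit is the symbol scanned
  -- there.
  output-accepts : ∀ c d {v} → output M c ≡ v ∷ [] → (v ≡ true) ⇔ (lookup (scannedOf (snap c d)) zero ≡ bit true)
  output-accepts (config s (t ∷ ts)) d out≡ with scanned t
  ... | bit b = mk⇔ (λ { refl → cong bit (Listₚ.∷-injectiveˡ out≡) })
                    (λ { refl → sym (Listₚ.∷-injectiveˡ out≡) })

  cong₆ : (f : ℕ → ℕ → ℕ → ℕ → ℕ → ℕ → Bool) → ∀ {t t₁ d d₁ i i₁ t′ t′₁ d′ d′₁ i′ i′₁} →
    t ≡ t₁ × d ≡ d₁ × i ≡ i₁ → t′ ≡ t′₁ × d′ ≡ d′₁ × i′ ≡ i′₁ → f t d i t′ d′ i′ ≡ f t₁ d₁ i₁ t′₁ d′₁ i′₁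
  cong₆ f (refl , refl , refl) (refl , refl , refl) = refl

  movedRule-at : ∀ m d i i′ → movedRule m d (toℕ i) (toℕ i′) ≡ moved m (d ≡ᵇ D) (φ i) (φ i′)
  movedRule-at m d i i′ = by-flag (d ≡ᵇ D)
    where
    by-flag : ∀ b → (if b then tab₂ (moved m true) (toℕ i) (toℕ i′) else tab₂ (moved m false) (toℕ i) (toℕ i′)) ≡
              moved m b (φ i) (φ i′)
    by-flag true  = tab₂-at (moved m true) i i′
    by-flag false = tab₂-at (moved m false) i i′

  -- From a clique to a certificate

  module Sound {c : ℕ → Bool} (cl : IsClique N K compat c) where
    open IsClique cl

    record Chosen (t d : ℕ) (i : Fin F) : Set where
      constructor chosen
      field
        t≤T    : t ≤ T′
        d<W    : d < W
        picked : c (vertex t d (toℕ i)) ≡ true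

    rule : ∀ {t d i t′ d′ i′} → Chosen t d i → Chosen t′ d′ i′ → ∀ k →
           nth true (ruleList t d (toℕ i) t′ d′ (toℕ i′)) k ≡ true
    rule {t} {d} {i} {t′} {d′} {i′} (chosen t≤T d<W pk) (chosen t′≤T d′<W pk′) =
      and-elim (ruleList t d (toℕ i) t′ d′ (toℕ i′))
        (trans (sym (cong₆ rules (decode-vertex {t} d<W (Finₚ.toℕ<n i)) (decode-vertex {t′} d′<W (Finₚ.toℕ<n i′))))
          (pairwise (vertex<N t≤T d<W (Finₚ.toℕ<n i)) (vertex<N t′≤T d′<W (Finₚ.toℕ<n i′)) pk pk′))

    -- By the first rule each of the K cells contributes at most one vertex; as the clique has K
    -- vertices, `sumTo-tight` gives every cell exactly one.
    chosen-exists : ∀ {t d} → t ≤ T′ → d < W → ∃ (Chosen t d)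
    chosen-exists {t} {d} t≤T d<W =
      let (f , f<F , picked) = positive⇒∃ (λ f → c (vertex t d f)) F (cell≡1 (mixed-radix (s≤s t≤T) d<W))
      in Fin.fromℕ< f<F , chosen t≤T d<W (subst (λ f → c (vertex t d f) ≡ true) (sym (Finₚ.toℕ-fromℕ< f<F)) picked)
      where
      cellSum : ℕ → ℕ
      cellSum k = sumTo (λ f → b2n (c (k * F + f))) F
      unique : ∀ {k f f′} → k < K → f < F → f′ < F → c (k * F + f) ≡ true → c (k * F + f′) ≡ true → f ≡ f′
      unique {k} {f} {f′} k<K f<F f′<F cf cf′ = ≡ᵇ-true {f} {f′} (⇒-elim ((τ ≡ᵇ τ) ∧ (o ≡ᵇ o))
        (and-elim (ruleList τ o f τ o f′) (trans (sym (cong₆ rules (at-cell f<F) (at-cell f′<F)))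
          (pairwise (mixed-radix k<K f<F) (mixed-radix k<K f′<F) cf cf′)) 0)
        (∧-intro (≡ᵇ-refl τ) (≡ᵇ-refl o)))
        where
        τ = div k W
        o = mod k W
        at-cell : ∀ {f} → f < F → time (k * F + f) ≡ τ × offset (k * F + f) ≡ o × content (k * F + f) ≡ f
        at-cell f<F = cong (λ e → div e W) (div-spec k f<F) , cong (λ e → mod e W) (div-spec k f<F) , mod-spec k f<F
      cell≡1 : ∀ {k} → k < K → cellSum k ≡ 1
      cell≡1 {k} = sumTo-tight K (λ k k<K → unique-≤1 (λ f → c (k * F + f)) F (unique k<K))
        (≤-reflexive (trans (sumTo-const 1 K) (trans (*-identityʳ K)
          (trans (sym size) (sumTo-nest (λ u → b2n (c u)) K F))))) k

    -- Opaque, because unfolding the search makes type checking very slow.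
    opaque
      exists : ∀ {t d} → t ≤ T′ → d < W → ∃ (Chosen t d)
      exists = chosen-exists

    control : ∀ {t d i d′ i′} → Chosen t d i → Chosen t d′ i′ →
              stateOf (φ i) ≡ stateOf (φ i′) × scannedOf (φ i) ≡ scannedOf (φ i′)
    control {t} {d} {i} {d′} {i′} C C′ =
      let same = trans (sym (tab₂-at sameControl i i′)) (⇒-elim (t ≡ᵇ t) (rule C C′ 1) (≡ᵇ-refl t))
          (s , σ) = ∧-true {eqF (Fin-finite states) (stateOf (φ i)) (stateOf (φ i′))} same
      in eqF-sound (Fin-finite states) s , eqF-sound Cells-finite σ

    next-state : ∀ {t d i d′ i′} → Chosen t d i → Chosen (suc t) d′ i′ →
                 proj₁ (transition (stateOf (φ i)) (scannedOf (φ i))) ≡ stateOf (φ i′)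
    next-state {t} {i = i} {i′ = i′} C C′ = eqF-sound (Fin-finite states)
      (trans (sym (tab₂-at nextState i i′)) (⇒-elim (t ≡ᵇ t) (rule C C′ 2) (≡ᵇ-refl t)))

    moved-content : ∀ {t d i d′ i′} j → Chosen t d i → Chosen (suc t) d′ i′ →
      Moves (proj₂ (lookup (actions (φ i)) j)) d d′ →
      lookup (contents (φ i′)) j ≡ (if d ≡ᵇ D then proj₁ (lookup (actions (φ i)) j) else lookup (contents (φ i)) j)
    moved-content {t} {d} {i} {d′} {i′} j C C′ mv = eqF-sound (Symbol-finite auxSymbols)
      (⇒-elim (eqF Move-finite m m) (allF-elim {f = test} (trans (sym (movedRule-at m d i i′)) (by-rule mv)) j)
        (eqF-refl Move-finite {m} refl))
      where
      m = proj₂ (lookup (actions (φ i)) j)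
      test = λ j → eqF Move-finite (proj₂ (lookup (actions (φ i)) j)) m ⇒ᵇ
        eqF (Symbol-finite auxSymbols) (lookup (contents (φ i′)) j)
          (if d ≡ᵇ D then proj₁ (lookup (actions (φ i)) j) else lookup (contents (φ i)) j)
      by-rule : ∀ {m} → Moves m d d′ → movedRule m d (toℕ i) (toℕ i′) ≡ true
      by-rule leftwards  = ⇒-elim ((t ≡ᵇ t) ∧ (d ≡ᵇ d)) (rule C C′ 3) (∧-intro (≡ᵇ-refl t) (≡ᵇ-refl d))
      by-rule inPlace    = ⇒-elim ((t ≡ᵇ t) ∧ (d ≡ᵇ d)) (rule C C′ 4) (∧-intro (≡ᵇ-refl t) (≡ᵇ-refl d))
      by-rule rightwards = ⇒-elim ((t ≡ᵇ t) ∧ (d′ ≡ᵇ d′)) (rule C C′ 5) (∧-intro (≡ᵇ-refl t) (≡ᵇ-refl d′))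

    at-head : ∀ {t i} → Chosen t D i → contents (φ i) ≡ scannedOf (φ i)
    at-head {i = i} C = eqF-sound Cells-finite
      (trans (sym (tab₁-at atHead i)) (⇒-elim (D ≡ᵇ D) (rule C C 6) (≡ᵇ-refl D)))

    starts : ∀ {d i} → Chosen 0 d i → stateOf (φ i) ≡ start
    starts {i = i} C = eqF-sound (Fin-finite states) (trans (sym (tab₁-at isStart i)) (rule C C 7))

    is-sound : ∀ {s} i → tab₁ (is s) (toℕ i) ≡ true → contents (φ i) ≡ onlyFirst s
    is-sound {s} i h = eqF-sound Cells-finite (trans (sym (tab₁-at (is s) i)) h)

    initial-left : ∀ {d i} → Chosen 0 d i → d < D → contents (φ i) ≡ onlyFirst blank
    initial-left {i = i} C d<D = is-sound i (trans (sym (if-true (<ᵇ-true d<D))) (rule C C 8))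

    initial-x : ∀ {e i} → Chosen 0 (D + e) i → e < E → contents (φ i) ≡ onlyFirst (bit (delimitBit x e))
    initial-x {e} {i} C e<E = by-bit (delimitBit x e) (subst (λ e → (if delimitBit x e then _ else _) ≡ true) (m+n∸m≡n D e)
      (trans (sym (trans (if-false (<ᵇ-false (m≤m+n D e))) (if-true (<ᵇ-true (+-monoʳ-< D e<E))))) (rule C C 8)))
      where
      by-bit : ∀ b → (if b then tab₁ (is (bit true)) (toℕ i) else tab₁ (is (bit false)) (toℕ i)) ≡ true →
               contents (φ i) ≡ onlyFirst (bit b)
      by-bit true  = is-sound i
      by-bit false = is-sound i

    initial-y : ∀ {e i} → Chosen 0 (D + (E + e)) i → e < Y →
      contents (φ i) ≡ onlyFirst blank ⊎ ∃ λ b → contents (φ i) ≡ onlyFirst (bit b)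
    initial-y {e} {i} C e<Y = cases (trans (sym (trans (if-false (<ᵇ-false (m≤m+n D (E + e))))
        (trans (if-false (<ᵇ-false (+-monoʳ-≤ D (m≤m+n E e)))) (if-true (<ᵇ-true (+-monoʳ-< D (+-monoʳ-< E e<Y)))))))
        (rule C C 8))
      where
      cases : (tab₁ (is blank) (toℕ i) ∨ (tab₁ (is (bit true)) (toℕ i) ∨ tab₁ (is (bit false)) (toℕ i))) ≡ true →
              contents (φ i) ≡ onlyFirst blank ⊎ ∃ λ b → contents (φ i) ≡ onlyFirst (bit b)
      cases h = [ (λ h₀ → inj₁ (is-sound i h₀))
                , (λ h′ → inj₂ ([ (λ h₁ → true , is-sound i h₁) , (λ h₂ → false , is-sound i h₂) ]′
                    (∨-true {tab₁ (is (bit true)) (toℕ i)} h′))) ]′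
                (∨-true {tab₁ (is blank) (toℕ i)} h)

    initial-right : ∀ {e i} → Chosen 0 (D + e) i → len ≤ e → contents (φ i) ≡ onlyFirst blank
    initial-right {e} {i} C le = is-sound i (trans (sym (trans (if-false (<ᵇ-false (m≤m+n D e)))
        (trans (if-false (<ᵇ-false (+-monoʳ-≤ D (≤-trans (m≤m+n E Y) le)))) (if-false (<ᵇ-false (+-monoʳ-≤ D le))))))
        (rule C C 8))

    blank-next : ∀ {e i i′} → Chosen 0 (D + (E + e)) i → Chosen 0 (D + (E + suc e)) i′ →
      contents (φ i) ≡ onlyFirst blank → contents (φ i′) ≡ onlyFirst blank
    blank-next {e} {i} {i′} C C′ eq = eqF-sound Cells-finite (⇒-elim (eqF Cells-finite (contents (φ i)) (onlyFirst blank))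
      (trans (sym (tab₂-at blankNext i i′)) (⇒-elim ((suc d ≡ᵇ D + (E + suc e)) ∧ not (d <ᵇ D + E)) (rule C C′ 9)
        (∧-intro (trans (cong (suc d ≡ᵇ_) (trans (cong (D +_) (+-suc E e)) (+-suc D (E + e)))) (≡ᵇ-refl d))
          (cong not (<ᵇ-false (+-monoʳ-≤ D (m≤m+n E e)))))))
      (eqF-refl Cells-finite eq))
      where d = D + (E + e)

    accepting : ∀ {d i} → Chosen T′ d i → lookup (scannedOf (φ i)) zero ≡ bit true
    accepting {i = i} C = eqF-sound (Symbol-finite auxSymbols)
      (trans (sym (tab₁-at accepts i)) (⇒-elim (T′ ≡ᵇ T′) (rule C C 10) (≡ᵇ-refl T′)))

    y-cell<W : ∀ {e} → e < Y → D + (E + e) < W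
    y-cell<W e<Y = s≤s (+-monoʳ-≤ D (≤-trans (+-monoʳ-≤ E (<⇒≤ e<Y)) len≤D))

    -- The certificate written in the cells E, …, E+Y-1 at time 0.
    symbolAt : ∀ {e} → Dec (e < Y) → Cell
    symbolAt (yes e<Y) = Vec.head (contents (φ (proj₁ (exists {0} z≤n (y-cell<W e<Y)))))
    symbolAt (no  _)   = blank

    g : ℕ → Cell
    g e = symbolAt (e <? Y)

    g-chosen : ∀ {e i} → e < Y → Chosen 0 (D + (E + e)) i → Vec.head (contents (φ i)) ≡ g e
    g-chosen {e} {i} e<Y C = is-symbol (e <? Y)
      where
      d = D + (E + e)
      is-symbol : ∀ e<Y? → Vec.head (contents (φ i)) ≡ symbolAt e<Y?
      is-symbol (no  e≮Y) = contradiction e<Y e≮Y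
      is-symbol (yes e<Y) = cong (λ i → Vec.head (contents (φ i))) (Finₚ.toℕ-injective (≡ᵇ-true {toℕ i}
        (⇒-elim (d ≡ᵇ d) (rule C (proj₂ (exists {0} z≤n (y-cell<W e<Y))) 0) (≡ᵇ-refl d))))

    g-symbol : ∀ {e} → e < Y → g e ≡ blank ⊎ ∃ λ b → g e ≡ bit b
    g-symbol e<Y =
      let (i , C) = exists z≤n (y-cell<W e<Y) in
      [ (λ eq → inj₁ (trans (sym (g-chosen e<Y C)) (cong Vec.head eq)))
      , (λ (b , eq) → inj₂ (b , trans (sym (g-chosen e<Y C)) (cong Vec.head eq))) ]′ (initial-y C e<Y)

    g-blank : ∀ {e} → suc e < Y → g e ≡ blank → g (suc e) ≡ blank
    g-blank {e} e<Y eq =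
      let (i , C) = exists z≤n (y-cell<W (<⇒≤ e<Y))
          (i′ , C′) = exists z≤n (y-cell<W e<Y)
      in trans (sym (g-chosen e<Y C′)) (cong Vec.head (blank-next C C′ (blank-contents C
           (trans (g-chosen (<⇒≤ e<Y) C) eq) (initial-y C (<⇒≤ e<Y)))))
      where
      blank-contents : ∀ {i} → Chosen 0 (D + (E + e)) i → Vec.head (contents (φ i)) ≡ blank →
        contents (φ i) ≡ onlyFirst blank ⊎ (∃ λ b → contents (φ i) ≡ onlyFirst (bit b)) → contents (φ i) ≡ onlyFirst blank
      blank-contents C eq (inj₁ h)       = h
      blank-contents C eq (inj₂ (b , h)) = contradiction (trans (sym (cong Vec.head h)) eq) λ ()

    open ReadOff g Y g-symbol g-blank

    y : Bits
    y = readY 0 Y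

    y≤Y : length y ≤ Y
    y≤Y = length-readY 0 Y

    open WithCertificate y y≤Y

    initial-all : ∀ {d i} → Chosen 0 d i → contents (φ i) ≡ onlyFirst (inputSym d)
    initial-all {d} {i} C = by-place (place D E Y d) C
      where
      first-only : contents (φ i) ≡ onlyFirst blank ⊎ (∃ λ b → contents (φ i) ≡ onlyFirst (bit b)) →
                   contents (φ i) ≡ onlyFirst (Vec.head (contents (φ i)))
      first-only (inj₁ h)       = trans h (cong onlyFirst (sym (cong Vec.head h)))
      first-only (inj₂ (b , h)) = trans h (cong onlyFirst (sym (cong Vec.head h)))
      by-place : ∀ {d} → Place D E Y d → Chosen 0 d i → contents (φ i) ≡ onlyFirst (inputSym d)
      by-place (before d<D)      C = trans (initial-left C d<D) (cong onlyFirst (sym (input-left d<D)))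
      by-place (within e<E)      C = trans (initial-x C e<E) (cong onlyFirst (sym (input-x e<E)))
      by-place (certify {e} e<Y) C = trans (first-only (initial-y C e<Y)) (cong onlyFirst (trans (g-chosen e<Y C)
        (sym (trans (input-y e) (nth-readY Y 0 ≤-refl e e<Y)))))
      by-place (beyond {e} Y≤e)  C = trans (initial-right C (+-monoʳ-≤ E Y≤e)) (cong onlyFirst (sym (input-beyond Y≤e)))

    -- Garbage may enter at the ends of the window, but it cannot reach the
    -- heads in time.
    invariant : ∀ t {d i} → Chosen t d i → t ≤ d → d + t ≤ D + D → φ i ≡ snap (c₀ t) d
    invariant t {d} {i} C t≤d d+t≤2D = assemble t C (contents-ok t C t≤d d+t≤2D)
      where
      t≤D : ∀ {t} → t ≤ T′ → t ≤ D
      t≤D t≤T = ≤-trans t≤T (m≤m+n T′ len)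
      state-ok : ∀ t {d i} → Chosen t d i → stateOf (φ i) ≡ stateOf (snap (c₀ t) d)
      contents-ok : ∀ t {d i} → Chosen t d i → t ≤ d → d + t ≤ D + D → contents (φ i) ≡ contents (snap (c₀ t) d)
      scanned-ok : ∀ t {d i} → Chosen t d i → scannedOf (φ i) ≡ scannedOf (snap (c₀ t) d)
      assemble : ∀ t {d i} → Chosen t d i → contents (φ i) ≡ contents (snap (c₀ t) d) → φ i ≡ snap (c₀ t) d
      assemble t C eq = cong₂ _,_ (state-ok t C) (cong₂ _,_ (scanned-ok t C) eq)
      -- All cells of time t agree on the scanned symbols, so these are read off the middle cell,
      -- which lies in the safe part of the window because t ≤ T′ ≤ D.
      scanned-ok t {d} C =
        let (i′ , C′) = exists (Chosen.t≤T C) D<W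
            t≤ = t≤D (Chosen.t≤T C)
        in trans (proj₂ (control C C′)) (trans (sym (at-head C′))
             (trans (contents-ok t C′ t≤ (+-monoʳ-≤ D t≤)) (snap-head (c₀ t) d)))
      state-ok zero    C = starts C
      state-ok (suc t) {d} C@(chosen t<T _ _) =
        let (i′ , C′) = exists (≤-trans (n≤1+n t) t<T) D<W
        in trans (sym (next-state C′ C)) (trans (cong₂ (λ s σ → proj₁ (transition s σ)) (state-ok t C′) (scanned-ok t C′))
             (snap-state (c₀ t) D d))
      contents-ok zero    {d} C _ _ = trans (initial-all C) (sym (initial-contents w d))
      contents-ok (suc t) {d′} {i′} C′@(chosen t<T d′<W _) t<d′ d′+t≤2D = vec-ext cell-ok
        where
        τ = transition (stateOf (snap (c₀ t) 0)) (scannedOf (snap (c₀ t) 0))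
        cell-ok : ∀ j → lookup (contents (φ i′)) j ≡ lookup (contents (snap (c₀ (suc t)) d′)) j
        cell-ok j = from-cell (proj₂ (lookup (proj₂ τ) j)) refl
          where
          use : ∀ {d m} → Moves m d d′ → proj₂ (lookup (proj₂ τ) j) ≡ m → d < W → t ≤ d → d + t ≤ D + D →
                lookup (contents (φ i′)) j ≡ lookup (contents (snap (c₀ (suc t)) d′)) j
          use {d} mv refl d<W t≤d d+t≤2D =
            let (i , C) = exists (≤-trans (n≤1+n t) t<T) d<W
                same = assemble t C (contents-ok t C t≤d d+t≤2D)
            in trans (moved-content j C C′ (subst (λ φ₁ → Moves (proj₂ (lookup (actions φ₁) j)) d d′) (sym same) mv))
                 (trans (cong (λ φ₁ → if d ≡ᵇ D then proj₁ (lookup (actions φ₁) j) else lookup (contents φ₁) j) same)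
                 (sym (snap-moved (c₀ t) {d} {d′} j mv)))
          -- The preceding cell of tape j is found from the move of its head. It is at most one
          -- place away, and the safe part at time t is wider by one on both sides.
          from-cell : ∀ m → proj₂ (lookup (proj₂ τ) j) ≡ m →
                      lookup (contents (φ i′)) j ≡ lookup (contents (snap (c₀ (suc t)) d′)) j
          from-cell stay  eq = use inPlace eq d′<W (<⇒≤ t<d′) (≤-trans (+-monoʳ-≤ d′ (n≤1+n t)) d′+t≤2D)
          from-cell right eq = use rightwards eq
            (s≤s (≤-trans (m≤m+n (suc d′) t) (≤-trans (≤-reflexive (sym (+-suc d′ t))) d′+t≤2D)))
            (≤-trans (<⇒≤ t<d′) (n≤1+n d′)) (≤-trans (≤-reflexive (sym (+-suc d′ t))) d′+t≤2D)
          from-cell left  eq = by-pred d′ refl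
            where
            by-pred : ∀ k → d′ ≡ k → lookup (contents (φ i′)) j ≡ lookup (contents (snap (c₀ (suc t)) d′)) j
            by-pred zero    refl = contradiction t<d′ λ ()
            by-pred (suc k) refl = use leftwards eq (<⇒≤ d′<W) (s≤s⁻¹ t<d′)
              (≤-trans (+-mono-≤ (n≤1+n k) (n≤1+n t)) d′+t≤2D)

    verified : verify w ≡ true
    verified =
      let (i , C) = exists ≤-refl D<W
          T≤D = m≤m+n T′ len
      in Equivalence.from (output-accepts (c₀ T′) D final)
           (trans (cong (λ φ₁ → lookup (scannedOf φ₁) zero) (sym (invariant T′ C T≤D (+-monoʳ-≤ D T≤D)))) (accepting C))

  -- From a certificate to a clique

  module Complete (y : Bits) (y≤Y : length y ≤ Y) (verified : verify ⟨ x , y ⟩ ≡ true) where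
    open WithCertificate y y≤Y

    value : ℕ → ℕ → Φ
    value t d = snap (c₀ t) d

    f : ℕ → ℕ → ℕ
    f t d = toℕ (code Φ-finite (value t d))

    f<F : ∀ t d → f t d < F
    f<F t d = Finₚ.toℕ<n (code Φ-finite (value t d))

    c : ℕ → Bool
    c u = content u ≡ᵇ f (time u) (offset u)

    by₁ : ∀ P {t d} → P (value t d) ≡ true → tab₁ P (f t d) ≡ true
    by₁ P {t} {d} h = trans (tab₁-at P (code Φ-finite (value t d))) (trans (cong P (φ-code (value t d))) h)

    by₂ : ∀ P {t d t′ d′} → P (value t d) (value t′ d′) ≡ true → tab₂ P (f t d) (f t′ d′) ≡ true
    by₂ P {t} {d} {t′} {d′} h = trans (tab₂-at P (code Φ-finite (value t d)) (code Φ-finite (value t′ d′)))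
      (trans (cong₂ P (φ-code (value t d)) (φ-code (value t′ d′))) h)

    moves : ∀ {m t d d′} → Moves m d d′ → movedRule m d (f t d) (f (suc t) d′) ≡ true
    moves {m} {t} {d} {d′} mv = trans (movedRule-at m d _ _) (trans
      (cong₂ (moved m (d ≡ᵇ D)) (φ-code (value t d)) (φ-code (value (suc t) d′)))
      (allF-intro λ j → ⇒-intro λ same → eqF-refl (Symbol-finite auxSymbols)
        (snap-moved (c₀ t) j (subst (λ m → Moves m d d′) (sym (eqF-sound Move-finite same)) mv))))

    contents-initial : ∀ {d s} → inputSym d ≡ s → contents (value 0 d) ≡ onlyFirst s
    contents-initial {d} eq = trans (initial-contents w d) (cong onlyFirst eq)

    by-is : ∀ {d s} → inputSym d ≡ s → tab₁ (is s) (f 0 d) ≡ true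
    by-is {d} {s} eq = by₁ (is s) {0} {d} (eqF-refl Cells-finite (contents-initial eq))

    initial-holds : ∀ d → initialRule d (f 0 d) ≡ true
    initial-holds d = by-place (place D E Y d)
      where
      by-bit : ∀ {d} b → inputSym d ≡ bit b →
               (if b then tab₁ (is (bit true)) (f 0 d) else tab₁ (is (bit false)) (f 0 d)) ≡ true
      by-bit true  = by-is
      by-bit false = by-is
      allowed : ∀ {d} (s : Cell) → inputSym d ≡ s → (s ≡ blank ⊎ ∃ λ b → s ≡ bit b) →
        (tab₁ (is blank) (f 0 d) ∨ (tab₁ (is (bit true)) (f 0 d) ∨ tab₁ (is (bit false)) (f 0 d))) ≡ true
      allowed {d} s eq (inj₁ refl) =
        cong (_∨ (tab₁ (is (bit true)) (f 0 d) ∨ tab₁ (is (bit false)) (f 0 d))) (by-is eq)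
      allowed {d} s eq (inj₂ (true , refl)) = trans (cong (tab₁ (is blank) (f 0 d) ∨_)
        (cong (_∨ tab₁ (is (bit false)) (f 0 d)) (by-is eq))) (Boolₚ.∨-zeroʳ _)
      allowed {d} s eq (inj₂ (false , refl)) = trans (cong (tab₁ (is blank) (f 0 d) ∨_)
        (trans (cong (tab₁ (is (bit true)) (f 0 d) ∨_) (by-is eq)) (Boolₚ.∨-zeroʳ _))) (Boolₚ.∨-zeroʳ _)
      bit-or-blank : ∀ (l : Bits) e → nth (blank {auxSymbols}) (map bit l) e ≡ blank ⊎ ∃ λ b → nth (blank {auxSymbols}) (map bit l) e ≡ bit b
      bit-or-blank []      e       = inj₁ refl
      bit-or-blank (b ∷ l) zero    = inj₂ (b , refl)
      bit-or-blank (b ∷ l) (suc e) = bit-or-blank l e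
      by-place : ∀ {d} → Place D E Y d → initialRule d (f 0 d) ≡ true
      by-place (before d<D) = trans (if-true (<ᵇ-true d<D)) (by-is (input-left d<D))
      by-place (within {e} e<E) = trans (if-false (<ᵇ-false (m≤m+n D e))) (trans (if-true (<ᵇ-true (+-monoʳ-< D e<E)))
        (by-bit (delimitBit x (D + e ∸ D)) (trans (input-x e<E) (cong (λ e → bit (delimitBit x e)) (sym (m+n∸m≡n D e))))))
      by-place (certify {e} e<Y) = trans (if-false (<ᵇ-false (m≤m+n D (E + e))))
        (trans (if-false (<ᵇ-false (+-monoʳ-≤ D (m≤m+n E e)))) (trans (if-true (<ᵇ-true (+-monoʳ-< D (+-monoʳ-< E e<Y))))
        (allowed _ (input-y e) (bit-or-blank y e))))
      by-place (beyond {e} Y≤e) = trans (if-false (<ᵇ-false (m≤m+n D (E + e))))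
        (trans (if-false (<ᵇ-false (+-monoʳ-≤ D (m≤m+n E e)))) (trans (if-false (<ᵇ-false (+-monoʳ-≤ D (+-monoʳ-≤ E Y≤e))))
        (by-is (input-beyond Y≤e))))

    blank-holds : ∀ d → D + E ≤ d → blankNext (value 0 d) (value 0 (suc d)) ≡ true
    blank-holds d le = ⇒-intro λ h → eqF-refl Cells-finite (contents-initial (by-place (place D E Y d) le
      (Vecₚ.∷-injectiveˡ (trans (sym (contents-initial refl)) (eqF-sound Cells-finite h)))))
      where
      nth-blank : ∀ (l : Bits) e → nth (blank {auxSymbols}) (map bit l) e ≡ blank → nth (blank {auxSymbols}) (map bit l) (suc e) ≡ blank
      nth-blank []      e       h = refl
      nth-blank (b ∷ l) (suc e) h = nth-blank l e h
      next-y : ∀ e → inputSym (D + (E + e)) ≡ blank → inputSym (suc (D + (E + e))) ≡ blank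
      next-y e h = trans (cong inputSym (sym (trans (cong (D +_) (+-suc E e)) (+-suc D (E + e)))))
        (trans (input-y (suc e)) (nth-blank y e (trans (sym (input-y e)) h)))
      by-place : ∀ {d} → Place D E Y d → D + E ≤ d → inputSym d ≡ blank → inputSym (suc d) ≡ blank
      by-place (before d<D)      le h = contradiction d<D (≤⇒≯ (≤-trans (m≤m+n D E) le))
      by-place (within e<E)      le h = contradiction (+-cancelˡ-≤ D _ _ le) (<⇒≱ e<E)
      by-place (certify {e} _)   le h = next-y e h
      by-place (beyond {e} _)    le h = next-y e h

    -- The true run has a content at every time and offset, so the rules hold on the infinite
    -- tableau and the rim of the window causes no exceptions.
    hold : ∀ t d t′ d′ → rules t d (f t d) t′ d′ (f t′ d′) ≡ true
    hold t d t′ d′ = and-intro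
      ( ⇒-intro (λ h → let (et , ed) = ∧-true {t ≡ᵇ t′} h in
          trans (cong₂ (λ t′ d′ → f t d ≡ᵇ f t′ d′) (sym (≡ᵇ-true {t} {t′} et)) (sym (≡ᵇ-true {d} {d′} ed))) (≡ᵇ-refl (f t d)))
      ∷ ⇒-intro (λ h → by₂ sameControl {t} {d} {t′} {d′} (same (≡ᵇ-true {t} {t′} h)))
      ∷ ⇒-intro (λ h → by₂ nextState {t} {d} {t′} {d′} (follows (≡ᵇ-true {suc t} {t′} h)))
      ∷ ⇒-intro (λ h → let (et , ed) = ∧-true {suc t ≡ᵇ t′} h in
          step-moves {left} (≡ᵇ-true {suc t} {t′} et) (subst (Moves left d) (≡ᵇ-true {suc d} {d′} ed) leftwards))
      ∷ ⇒-intro (λ h → let (et , ed) = ∧-true {suc t ≡ᵇ t′} h in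
          step-moves {stay} (≡ᵇ-true {suc t} {t′} et) (subst (Moves stay d) (≡ᵇ-true {d} {d′} ed) inPlace))
      ∷ ⇒-intro (λ h → let (et , ed) = ∧-true {suc t ≡ᵇ t′} h in
          step-moves {right} (≡ᵇ-true {suc t} {t′} et) (subst (λ d → Moves right d d′) (sym (≡ᵇ-true {d} {suc d′} ed)) rightwards))
      ∷ ⇒-intro (λ h → by₁ atHead {t} {d} (eqF-refl Cells-finite (head (≡ᵇ-true {d} {D} h))))
      ∷ ⇒-intro (λ h → by₁ isStart {t} {d} (eqF-refl (Fin-finite states) (begins (≡ᵇ-true {t} {0} h))))
      ∷ ⇒-intro (λ h → subst (λ t → initialRule d (f t d) ≡ true) (sym (≡ᵇ-true {t} {0} h)) (initial-holds d))
      ∷ ⇒-intro (λ h → let (et , h₁) = ∧-true {t ≡ᵇ 0} h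
                           (et′ , h₂) = ∧-true {t′ ≡ᵇ 0} h₁
                           (ed , h₃) = ∧-true {suc d ≡ᵇ d′} h₂ in
          by₂ blankNext {t} {d} {t′} {d′} (blanks (≡ᵇ-true {t} {0} et) (≡ᵇ-true {t′} {0} et′) (≡ᵇ-true {suc d} {d′} ed) (not-true h₃)))
      ∷ ⇒-intro (λ h → by₁ accepts {t} {d} (eqF-refl (Symbol-finite auxSymbols) (accepting (≡ᵇ-true {t} {T′} h))))
      ∷ [])
      where
      same : t ≡ t′ → sameControl (value t d) (value t′ d′) ≡ true
      same refl = ∧-intro (eqF-refl (Fin-finite states) {stateOf (value t d)} refl)
                          (eqF-refl Cells-finite {scannedOf (value t d)} refl)
      follows : suc t ≡ t′ → nextState (value t d) (value t′ d′) ≡ true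
      follows refl = eqF-refl (Fin-finite states) (snap-state (c₀ t) d d′)
      step-moves : ∀ {m} → suc t ≡ t′ → Moves m d d′ → movedRule m d (f t d) (f t′ d′) ≡ true
      step-moves {m} refl mv = moves {m} {t} {d} {d′} mv
      head : d ≡ D → contents (value t d) ≡ scannedOf (value t d)
      head refl = snap-head (c₀ t) D
      begins : t ≡ 0 → stateOf (value t d) ≡ start
      begins refl = refl
      blanks : t ≡ 0 → t′ ≡ 0 → suc d ≡ d′ → (d <ᵇ D + E) ≡ false → blankNext (value t d) (value t′ d′) ≡ true
      blanks refl refl refl h = blank-holds d (≮⇒≥ λ lt → contradiction (trans (sym (<ᵇ-true lt)) h) λ ())
      accepting : t ≡ T′ → lookup (scannedOf (value t d)) zero ≡ bit true
      accepting refl = Equivalence.to (output-accepts (c₀ T′) d final) verified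

    clique : IsClique N K compat c
    clique = record
      { size = trans (sumTo-nest (λ u → b2n (c u)) K F) (trans (sumTo-cong K (λ k _ → one-per-cell k))
          (trans (sumTo-const 1 K) (*-identityʳ K)))
      ; pairwise = λ {a} {b} _ _ ca cb → trans
          (cong₆ rules {time a} {time a} {offset a} {offset a} {content a} {f (time a) (offset a)}
             {time b} {time b} {offset b} {offset b} {content b} {f (time b) (offset b)}
             (refl , refl , ≡ᵇ-true ca) (refl , refl , ≡ᵇ-true cb))
          (hold (time a) (offset a) (time b) (offset b)) }
      where
      one-per-cell : ∀ k → sumTo (λ i → b2n (c (k * F + i))) F ≡ 1
      one-per-cell k = trans (sumTo-cong F (λ i i<F → cong b2n (cong₂ _≡ᵇ_ (mod-spec k i<F)
          (cong₂ f (cong (λ e → div e W) (div-spec k i<F)) (cong (λ e → mod e W) (div-spec k i<F))))))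
        (sumTo-indicator F (f<F (div k W) (mod k W)))

  clique⇔certificate : ∃ (IsClique N K compat) ⇔ (∃ λ y → length y ≤ Y × verify ⟨ x , y ⟩ ≡ true)
  clique⇔certificate = mk⇔ (λ (c , cl) → let open Sound cl in y , y≤Y , verified)
                           (λ (y , y≤Y , ok) → _ , Complete.clique y y≤Y ok)

  F≥1 : 1 ≤ F
  F≥1 = ≤-trans (s≤s z≤n) (Finₚ.toℕ<n (code Φ-finite (snap (initial M []) 0)))

  K≤N : K ≤ N
  K≤N = ≤-trans (≤-reflexive (sym (*-identityʳ K))) (*-monoʳ-≤ K F≥1)

-- Comparison of sums of numbers digit by digit

half-parity : ∀ e → e ≡ 2 * ⌊ e /2⌋ + b2n (oddᵇ e)
half-parity zero          = refl
half-parity (suc zero)    = refl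
half-parity (suc (suc e)) rewrite Boolₚ.not-involutive (oddᵇ e) = trans (cong (2 +_) (half-parity e))
  (lemma ⌊ e /2⌋ (b2n (oddᵇ e)))
  where
  lemma : ∀ h ρ → 2 + (2 * h + ρ) ≡ 2 * suc h + ρ
  lemma = solve-∀

-- The carry of Σ (cᵢ - dᵢ) 2ⁱ, raised by 2 in order to stay a natural number;
-- here every dᵢ is a digit, at most 2.
balance : (c d : ℕ → ℕ) → ℕ → ℕ
balance c d = natrec (λ i a → ⌊ (a + (2 + c i)) ∸ d i /2⌋) 2

weighted : (ℕ → ℕ) → ℕ → ℕ
weighted c = sumTo (λ i → c i * 2 ^ i)

-- Division with remainder by 2 ^ m: `balance` is the quotient, and r collects the parities lost in
-- halving. As d ≤ 2, the summand 2 in each step keeps the truncated subtraction exact.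
balance-invariant : ∀ c d → (∀ i → d i ≤ 2) → ∀ m → ∃ λ r → r < 2 ^ m ×
  weighted c m + 2 * 2 ^ m ≡ weighted d m + (2 ^ m * balance c d m + r)
balance-invariant c d d≤2 zero    = 0 , s≤s z≤n , refl
balance-invariant c d d≤2 (suc m) =
  let (r , r<P , eq) = balance-invariant c d d≤2 m in
  r + P * ρ , ≤-trans (+-monoˡ-< (P * ρ) r<P) (≤-trans (+-monoʳ-≤ P (*-monoʳ-≤ P (b2n≤1 (oddᵇ e)))) (≤-reflexive (double P))) ,
  (begin
    c m * P + weighted c m + 2 * (2 * P)                          ≡⟨ lem₁ (c m) P (weighted c m) ⟩
    (weighted c m + 2 * P) + P * (2 + c m)                        ≡⟨ cong (_+ P * (2 + c m)) eq ⟩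
    (weighted d m + (P * a + r)) + P * (2 + c m)                  ≡⟨ lem₂ (weighted d m) P a r (2 + c m) ⟩
    weighted d m + r + P * (a + (2 + c m))                        ≡⟨ cong (λ z → weighted d m + r + P * z) carry ⟩
    weighted d m + r + P * (2 * h + ρ + d m)                      ≡⟨ lem₃ (weighted d m) r P h ρ (d m) ⟩
    d m * P + weighted d m + (2 * P * h + (r + P * ρ))            ∎)
  where
  open ≡-Reasoning
  P = 2 ^ m
  a = balance c d m
  e = (a + (2 + c m)) ∸ d m
  h = ⌊ e /2⌋
  ρ = b2n (oddᵇ e)
  double : ∀ P → P + P * 1 ≡ 2 * P
  double = solve-∀
  carry : a + (2 + c m) ≡ 2 * h + ρ + d m
  carry = trans (sym (m∸n+n≡m (≤-trans (d≤2 m) (≤-trans (m≤m+n 2 (c m)) (m≤n+m _ a))))) (cong (_+ d m) (half-parity e))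
  lem₁ : ∀ c P S → c * P + S + 2 * (2 * P) ≡ (S + 2 * P) + P * (2 + c)
  lem₁ = solve-∀
  lem₂ : ∀ S P a r c → (S + (P * a + r)) + P * c ≡ S + r + P * (a + c)
  lem₂ = solve-∀
  lem₃ : ∀ S r P h ρ d → S + r + P * (2 * h + ρ + d) ≡ d * P + S + (2 * P * h + (r + P * ρ))
  lem₃ = solve-∀

-- A nonnegative carry shows as a value of at least 2, and the remainder r < 2 ^ m is too small to
-- change the sign.
balance-spec : ∀ c d → (∀ i → d i ≤ 2) → ∀ m → ((1 <ᵇ balance c d m) ≡ true) ⇔ (weighted d m ≤ weighted c m)
balance-spec c d d≤2 m with balance-invariant c d d≤2 m
... | r , r<P , eq = mk⇔ enough exceed
  where
  P = 2 ^ m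
  a = balance c d m
  open ≤-Reasoning
  enough : (1 <ᵇ a) ≡ true → weighted d m ≤ weighted c m
  enough h = +-cancelʳ-≤ (2 * P) (weighted d m) (weighted c m) (begin
    weighted d m + 2 * P              ≤⟨ +-monoʳ-≤ (weighted d m) (*-monoˡ-≤ P (true-<ᵇ {1} {a} h)) ⟩
    weighted d m + a * P              ≡⟨ cong (weighted d m +_) (*-comm a P) ⟩
    weighted d m + P * a              ≤⟨ +-monoʳ-≤ (weighted d m) (m≤m+n (P * a) r) ⟩
    weighted d m + (P * a + r)        ≡⟨ eq ⟨
    weighted c m + 2 * P              ∎)
  exceed : weighted d m ≤ weighted c m → (1 <ᵇ a) ≡ true
  exceed le = <ᵇ-true (≰⇒> λ a≤1 → <-irrefl refl (begin-strict
    weighted d m + (P * a + r)        ≤⟨ +-monoʳ-≤ (weighted d m) (+-monoˡ-≤ r (*-monoʳ-≤ P a≤1)) ⟩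
    weighted d m + (P * 1 + r)        <⟨ +-monoʳ-< (weighted d m) (+-monoʳ-< (P * 1) r<P) ⟩
    weighted d m + (P * 1 + P)        ≡⟨ cong (weighted d m +_) (lemma P) ⟩
    weighted d m + 2 * P              ≤⟨ +-monoˡ-≤ (2 * P) le ⟩
    weighted c m + 2 * P              ≡⟨ eq ⟩
    weighted d m + (P * a + r)        ∎))
    where
    lemma : ∀ P → P * 1 + P ≡ 2 * P
    lemma = solve-∀

sumTo-swap : ∀ (f : ℕ → ℕ → ℕ) m n → sumTo (λ i → sumTo (f i) n) m ≡ sumTo (λ j → sumTo (λ i → f i j) m) n
sumTo-swap f zero    n = sym (sumTo-zero n (λ _ _ → refl))
sumTo-swap f (suc m) n = trans (cong (sumTo (f m) n +_) (sumTo-swap f m n)) (sym (sumTo-+ (f m) _ n))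

-- Lists given by their entries

allTo-elim : ∀ {f} n → allTo f n ≡ true → ∀ {i} → i < n → f i ≡ true
allTo-elim {f} (suc n) h {i} i<n with i ≟ n
... | yes refl = proj₁ (∧-true {f n} h)
... | no  i≢n  = allTo-elim n (proj₂ (∧-true {f n} h)) (≤∧≢⇒< (s≤s⁻¹ i<n) i≢n)

allTo-intro : ∀ {f} n → (∀ {i} → i < n → f i ≡ true) → allTo f n ≡ true
allTo-intro zero    h = refl
allTo-intro (suc n) h = ∧-intro (h ≤-refl) (allTo-intro n (λ lt → h (m<n⇒m<1+n lt)))

nth-concat : ∀ {A : Set} {d : A} {k n} (F : Fin k → List A) → (∀ j → length (F j) ≡ n) →
             ∀ j {i} → i < n → nth d (concat (tabulate F)) (toℕ j * n + i) ≡ nth d (F j) i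
nth-concat F len zero    i<n = nth-++ˡ (F zero) _ (subst (_ <_) (sym (len zero)) i<n)
nth-concat {d = d} {n = n} F len (suc j) {i} i<n = trans
  (cong (nth d (F zero ++ concat (tabulate (F ∘ suc)))) (trans (+-assoc n (toℕ j * n) i) (cong (_+ (toℕ j * n + i)) (sym (len zero)))))
  (trans (nth-++ʳ (F zero) (concat (tabulate (F ∘ suc))) (toℕ j * n + i)) (nth-concat (F ∘ suc) (len ∘ suc) j i<n))

applyUpTo-+ : ∀ {A : Set} (f : ℕ → A) m n → applyUpTo f (m + n) ≡ applyUpTo f m ++ applyUpTo (λ i → f (m + i)) n
applyUpTo-+ f zero    n = refl
applyUpTo-+ f (suc m) n = cong (f 0 ∷_) (applyUpTo-+ (f ∘ suc) m n)

applyUpTo-cong : ∀ {A : Set} {f g : ℕ → A} n → (∀ {i} → i < n → f i ≡ g i) → applyUpTo f n ≡ applyUpTo g n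
applyUpTo-cong zero    h = refl
applyUpTo-cong (suc n) h = cong₂ _∷_ (h (s≤s z≤n)) (applyUpTo-cong n (h ∘ s≤s))

tabulate-upTo : ∀ {A : Set} (f : ℕ → A) n → tabulate {n = n} (λ v → f (toℕ v)) ≡ applyUpTo f n
tabulate-upTo f zero    = refl
tabulate-upTo f (suc n) = cong (f 0 ∷_) (tabulate-upTo (f ∘ suc) n)

concat-blocks : ∀ {A : Set} (h : ℕ → A) k n →
  concat (tabulate {n = k} λ j → tabulate {n = n} λ v → h (toℕ j * n + toℕ v)) ≡ applyUpTo h (k * n)
concat-blocks h zero    n = refl
concat-blocks h (suc k) n = trans (cong₂ _++_ (tabulate-upTo h n)
    (trans (cong concat (Listₚ.tabulate-cong {n = k} λ j → Listₚ.tabulate-cong {n = n} λ v → cong h (+-assoc n (toℕ j * n) (toℕ v))))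
      (concat-blocks (λ i → h (n + i)) k n)))
  (sym (applyUpTo-+ h n (k * n)))

applyUpTo-nth : ∀ {A : Set} (d : A) l {m} → m ≤ length l → applyUpTo (nth d l) m ≡ take m l
applyUpTo-nth d l       {zero}  le       = refl
applyUpTo-nth d (x ∷ l) {suc m} (s≤s le) = cong (x ∷_) (applyUpTo-nth d l le)

nth-drop : ∀ {A : Set} (d : A) s l i → nth d l (s + i) ≡ nth d (drop s l) i
nth-drop d zero    l       i = refl
nth-drop d (suc s) []      i = refl
nth-drop d (suc s) (x ∷ l) i = nth-drop d s l i

-- Iteration of functions

iter : (ℕ → ℕ) → ℕ → ℕ → ℕ
iter f = natrec (λ _ → f)

iter-front : ∀ f a m → iter f a (suc m) ≡ iter f (f a) m
iter-front f a zero    = refl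
iter-front f a (suc m) = cong f (iter-front f a m)

-- The length of the initial run of trues of P, cut off at the number of steps.
scan : (ℕ → Bool) → ℕ → ℕ
scan P = iter (λ i → if P i then suc i else i) 0

scan-unique : ∀ P n m → (∀ {i} → i < n → P i ≡ true) → P n ≡ false → n ≤ m → scan P m ≡ n
scan-unique P n m below stop n≤m = trans (steps m) (m≥n⇒m⊓n≡n n≤m)
  where
  steps : ∀ m → scan P m ≡ m ⊓ n
  steps zero = refl
  steps (suc m) rewrite steps m with m <? n
  ... | yes m<n rewrite m≤n⇒m⊓n≡m (<⇒≤ m<n) | m≤n⇒m⊓n≡m m<n | below m<n = refl
  ... | no  m≮n rewrite m≥n⇒m⊓n≡n (≮⇒≥ m≮n) | m≥n⇒m⊓n≡n (m≤n⇒m≤1+n (≮⇒≥ m≮n)) | stop = refl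

scan-spec : ∀ P m → (∀ {i} → i < scan P m → P i ≡ true) × (scan P m ≡ m ⊎ P (scan P m) ≡ false)
scan-spec P zero    = (λ ()) , inj₁ refl
scan-spec P (suc m) with scan P m | scan-spec P m
... | r | below , end with P r in eq
...   | false = below , inj₂ eq
...   | true  = below′ , end′ end
  where
  below′ : ∀ {i} → i < suc r → P i ≡ true
  below′ {i} lt with i ≟ r
  ... | yes refl = eq
  ... | no  i≢r  = below (≤∧≢⇒< (s≤s⁻¹ lt) i≢r)
  end′ : r ≡ m ⊎ true ≡ false → suc r ≡ suc m ⊎ P (suc r) ≡ false
  end′ (inj₁ refl) = inj₁ refl

-- The verifier

sameᵇ : Bool → Bool → Bool
sameᵇ true  b = b
sameᵇ false b = not b

sameB : ∀ {n} {f g : BFun n} → CompB f → CompB g → CompB (λ w ρ → sameᵇ (f w ρ) (g w ρ))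
sameB {f = f} {g} F G = congC (λ w ρ → lemma (f w ρ) (g w ρ)) (F ≡B G)
  where
  lemma : ∀ a b → b2n (b2n a ≡ᵇ b2n b) ≡ b2n (sameᵇ a b)
  lemma true  true  = refl
  lemma true  false = refl
  lemma false true  = refl
  lemma false false = refl

-- The instance is the word X of length L; the certificate Y lists one side of
-- the bipartition and then the k colour classes.  With strict = true also the
-- numbers are compared with L.
module Check (k : ℕ) (strict : Bool) (X : ℕ → Bool) (L : ℕ) (Y : ℕ → Bool) where

  n base : ℕ
  n = scan X L
  base = n + suc (n * n)

  adj : ℕ → ℕ → Bool
  adj u v = X (n + suc (u * n + v))

  -- adv passes over a digit of a number and stays at its end.
  adv numEnd start : ℕ → ℕ
  adv p = if X p then 2 + p else p
  numEnd s = suc (iter adv s L)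
  start = iter numEnd base

  -- Past the end of a number the digit is 0, so the same count L of digits can be read from every
  -- number.
  digit : ℕ → ℕ → ℕ
  digit s i = if X (iter adv s i) then (if X (suc (iter adv s i)) then 2 else 1) else 0

  inClass : ℕ → ℕ → Bool
  inClass j v = Y (suc j * n + v)

  graphOK bipartiteOK independentOK disjointOK fairOK wellFormed bounded check : Bool
  graphOK = allTo (λ u → not (adj u u) ∧ allTo (λ v → sameᵇ (adj u v) (adj v u)) n) n
  bipartiteOK = allTo (λ u → allTo (λ v → adj u v ⇒ᵇ not (sameᵇ (Y u) (Y v))) n) n
  independentOK = allTo (λ j → allTo (λ u → allTo (λ v → (inClass j u ∧ inClass j v) ⇒ᵇ not (adj u v)) n) n) k
  disjointOK = allTo (λ i → allTo (λ j → allTo (λ v → (inClass i v ∧ inClass j v) ⇒ᵇ (i ≡ᵇ j)) n) k) k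

  -- The sum of the i-th digits over class j is at most 2n, small enough for a unary register even
  -- if the profits are not.
  column : ℕ → ℕ → ℕ
  column j i = sumTo (λ v → b2n (inClass j v) * digit (start (suc (j * n + v))) i) n

  fairOK = allTo (λ j → 1 <ᵇ balance (column j) (digit (start 0)) L) k
  wellFormed = start (suc (k * n)) ≡ᵇ L

  -- The number L written with one huge digit. `balance` restricts only the digits of its second
  -- argument, so L need not be converted.
  single : ℕ → ℕ
  single i = if i ≡ᵇ 0 then L else 0

  bounded = allTo (λ m → 1 <ᵇ balance single (digit (start m)) L) (suc (k * n))

  check = wellFormed ∧ graphOK ∧ bipartiteOK ∧ independentOK ∧ disjointOK ∧ fairOK ∧ (strict ⇒ᵇ bounded)

iterC : ∀ {n} {f : Bits → ℕ → ℕ} {ini cnt : Fun n} {h : Fun 0} →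
        Comp {1} (λ w ρ → f w (ρ #0)) → Comp h → (∀ w a → f w a ≤ a + h w noArgs) →
        Comp ini → Comp cnt → Comp (λ w ρ → iter (f w) (ini w ρ) (cnt w ρ))
iterC {f = f} F H growth I C = recC I C (app₁ {g = f} F (varC #1)) (renC none H) (λ w ρ i a → growth w a)
  where
  none : ∀ {n} → Selection 0 n
  none = selection (λ _ → noArgs) (λ ()) (λ _ ())

-- In a pair the even positions are true until the first component ends.
lengthOf : Bits → ℕ
lengthOf z = scan (λ i → nth false z (2 * i)) (length z)

firstPart secondPart : Bits → ℕ → Bool
firstPart z i = (i <ᵇ lengthOf z) ∧ nth false z (suc (2 * i))
secondPart z i = nth false z (suc (2 * lengthOf z) + i)

module _ (k : ℕ) (strict : Bool) where

  module V (z : Bits) = Check k strict (firstPart z) (lengthOf z) (secondPart z)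

  verifier : Bits → Bool
  verifier z = V.check z

  LC : ∀ {n} → Comp {n} (λ w ρ → lengthOf w)
  LC = iterC {f = λ w i → if nth false w (2 * i) then suc i else i}
    (ifC (bitB (litC 2 *C varC #0)) (sucC (varC #0)) (varC #0)) (litC 1)
    (λ w a → step≤ (nth false w (2 * a)) a 1) zeroC lengthC

  XB : ∀ {n} {f : Fun n} → Comp f → CompB (λ w ρ → firstPart w (f w ρ))
  XB F = F <B LC ∧B bitB (sucC (litC 2 *C F))

  YB : ∀ {n} {f : Fun n} → Comp f → CompB (λ w ρ → secondPart w (f w ρ))
  YB F = bitB (sucC (litC 2 *C LC) +C F)

  nC : ∀ {n} → Comp {n} (λ w ρ → V.n w)
  nC = iterC {f = λ w i → if firstPart w i then suc i else i}
    (ifC (XB (varC #0)) (sucC (varC #0)) (varC #0)) (litC 1)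
    (λ w a → step≤ (firstPart w a) a 1) zeroC LC

  adjB : ∀ {n} {f g : Fun n} → Comp f → Comp g → CompB (λ w ρ → V.adj w (f w ρ) (g w ρ))
  adjB F G = XB (nC +C sucC (F *C nC +C G))

  advsC : ∀ {n} {f g : Fun n} → Comp f → Comp g → Comp (λ w ρ → iter (V.adv w) (f w ρ) (g w ρ))
  advsC = iterC {f = V.adv} (ifC (XB (varC #0)) (sucC (sucC (varC #0))) (varC #0)) (litC 2)
    (λ w a → step≤ (firstPart w a) a 2)

  advs≤ : ∀ w s m → iter (V.adv w) s m ≤ s + m * 2
  advs≤ w s m = natrec-≤ (λ _ → V.adv w) s 2 m (λ i a _ → step≤ (firstPart w a) a 2)

  startC : ∀ {n} {f : Fun n} → Comp f → Comp (λ w ρ → V.start w (f w ρ))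
  startC = iterC {f = V.numEnd} (sucC (advsC (varC #0) LC)) (sucC (LC *C litC 2))
    (λ w a → ≤-trans (s≤s (advs≤ w a (lengthOf w))) (≤-reflexive (sym (+-suc a (lengthOf w * 2)))))
    (nC +C sucC (nC *C nC))

  digitC : ∀ {n} {f g : Fun n} → Comp f → Comp g → Comp (λ w ρ → V.digit w (f w ρ) (g w ρ))
  digitC S I = ifC (XB (advsC S I)) (ifC (XB (sucC (advsC S I))) (litC 2) (litC 1)) (litC 0)

  inClassB : ∀ {n} {f g : Fun n} → Comp f → Comp g → CompB (λ w ρ → V.inClass w (f w ρ) (g w ρ))
  inClassB J U = YB (sucC J *C nC +C U)

  columnC : ∀ {n} {f g : Fun n} → Comp f → Comp g → Comp (λ w ρ → V.column w (f w ρ) (g w ρ))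
  columnC J I = app₂ {g = V.column} (sumC nC (inClassB (varC #1) (varC #0) *C
    digitC (startC (sucC (varC #1 *C nC +C varC #0))) (varC #2))) J I

  singleC : ∀ {n} {f : Fun n} → Comp f → Comp (λ w ρ → V.single w (f w ρ))
  singleC I = ifC (I ≡B litC 0) LC (litC 0)

  balanceC : ∀ {n} {c d : Bits → ℕ → ℕ → ℕ} {j l : Fun n} → Comp {2} (λ w ρ → c w (ρ #0) (ρ #1)) →
    Comp {2} (λ w ρ → d w (ρ #0) (ρ #1)) → Comp j → Comp l →
    Comp (λ w ρ → balance (c w (j w ρ)) (d w (j w ρ)) (l w ρ))
  balanceC {c = c} {d} Cc Dd J Lc = recC (litC 2) Lc
    (halfC ((varC #1 +C (litC 2 +C app₂ {g = c} Cc (wkC (wkC J)) (varC #0))) ∸C app₂ {g = d} Dd (wkC (wkC J)) (varC #0)))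
    (litC 2 +C app₂ {g = c} Cc (wkC J) (varC #0))
    (λ w ρ i a → ≤-trans (⌊n/2⌋≤n _) (m∸n≤m _ (d w _ i)))

  checkB : CompB {0} (λ w ρ → verifier w)
  checkB =
    startC (sucC (litC k *C nC)) ≡B LC ∧B
    allB nC (notB (adjB (varC #0) (varC #0)) ∧B allB nC (sameB (adjB (varC #1) (varC #0)) (adjB (varC #0) (varC #1)))) ∧B
    allB nC (allB nC (adjB (varC #1) (varC #0) ⇒B notB (sameB (YB (varC #1)) (YB (varC #0))))) ∧B
    allB (litC k) (allB nC (allB nC ((inClassB (varC #2) (varC #1) ∧B inClassB (varC #2) (varC #0)) ⇒B
      notB (adjB (varC #1) (varC #0))))) ∧B
    allB (litC k) (allB (litC k) (allB nC ((inClassB (varC #2) (varC #0) ∧B inClassB (varC #1) (varC #0)) ⇒B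
      varC #2 ≡B varC #1))) ∧B
    allB (litC k) (litC 1 <B balanceC {c = V.column} {d = λ w _ → V.digit w (V.start w 0)}
      (columnC (varC #0) (varC #1)) (digitC (startC (litC 0)) (varC #1)) (varC #0) LC) ∧B
    (constB strict ⇒B allB (sucC (litC k *C nC)) (litC 1 <B balanceC {c = λ w _ → V.single w} {d = λ w m → V.digit w (V.start w m)}
      (singleC (varC #1)) (digitC (startC (varC #0)) (varC #1)) (varC #0) LC))

  verifier-PolyTime : PolyTime (λ z → verifier z ∷ [])
  verifier-PolyTime = out⇒PolyTime (bitO checkB)

-- Correctness of the verifier

fin-below : ∀ {n} {P : ℕ → Set} → (∀ (v : Fin n) → P (toℕ v)) → ∀ {i} → i < n → P i
fin-below {P = P} h i<n = subst P (Finₚ.toℕ-fromℕ< i<n) (h (Fin.fromℕ< i<n))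

iter-fixed : ∀ {f a} → f a ≡ a → ∀ m → iter f a m ≡ a
iter-fixed fix zero    = refl
iter-fixed {f} fix (suc m) = trans (cong f (iter-fixed fix m)) fix

iter-≥ : ∀ {f} → (∀ a → a ≤ f a) → ∀ a m → a ≤ iter f a m
iter-≥ h a zero    = ≤-refl
iter-≥ h a (suc m) = ≤-trans (iter-≥ h a m) (h _)

nth-replicate : ∀ {A : Set} {d : A} n x {i} → i < n → nth d (replicate n x) i ≡ x
nth-replicate (suc n) x {zero}  _        = refl
nth-replicate (suc n) x {suc i} (s≤s lt) = nth-replicate n x lt

nth⇒All : ∀ {P : ℕ → Set} l → (∀ {m} → m < length l → P (nth 0 l m)) → All P l
nth⇒All []      h = []
nth⇒All (x ∷ l) h = h (s≤s z≤n) ∷ nth⇒All l (h ∘ s≤s)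

All⇒nth : ∀ {P : ℕ → Set} {l} → All P l → ∀ {m} → m < length l → P (nth 0 l m)
All⇒nth (p ∷ ps) {zero}  _        = p
All⇒nth (p ∷ ps) {suc m} (s≤s lt) = All⇒nth ps lt

value : Bits → ℕ
value []       = 0
value (b ∷ ds) = (if b then 2 else 1) + 2 * value ds

-- Bijective base 2 has no leading zeros: every bit string is the digit string of a number, so
-- parsing never has to reject digits.
undigits : Bits → ℕᵇ
undigits []           = zero
undigits (true  ∷ ds) = 2[1+ undigits ds ]
undigits (false ∷ ds) = 1+[2 undigits ds ]

digits-undigits : ∀ ds → digits (undigits ds) ≡ ds
digits-undigits []           = refl
digits-undigits (true  ∷ ds) = cong (true ∷_) (digits-undigits ds)
digits-undigits (false ∷ ds) = cong (false ∷_) (digits-undigits ds)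

encode-undigits : ∀ ds → encodeNumber (ℕᵇ.toℕ (undigits ds)) ≡ delimit ds
encode-undigits ds = cong delimit (trans (cong digits (ℕᵇₚ.fromℕ-toℕ (undigits ds))) (digits-undigits ds))

value-digits : ∀ b → value (digits b) ≡ ℕᵇ.toℕ b
value-digits zero     = refl
value-digits 2[1+ b ] rewrite value-digits b = sym (*-suc 2 (ℕᵇ.toℕ b))
value-digits 1+[2 b ] rewrite value-digits b = refl

value-number : ∀ a → value (digits (ℕᵇ.fromℕ a)) ≡ a
value-number a = trans (value-digits (ℕᵇ.fromℕ a)) (ℕᵇₚ.toℕ-fromℕ a)

fairInstance : ∀ {k n} → Graph n → (Fin k → Fin n → ℕ) → ℕ → FairInstance k
fairInstance {n = n} G p q = record { n = n ; G = G ; p = p ; q = q }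

module Correctness (k : ℕ) (strict : Bool) (x : Bits) (X : ℕ → Bool) (X≗ : ∀ i → X i ≡ nth false x i)
                   (Y : ℕ → Bool) where

  L : ℕ
  L = length x

  open Check k strict X L Y

  -- From position s on, x reads r. Both sides continue with the default `false`, since `adv` may
  -- look past the end of the word.
  record Suffix (s : ℕ) (r : Bits) : Set where
    field
      reads : ∀ i → X (s + i) ≡ nth false r i
      ends  : s + length r ≡ L
  open Suffix

  suffix-++ : ∀ l {r s} → Suffix s (l ++ r) → Suffix (s + length l) r
  suffix-++ l {r} {s} S = record
    { reads = λ i → trans (cong X (+-assoc s (length l) i)) (trans (reads S (length l + i)) (nth-++ʳ l r i))
    ; ends = trans (+-assoc s (length l) (length r)) (trans (cong (s +_) (sym (Listₚ.length-++ l))) (ends S)) }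

  suffix-at : ∀ {s s′ r} → s ≡ s′ → Suffix s r → Suffix s′ r
  suffix-at refl S = S

  suffix-tail : ∀ {b r s} → Suffix s (b ∷ r) → Suffix (suc s) r
  suffix-tail {b} {r} {s} S = suffix-at (+-comm s 1) (suffix-++ (b ∷ []) S)

  first-bit : ∀ {b r s} → Suffix s (b ∷ r) → X s ≡ b
  first-bit {s = s} S = trans (cong X (sym (+-identityʳ s))) (reads S 0)

  position≤L : ∀ {r s} → Suffix s r → s ≤ L
  position≤L {r} {s} S = ≤-trans (m≤m+n s (length r)) (≤-reflexive (ends S))

  adv-true : ∀ {s} → X s ≡ true → adv s ≡ 2 + s
  adv-true h = if-true h

  adv-false : ∀ {s} → X s ≡ false → adv s ≡ s
  adv-false h = if-false h

  digit-suc : ∀ s i → digit s (suc i) ≡ digit (adv s) i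
  digit-suc s i = cong (λ p → if X p then (if X (suc p) then 2 else 1) else 0) (iter-front adv s i)

  digit≤2 : ∀ s i → digit s i ≤ 2
  digit≤2 s i with X (iter adv s i) | X (suc (iter adv s i))
  ... | true  | true  = ≤-refl
  ... | true  | false = s≤s z≤n
  ... | false | _     = z≤n

  advs-delimit : ∀ ds {s r} c → Suffix s (delimit ds ++ r) → length ds ≤ c → iter adv s c ≡ s + 2 * length ds
  advs-delimit []       {s} c S le = trans (iter-fixed (adv-false (first-bit S)) c) (sym (+-identityʳ s))
  advs-delimit (b ∷ ds) {s} {r} (suc c) S (s≤s le) = begin
    iter adv s (suc c)                 ≡⟨ iter-front adv s c ⟩
    iter adv (adv s) c                 ≡⟨ cong (λ s → iter adv s c) (adv-true (first-bit S)) ⟩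
    iter adv (2 + s) c                 ≡⟨ advs-delimit ds c (suffix-tail (suffix-tail S)) le ⟩
    2 + s + 2 * length ds              ≡⟨ lemma s (length ds) ⟩
    s + 2 * suc (length ds)            ∎
    where
    open ≡-Reasoning
    lemma : ∀ s l → 2 + s + 2 * l ≡ s + 2 * suc l
    lemma = solve-∀

  weighted-delimit : ∀ ds {s r} c → Suffix s (delimit ds ++ r) → length ds ≤ c → weighted (digit s) c ≡ value ds
  weighted-delimit [] {s} c S le = sumTo-zero c λ i _ → cong (_* 2 ^ i)
    (if-false (trans (cong X (iter-fixed (adv-false (first-bit S)) i)) (first-bit S)))
  weighted-delimit (b ∷ ds) {s} (suc c) S (s≤s le) = begin
    weighted (digit s) (suc c)                                            ≡⟨ sumTo-front (λ i → digit s i * 2 ^ i) c ⟩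
    digit s 0 * 1 + sumTo (λ i → digit s (suc i) * (2 * 2 ^ i)) c         ≡⟨ cong₂ _+_ (trans (*-identityʳ _) leading) rest ⟩
    (if b then 2 else 1) + 2 * value ds                                   ∎
    where
    open ≡-Reasoning
    S′ = suffix-tail S
    leading : digit s 0 ≡ (if b then 2 else 1)
    leading = trans (if-true (first-bit S)) (cong (λ b → if b then 2 else 1) (first-bit S′))
    following : ∀ i → digit s (suc i) ≡ digit (2 + s) i
    following i = trans (digit-suc s i) (cong (λ s → digit s i) (adv-true (first-bit S)))
    lemma : ∀ a b → a * (2 * b) ≡ 2 * (a * b)
    lemma = solve-∀
    rest : sumTo (λ i → digit s (suc i) * (2 * 2 ^ i)) c ≡ 2 * value ds
    rest = trans (sumTo-cong c (λ i _ → trans (cong (_* (2 * 2 ^ i)) (following i)) (lemma (digit (2 + s) i) (2 ^ i))))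
      (trans (sumTo-*ˡ (λ i → digit (2 + s) i * 2 ^ i) 2 c) (cong (2 *_) (weighted-delimit ds c (suffix-tail S′) le)))

  digits≤L : ∀ ds {s r} → Suffix s (delimit ds ++ r) → length ds ≤ L
  digits≤L ds {s} {r} S = begin
    length ds                       ≤⟨ m≤m+n _ _ ⟩
    2 * length ds                   ≤⟨ n≤1+n _ ⟩
    suc (2 * length ds)             ≡⟨ length-delimit ds ⟨
    length (delimit ds)             ≤⟨ m≤n+m _ s ⟩
    s + length (delimit ds)         ≤⟨ position≤L (suffix-++ (delimit ds) S) ⟩
    L                               ∎
    where open ≤-Reasoning

  numEnd-delimit : ∀ ds {s r} → Suffix s (delimit ds ++ r) → numEnd s ≡ s + length (delimit ds)
  numEnd-delimit ds {s} S = trans (cong suc (advs-delimit ds L S (digits≤L ds S)))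
    (trans (sym (+-suc s (2 * length ds))) (cong (s +_) (sym (length-delimit ds))))

  after-number : ∀ ds {s r} → Suffix s (delimit ds ++ r) → Suffix (numEnd s) r
  after-number ds S = suffix-at (sym (numEnd-delimit ds S)) (suffix-++ (delimit ds) S)

  number-value : ∀ ns {s m} → Suffix s (encodeNumbers ns) → m < length ns →
                 weighted (digit (iter numEnd s m)) L ≡ nth 0 ns m
  number-value (a ∷ ns) {s} {zero} S _ =
    trans (weighted-delimit (digits (ℕᵇ.fromℕ a)) L S (digits≤L (digits (ℕᵇ.fromℕ a)) S)) (value-number a)
  number-value (a ∷ ns) {s} {suc m} S (s≤s lt) = trans (cong (λ s → weighted (digit s) L) (iter-front numEnd s m))
    (number-value ns (after-number (digits (ℕᵇ.fromℕ a)) S) lt)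

  numbers-end : ∀ ns {s} → Suffix s (encodeNumbers ns) → iter numEnd s (length ns) ≡ L
  numbers-end []       {s} S = trans (sym (+-identityʳ s)) (ends S)
  numbers-end (a ∷ ns) {s} S = trans (iter-front numEnd s (length ns))
    (numbers-end ns (after-number (digits (ℕᵇ.fromℕ a)) S))

  whole : Suffix 0 x
  whole = record { reads = X≗ ; ends = refl }

  -- The unary count of vertices ends at the first 0 of the encoding, so `scan` finds it.
  vertices : ∀ I → encodeFair {k} I ≡ x → FairInstance.n I ≡ n
  vertices I enc = sym (scan-unique X n₀ L trues (first-bit after) (position≤L after))
    where
    n₀ = FairInstance.n I
    rest = concat (tabulate λ u → tabulate λ v → adjacent (FairInstance.G I) u v)
    numbers = encodeNumbers (DecisionProblem.numbers (FairDivision k) I)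
    here′ : Suffix 0 (replicate n₀ true ++ false ∷ rest ++ numbers)
    here′ = subst (Suffix 0) (trans (sym enc) (Listₚ.++-assoc (replicate n₀ true) (false ∷ rest) numbers)) whole
    after : Suffix n₀ (false ∷ rest ++ numbers)
    after = suffix-at (Listₚ.length-replicate n₀) (suffix-++ (replicate n₀ true) here′)
    trues : ∀ {i} → i < n₀ → X i ≡ true
    trues {i} lt = trans (reads here′ i) (trans
      (nth-++ˡ (replicate n₀ true) _ (subst (i <_) (sym (Listₚ.length-replicate n₀)) lt)) (nth-replicate n₀ true lt))

  n≤L : n ≤ L
  n≤L = ≤-trans (natrec-≤ _ 0 1 L (λ i a _ → step≤ (X a) a 1)) (≤-reflexive (*-identityʳ L))

  module Matched (G : Graph n) (p : Fin k → Fin n → ℕ) (q : ℕ)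
                 (enc : encodeFair (fairInstance G p q) ≡ x) where

    rest : Bits
    rest = concat (tabulate λ u → tabulate λ v → adjacent G u v)

    profits numbers : List ℕ
    profits = concat (tabulate λ j → tabulate (p j))
    numbers = q ∷ profits

    length-rest : length rest ≡ n * n
    length-rest = length-concat-tabulate (λ u → tabulate (adjacent G u)) (λ u → Listₚ.length-tabulate (adjacent G u))

    length-numbers : length numbers ≡ suc (k * n)
    length-numbers = cong suc (length-concat-tabulate (λ j → tabulate (p j)) (λ j → Listₚ.length-tabulate (p j)))

    graph-suffix : Suffix (suc n) (rest ++ encodeNumbers numbers)
    graph-suffix = suffix-tail (suffix-at (Listₚ.length-replicate n) (suffix-++ (replicate n true)
      (subst (Suffix 0) (trans (sym enc) (Listₚ.++-assoc (replicate n true) (false ∷ rest) _)) whole)))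

    numbers-suffix : Suffix base (encodeNumbers numbers)
    numbers-suffix = suffix-at (trans (cong (suc n +_) length-rest) (sym (+-suc n (n * n)))) (suffix-++ rest graph-suffix)

    adj≡ : ∀ u v → adj (toℕ u) (toℕ v) ≡ adjacent G u v
    adj≡ u v = begin
      X (n + suc i)                                    ≡⟨ cong X (+-suc n i) ⟩
      X (suc n + i)                                    ≡⟨ reads graph-suffix i ⟩
      nth false (rest ++ encodeNumbers numbers) i      ≡⟨ nth-++ˡ rest _ (subst (i <_) (sym length-rest) (mixed-radix (Finₚ.toℕ<n u) (Finₚ.toℕ<n v))) ⟩
      nth false rest i                                 ≡⟨ nth-concat (λ u → tabulate (adjacent G u)) (λ u → Listₚ.length-tabulate (adjacent G u)) u (Finₚ.toℕ<n v) ⟩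
      nth false (tabulate (adjacent G u)) (toℕ v)      ≡⟨ nth-tabulate false (adjacent G u) v ⟩
      adjacent G u v                                   ∎
      where
      open ≡-Reasoning
      i = toℕ u * n + toℕ v

    value≡ : ∀ {m} → m < suc (k * n) → weighted (digit (start m)) L ≡ nth 0 numbers m
    value≡ {m} lt = number-value numbers numbers-suffix (subst (m <_) (sym length-numbers) lt)

    profit≡ : ∀ j v → weighted (digit (start (suc (toℕ j * n + toℕ v)))) L ≡ p j v
    profit≡ j v = trans (value≡ (s≤s (mixed-radix (Finₚ.toℕ<n j) (Finₚ.toℕ<n v))))
      (trans (nth-concat (λ j → tabulate (p j)) (λ j → Listₚ.length-tabulate (p j)) j (Finₚ.toℕ<n v)) (nth-tabulate 0 (p j) v))

    wellFormed≡ : wellFormed ≡ true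
    wellFormed≡ = trans (cong (_≡ᵇ L) (trans (cong start (sym length-numbers)) (numbers-end numbers numbers-suffix))) (≡ᵇ-refl L)

    graph≡ : graphOK ≡ true
    graph≡ = allTo-intro n (fin-below λ u → ∧-intro (cong not (trans (adj≡ u u) (loopless G u)))
      (allTo-intro n (fin-below λ v → same (trans (adj≡ u v) (trans (symmetric G u v) (sym (adj≡ v u)))))))
      where
      same : ∀ {a b} → a ≡ b → sameᵇ a b ≡ true
      same {true}  refl = refl
      same {false} refl = refl

    weighted-single : weighted single L ≡ L
    weighted-single = go L
      where
      go : ∀ m → sumTo (λ i → (if i ≡ᵇ 0 then m else 0) * 2 ^ i) m ≡ m
      go zero    = refl
      go (suc m) = trans (sumTo-front (λ i → (if i ≡ᵇ 0 then suc m else 0) * 2 ^ i) m)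
        (trans (cong (suc m * 1 +_) (sumTo-zero m (λ _ _ → refl))) (trans (+-identityʳ _) (*-identityʳ (suc m))))

    bounded⇔ : (bounded ≡ true) ⇔ All (_≤ L) numbers
    bounded⇔ = mk⇔
      (λ h → nth⇒All numbers λ {m} lt → let lt′ = subst (m <_) length-numbers lt in
        subst₂ _≤_ (value≡ lt′) weighted-single
          (Equivalence.to (balance-spec single (digit (start m)) (digit≤2 _) L) (allTo-elim (suc (k * n)) h lt′)))
      (λ h → allTo-intro (suc (k * n)) λ {m} lt → Equivalence.from (balance-spec single (digit (start m)) (digit≤2 _) L)
        (subst₂ _≤_ (sym (value≡ lt)) (sym weighted-single) (All⇒nth h (subst (m <_) (sym length-numbers) lt))))

    module Classes (A : Subset n) (C : Fin k → Subset n) (A≡ : ∀ v → Y (toℕ v) ≡ lookup A v)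
                   (C≡ : ∀ j v → inClass (toℕ j) (toℕ v) ≡ lookup (C j) v) where

      -- The sums over digits and over vertices are exchanged; for each vertex the inner sum is then
      -- its profit.
      column-weighted : ∀ j → weighted (column (toℕ j)) L ≡ profit (p j) (C j)
      column-weighted j = begin
        sumTo (λ i → sumTo (λ v → b v * digit (σ v) i) n * 2 ^ i) L         ≡⟨ sumTo-cong L (λ i _ → sym (sumTo-*ʳ (λ v → b v * digit (σ v) i) (2 ^ i) n)) ⟩
        sumTo (λ i → sumTo (λ v → b v * digit (σ v) i * 2 ^ i) n) L         ≡⟨ sumTo-swap (λ i v → b v * digit (σ v) i * 2 ^ i) L n ⟩
        sumTo (λ v → sumTo (λ i → b v * digit (σ v) i * 2 ^ i) L) n         ≡⟨ sumTo-cong n (λ v _ → trans (sumTo-cong L (λ i _ → *-assoc (b v) (digit (σ v) i) (2 ^ i)))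
                                                                                  (sumTo-*ˡ (λ i → digit (σ v) i * 2 ^ i) (b v) L)) ⟩
        sumTo (λ v → b v * weighted (digit (σ v)) L) n                      ≡⟨ profit-sum (p j) (C j) _ (λ v →
                                                                                  cong₂ _*_ (cong b2n (sym (C≡ j v))) (sym (profit≡ j v))) ⟨
        profit (p j) (C j)                                                  ∎
        where
        open ≡-Reasoning
        b σ : ℕ → ℕ
        b v = b2n (inClass (toℕ j) v)
        σ v = start (suc (toℕ j * n + v))

      fair⇔ : (fairOK ≡ true) ⇔ (∀ j → q ≤ profit (p j) (C j))
      fair⇔ = mk⇔
        (λ h j → subst₂ _≤_ (value≡ (s≤s z≤n)) (column-weighted j)
          (Equivalence.to (balance-spec (column (toℕ j)) (digit (start 0)) (digit≤2 _) L) (allTo-elim k h (Finₚ.toℕ<n j))))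
        (λ h → allTo-intro k (fin-below λ j → Equivalence.from (balance-spec (column (toℕ j)) (digit (start 0)) (digit≤2 _) L)
          (subst₂ _≤_ (sym (value≡ (s≤s z≤n))) (sym (column-weighted j)) (h j))))

      adjacent⇒ : ∀ {u v} → T (adjacent G u v) → adj (toℕ u) (toℕ v) ≡ true
      adjacent⇒ {u} {v} t = trans (adj≡ u v) (T⇒true t)

      ⇒adjacent : ∀ {u v} → adj (toℕ u) (toℕ v) ≡ true → T (adjacent G u v)
      ⇒adjacent {u} {v} h = subst T (sym (trans (sym (adj≡ u v)) h)) tt

      bipartite⇔ : (bipartiteOK ≡ true) ⇔ (Independent G A × Independent G (∁ A))
      bipartite⇔ = mk⇔
        (λ h → (λ u v u∈ v∈ t → clash h t (∈⇒lookup u∈) (∈⇒lookup v∈)) ,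
               (λ u v u∈ v∈ t → clash h t (∈∁⇒lookup u∈) (∈∁⇒lookup v∈)))
        (λ (i , i′) → allTo-intro n (fin-below λ u → allTo-intro n (fin-below λ v → ⇒-intro λ a →
          differ (i u v) (i′ u v) (⇒adjacent a))))
        where
        lookup⇒∈∁ : ∀ {v} → lookup A v ≡ false → v ∈ ∁ A
        lookup⇒∈∁ {v} eq = lookup⇒∈ (trans (Vecₚ.lookup-map v not A) (cong not eq))
        clash : ∀ {u v b} → bipartiteOK ≡ true → T (adjacent G u v) → lookup A u ≡ b → lookup A v ≡ b → ⊥
        clash {u} {v} {b} h t eu ev = absurd b (trans (cong₂ (λ a c → not (sameᵇ a c)) (sym (trans (A≡ u) eu)) (sym (trans (A≡ v) ev)))
          (⇒-elim (adj (toℕ u) (toℕ v)) (allTo-elim n (allTo-elim n h (Finₚ.toℕ<n u)) (Finₚ.toℕ<n v)) (adjacent⇒ {u} {v} t)))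
          where
          absurd : ∀ b → not (sameᵇ b b) ≡ true → ⊥
          absurd true  ()
          absurd false ()
        differ : ∀ {u v} → (u ∈ A → v ∈ A → ¬ T (adjacent G u v)) → (u ∈ ∁ A → v ∈ ∁ A → ¬ T (adjacent G u v)) →
                 T (adjacent G u v) → not (sameᵇ (Y (toℕ u)) (Y (toℕ v))) ≡ true
        differ {u} {v} i i′ t rewrite A≡ u | A≡ v with lookup A u in eu | lookup A v in ev
        ... | true  | true  = contradiction t (i (lookup⇒∈ eu) (lookup⇒∈ ev))
        ... | true  | false = refl
        ... | false | true  = refl
        ... | false | false = contradiction t (i′ (lookup⇒∈∁ eu) (lookup⇒∈∁ ev))

      in-class : ∀ {j v} → v ∈ C j → inClass (toℕ j) (toℕ v) ≡ true
      in-class {j} {v} v∈ = trans (C≡ j v) (∈⇒lookup v∈)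

      class-in : ∀ {j v} → inClass (toℕ j) (toℕ v) ≡ true → v ∈ C j
      class-in {j} {v} h = lookup⇒∈ (trans (sym (C≡ j v)) h)

      independent⇔ : (independentOK ≡ true) ⇔ (∀ j → Independent G (C j))
      independent⇔ = mk⇔
        (λ h j u v u∈ v∈ t → contradiction (trans (sym (adjacent⇒ {u} {v} t)) (not-true
          (⇒-elim (inClass (toℕ j) (toℕ u) ∧ inClass (toℕ j) (toℕ v))
            (allTo-elim n (allTo-elim n (allTo-elim k h (Finₚ.toℕ<n j)) (Finₚ.toℕ<n u)) (Finₚ.toℕ<n v))
            (∧-intro (in-class {j} u∈) (in-class {j} v∈))))) λ ())
        (λ h → allTo-intro k (fin-below λ j → allTo-intro n (fin-below λ u → allTo-intro n (fin-below λ v →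
          ⇒-intro λ uv → let (hu , hv) = ∧-true {inClass (toℕ j) (toℕ u)} uv in
            no-adj (λ a → h j u v (class-in {j} hu) (class-in {j} hv) (⇒adjacent {u} {v} a))))))
        where
        no-adj : ∀ {b} → (b ≡ true → ⊥) → not b ≡ true
        no-adj {true}  h = ⊥-elim (h refl)
        no-adj {false} h = refl

      disjoint⇔ : (disjointOK ≡ true) ⇔ (∀ i j → i ≢ j → Empty (C i ∩ C j))
      disjoint⇔ = mk⇔
        (λ h i j i≢j (v , v∈) → let (v∈i , v∈j) = x∈p∩q⁻ (C i) (C j) v∈ in
          i≢j (Finₚ.toℕ-injective (≡ᵇ-true {toℕ i} {toℕ j} (⇒-elim (inClass (toℕ i) (toℕ v) ∧ inClass (toℕ j) (toℕ v))
            (allTo-elim n (allTo-elim k (allTo-elim k h (Finₚ.toℕ<n i)) (Finₚ.toℕ<n j)) (Finₚ.toℕ<n v))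
            (∧-intro (in-class {i} v∈i) (in-class {j} v∈j))))))
        (λ h → allTo-intro k (fin-below λ i → allTo-intro k (fin-below λ j → allTo-intro n (fin-below λ v →
          ⇒-intro λ both → let (hi , hj) = ∧-true {inClass (toℕ i) (toℕ v)} both in same i j v (h i j) hi hj))))
        where
        same : ∀ i j v → (i ≢ j → Empty (C i ∩ C j)) → inClass (toℕ i) (toℕ v) ≡ true →
               inClass (toℕ j) (toℕ v) ≡ true → (toℕ i ≡ᵇ toℕ j) ≡ true
        same i j v h hi hj with i Finₚ.≟ j
        ... | yes refl = ≡ᵇ-refl (toℕ i)
        ... | no  i≢j  = ⊥-elim (h i≢j (v , x∈p∩q⁺ (class-in {i} hi , class-in {j} hj)))

  adv-≥ : ∀ a → a ≤ adv a
  adv-≥ a with X a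
  ... | true  = m≤n+m a 2
  ... | false = ≤-refl

  numEnd-≥ : ∀ a → a ≤ numEnd a
  numEnd-≥ a = ≤-trans (iter-≥ adv-≥ a L) (n≤1+n _)

  -- A number broken off by the end of the word would end beyond L, because its terminating 0 is
  -- missing and a lone continuation bit makes `adv` jump over the end.
  parse : ∀ r {s} c → Suffix s r → length r ≤ c → suc (iter adv s c) ≤ L → ∃ λ ds → ∃ λ r′ → r ≡ delimit ds ++ r′
  parse []                 {s} c S le lt = contradiction
    (≤-trans (s≤s (iter-≥ adv-≥ s c)) (≤-trans lt (≤-reflexive (trans (sym (ends S)) (+-identityʳ s))))) 1+n≰n
  parse (false ∷ r)        c S le lt = [] , r , refl
  parse (true ∷ [])        {s} (suc c) S le lt = contradiction (begin
      suc (suc (suc s))             ≤⟨ s≤s (iter-≥ adv-≥ (2 + s) c) ⟩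
      suc (iter adv (2 + s) c)      ≡⟨ cong (λ s → suc (iter adv s c)) (adv-true (first-bit S)) ⟨
      suc (iter adv (adv s) c)      ≡⟨ cong suc (iter-front adv s c) ⟨
      suc (iter adv s (suc c))      ≤⟨ lt ⟩
      L                             ≡⟨ trans (sym (ends S)) (+-comm s 1) ⟩
      suc s                         ∎) (<⇒≱ (m≤n+m (suc (suc s)) 1))
    where open ≤-Reasoning
  parse (true ∷ b ∷ r)     {s} (suc c) S (s≤s le) lt =
    let (ds , r′ , eq) = parse r c (suffix-tail (suffix-tail S)) (≤-trans (n≤1+n _) le)
          (≤-trans (≤-reflexive (cong suc (sym (trans (iter-front adv s c) (cong (λ s → iter adv s c) (adv-true (first-bit S))))))) lt)
    in b ∷ ds , r′ , cong (λ r → true ∷ b ∷ r) eq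

  parse-all : ∀ m {s r} → Suffix s r → iter numEnd s m ≡ L → ∃ λ dss → length dss ≡ m × r ≡ concat (map delimit dss)
  parse-all zero {s} {[]} S eq = [] , refl , refl
  parse-all zero {s} {b ∷ r} S refl = contradiction (trans (sym (ends S)) (+-suc s (length r))) (<⇒≢ (s≤s (m≤m+n s (length r))))
  parse-all (suc m) {s} {r} S eq =
    let eq′ = trans (sym (iter-front numEnd s m)) eq
        (ds , r′ , r≡) = parse r L S (≤-trans (m≤n+m (length r) s) (≤-reflexive (ends S)))
          (≤-trans (iter-≥ numEnd-≥ (numEnd s) m) (≤-reflexive eq′))
        (dss , len , r′≡) = parse-all m (after-number ds (subst (Suffix s) r≡ S)) eq′
    in ds ∷ dss , cong suc len , trans r≡ (cong (delimit ds ++_) r′≡)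

  same-sound : ∀ {a b} → sameᵇ a b ≡ true → a ≡ b
  same-sound {true}  {true}  h = refl
  same-sound {false} {false} h = refl

  -- Either the scan stopped at a 0, or it reached L, where the default `false` is read.
  X-n : X n ≡ false
  X-n = [ (λ n≡L → trans (cong X n≡L) (trans (X≗ L) (nth-beyond x ≤-refl))) , id ]′ (proj₂ (scan-spec X L))

  -- A certificate proves nothing about a word that encodes no instance, so such words must be
  -- refused. The graph is read off the adjacency bits; the rest splits into exactly 1 + k n numbers
  -- because their ends add up to L.
  decodable : wellFormed ≡ true → graphOK ≡ true → ∃ λ I → encodeFair {k} I ≡ x
  decodable wf gr = fromNumbers (map number dss) (trans (Listₚ.length-map number dss) len)
    (trans (encodes dss) (sym drop≡))
    where
    end≡ : start (suc (k * n)) ≡ L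
    end≡ = ≡ᵇ-true {start (suc (k * n))} {L} wf
    base≤L : base ≤ L
    base≤L = ≤-trans (iter-≥ numEnd-≥ base (suc (k * n))) (≤-reflexive end≡)
    tail-suffix : Suffix base (drop base x)
    tail-suffix = record
      { reads = λ i → trans (X≗ (base + i)) (nth-drop false base x i)
      ; ends = trans (cong (base +_) (Listₚ.length-drop base x)) (m+[n∸m]≡n base≤L) }
    parsed = parse-all (suc (k * n)) tail-suffix end≡
    dss = proj₁ parsed
    len = proj₁ (proj₂ parsed)
    drop≡ = proj₂ (proj₂ parsed)
    number : Bits → ℕ
    number ds = ℕᵇ.toℕ (undigits ds)
    encodes : ∀ dss → encodeNumbers (map number dss) ≡ concat (map delimit dss)
    encodes []         = refl
    encodes (ds ∷ dss) = cong₂ _++_ (encode-undigits ds) (encodes dss)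
    adj-ok : ∀ {u} → u < n → not (adj u u) ≡ true × (∀ {v} → v < n → adj u v ≡ adj v u)
    adj-ok {u} u<n = let (l , s) = ∧-true {not (adj u u)} (allTo-elim n gr u<n) in
      l , λ v<n → same-sound (allTo-elim n s v<n)
    G : Graph n
    G = record
      { adjacent = λ u v → adj (toℕ u) (toℕ v)
      ; symmetric = λ u v → proj₂ (adj-ok (Finₚ.toℕ<n u)) (Finₚ.toℕ<n v)
      ; loopless = λ v → not-true (proj₁ (adj-ok (Finₚ.toℕ<n v))) }
    graph≡ : encodeGraph G ≡ take base x
    graph≡ = begin
      replicate n true ++ false ∷ concat (tabulate {n = n} λ u → tabulate {n = n} λ v → X (n + suc (toℕ u * n + toℕ v)))
        ≡⟨ cong₂ (λ a b → a ++ false ∷ b) (trues n (proj₁ (scan-spec X L))) (concat-blocks (λ i → X (n + suc i)) n n) ⟩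
      applyUpTo X n ++ false ∷ applyUpTo (λ i → X (n + suc i)) (n * n)
        ≡⟨ cong (λ b → applyUpTo X n ++ b ∷ applyUpTo (λ i → X (n + suc i)) (n * n)) (trans (sym X-n) (cong X (sym (+-identityʳ n)))) ⟩
      applyUpTo X n ++ applyUpTo (λ i → X (n + i)) (suc (n * n))
        ≡⟨ applyUpTo-+ X n (suc (n * n)) ⟨
      applyUpTo X base
        ≡⟨ applyUpTo-cong base (λ {i} _ → X≗ i) ⟩
      applyUpTo (nth false x) base
        ≡⟨ applyUpTo-nth false x base≤L ⟩
      take base x
        ∎
      where
      open ≡-Reasoning
      trues : ∀ m {f : ℕ → Bool} → (∀ {i} → i < m → f i ≡ true) → replicate m true ≡ applyUpTo f m
      trues zero    h = refl
      trues (suc m) h = cong₂ _∷_ (sym (h (s≤s z≤n))) (trues m (h ∘ s≤s))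
    fromNumbers : ∀ ns → length ns ≡ suc (k * n) → encodeNumbers ns ≡ drop base x → ∃ λ I → encodeFair {k} I ≡ x
    fromNumbers (q ∷ ps) len eq =
      fairInstance G (λ j v → nth 0 ps (toℕ j * n + toℕ v)) q ,
      trans (cong₂ _++_ graph≡ (trans (cong (λ ps → encodeNumbers (q ∷ ps)) profits≡) eq)) (Listₚ.take++drop≡id base x)
      where
      len′ : length ps ≡ k * n
      len′ = suc-injective len
      profits≡ : concat (tabulate {n = k} λ j → tabulate {n = n} λ v → nth 0 ps (toℕ j * n + toℕ v)) ≡ ps
      profits≡ = trans (concat-blocks (nth 0 ps) k n) (trans (applyUpTo-nth 0 ps (≤-reflexive (sym len′)))
        (Listₚ.take-all (k * n) ps (≤-reflexive len′)))

  Coloured : FairInstance k → Set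
  Coloured I = Σ (PartialColoring k (FairInstance.G I)) λ C →
    ∀ j → FairInstance.q I ≤ profit (FairInstance.p I j) (PartialColoring.X C j)

  Solved : FairInstance k → Set
  Solved I = Bipartite (FairInstance.G I) × Coloured I ×
    (strict ≡ true → All (_≤ L) (DecisionProblem.numbers (FairDivision k) I))

  -- The check depends on the word only, so its success applies to every instance with this encoding
  -- at once. This takes the place of injectivity of the encoding.
  sound : check ≡ true → ∀ I → encodeFair I ≡ x → Solved I
  sound ok I enc = by-size (vertices I enc) (FairInstance.G I) (FairInstance.p I) (FairInstance.q I) enc
    where
    by-size : ∀ {n₀} → n₀ ≡ n → (G : Graph n₀) (p : Fin k → Fin n₀ → ℕ) (q : ℕ) →
      let I = fairInstance G p q in encodeFair I ≡ x → Solved I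
    -- Matching turns the number of vertices of the instance into the n found in the word, so that
    -- the classes listed by Y become subsets of its vertices.
    by-size refl G p q enc =
      let (_ , h₁) = ∧-true {wellFormed} ok
          (_ , h₂) = ∧-true {graphOK} h₁
          (bip , h₃) = ∧-true {bipartiteOK} h₂
          (ind , h₄) = ∧-true {independentOK} h₃
          (dis , h₅) = ∧-true {disjointOK} h₄
          (fair , bound) = ∧-true {fairOK} h₅
      in (A , Equivalence.to bipartite⇔ bip) ,
         (record { X = C ; independent = Equivalence.to independent⇔ ind ; disjoint = Equivalence.to disjoint⇔ dis } ,
          Equivalence.to fair⇔ fair) ,
         λ st → Equivalence.to bounded⇔ (⇒-elim strict bound st)
      where
      A : Subset n
      A = Vec.tabulate λ v → Y (toℕ v)
      C : Fin k → Subset n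
      C j = Vec.tabulate λ v → inClass (toℕ j) (toℕ v)
      open Matched G p q enc
      open Classes A C (λ v → sym (Vecₚ.lookup∘tabulate (λ v → Y (toℕ v)) v))
        (λ j v → sym (Vecₚ.lookup∘tabulate (λ v → inClass (toℕ j) (toℕ v)) v))

  rows : ∀ {m} → Subset m → (Fin k → Subset m) → Fin (suc k) → Bits
  rows A C zero    = Vec.toList A
  rows A C (suc j) = Vec.toList (C j)

  certificate : ∀ {m} → Subset m → (Fin k → Subset m) → Bits
  certificate A C = concat (tabulate (rows A C))

  length-rows : ∀ {m} (A : Subset m) C i → length (rows A C i) ≡ m
  length-rows A C zero    = Vecₚ.length-toList A
  length-rows A C (suc j) = Vecₚ.length-toList (C j)

  complete : ∀ I → encodeFair I ≡ x → (S : Solved I) →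
    (∀ i → Y i ≡ nth false (certificate (proj₁ (proj₁ S)) (PartialColoring.X (proj₁ (proj₁ (proj₂ S))))) i) → check ≡ true
  complete I enc S = by-size (vertices I enc) (FairInstance.G I) (FairInstance.p I) (FairInstance.q I) enc S
    where
    by-size : ∀ {n₀} → n₀ ≡ n → (G : Graph n₀) (p : Fin k → Fin n₀ → ℕ) (q : ℕ) →
      let I = fairInstance G p q in encodeFair I ≡ x → (S : Solved I) →
      (∀ i → Y i ≡ nth false (certificate (proj₁ (proj₁ S)) (PartialColoring.X (proj₁ (proj₁ (proj₂ S))))) i) → check ≡ true
    by-size refl G p q enc ((A , bip) , (C , fair) , bound) Y≡ =
      ∧-intro wellFormed≡ (∧-intro graph≡ (∧-intro (Equivalence.from bipartite⇔ bip)
        (∧-intro (Equivalence.from independent⇔ (PartialColoring.independent C))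
        (∧-intro (Equivalence.from disjoint⇔ (PartialColoring.disjoint C)) (∧-intro (Equivalence.from fair⇔ fair)
        (⇒-intro λ st → Equivalence.from bounded⇔ (bound st)))))))
      where
      classes = PartialColoring.X C
      row : ∀ i v → Y (toℕ i * n + toℕ v) ≡ nth false (rows A classes i) (toℕ v)
      row i v = trans (Y≡ _) (nth-concat (rows A classes) (length-rows A classes) i (Finₚ.toℕ<n v))
      open Matched G p q enc
      open Classes A classes (λ v → trans (row zero v) (nth-toList false A v)) (λ j v → trans (row (suc j) v) (nth-toList false (classes j) v))

-- Membership in NP

module Pairing (x y : Bits) where

  z : Bits
  z = ⟨ x , y ⟩

  in-x : ∀ {e} → e < suc (2 * length x) → nth false z e ≡ delimitBit x e
  in-x {e} lt = trans (nth-++ˡ (delimit x) y (subst (e <_) (sym (length-delimit x)) lt)) (nth-delimit x e)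

  delimitBit-even : ∀ i → delimitBit x (2 * i) ≡ (i <ᵇ length x)
  delimitBit-even i = trans (if-false (odd-double i)) (cong (_<ᵇ length x) (half-double i))

  delimitBit-odd : ∀ i → delimitBit x (suc (2 * i)) ≡ nth false x i
  delimitBit-odd i = trans (if-true (cong not (odd-double i))) (cong (nth false x) (half-double′ i))

  pair-length : lengthOf z ≡ length x
  pair-length = scan-unique (λ i → nth false z (2 * i)) (length x) (length z)
    (λ {i} lt → trans (in-x (m<n⇒m<1+n (*-monoʳ-< 2 lt))) (trans (delimitBit-even i) (<ᵇ-true lt)))
    (trans (in-x ≤-refl) (trans (delimitBit-even (length x)) (<ᵇ-false {length x} ≤-refl)))
    (≤-trans (≤-trans (≤-trans (m≤m+n (length x) _) (n≤1+n _)) (≤-reflexive (sym (length-delimit x))))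
      (≤-trans (m≤m+n _ (length y)) (≤-reflexive (sym (Listₚ.length-++ (delimit x))))))

  first≡ : ∀ i → firstPart z i ≡ nth false x i
  first≡ i = trans (cong (λ l → (i <ᵇ l) ∧ nth false z (suc (2 * i))) pair-length) (by-case (i <? length x))
    where
    by-case : Dec (i < length x) → ((i <ᵇ length x) ∧ nth false z (suc (2 * i))) ≡ nth false x i
    by-case (yes lt) = trans (cong (_∧ nth false z (suc (2 * i))) (<ᵇ-true lt))
      (trans (in-x (s≤s (*-monoʳ-< 2 lt))) (delimitBit-odd i))
    by-case (no  ge) = trans (cong (_∧ nth false z (suc (2 * i))) (<ᵇ-false (≮⇒≥ ge))) (sym (nth-beyond x (≮⇒≥ ge)))

  second≡ : ∀ i → secondPart z i ≡ nth false y i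
  second≡ i = trans (cong (λ l → nth false z (l + i)) (trans (cong (λ l → suc (2 * l)) pair-length) (sym (length-delimit x))))
    (nth-++ʳ (delimit x) y i)

-- A common form of the two languages. With `strict` true the numbers are bounded by the length of
-- the word, which is the bound given by the polynomial `0 ∷ 1 ∷ []`.
Restricted : ∀ k → Bool → Language
Restricted k strict x = ∃ λ I → encodeFair {k} I ≡ x × Bipartite (FairInstance.G I) ×
  DecisionProblem.Yes (FairDivision k) I × (strict ≡ true → All (_≤ length x) (DecisionProblem.numbers (FairDivision k) I))

module _ (k′ : ℕ) (strict : Bool) where

  private
    k : ℕ
    k = 2 + k′

  module At (x y : Bits) = Correctness k strict x (firstPart ⟨ x , y ⟩) (Pairing.first≡ x y)
    (secondPart ⟨ x , y ⟩)

  check≡ : ∀ x y → verifier k strict ⟨ x , y ⟩ ≡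
    Check.check k strict (firstPart ⟨ x , y ⟩) (length x) (secondPart ⟨ x , y ⟩)
  check≡ x y = cong (λ l → Check.check k strict (firstPart ⟨ x , y ⟩) l (secondPart ⟨ x , y ⟩))
    (Pairing.pair-length x y)

  verified⇒ : ∀ {x y} → verifier k strict ⟨ x , y ⟩ ≡ true → ∀ I → encodeFair I ≡ x →
    Bipartite (FairInstance.G I) × DecisionProblem.Yes (FairDivision k) I ×
    (strict ≡ true → All (_≤ length x) (DecisionProblem.numbers (FairDivision k) I))
  verified⇒ {x} {y} ok I enc =
    let (bip , (C , fair) , bound) = At.sound x y (trans (sym (check≡ x y)) ok) I enc in
    bip , (C , minimum-glb (λ j → profit (FairInstance.p I j) (PartialColoring.X C j)) fair) , bound

  -- The certificate has k + 1 rows of n bits, one for the side of the bipartition and one for each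
  -- class, and n is at most the length of x.
  ⇒verified : ∀ {x} → Restricted k strict x → ∃ λ y → length y ≤ suc k * length x × verifier k strict ⟨ x , y ⟩ ≡ true
  ⇒verified {x} (I , enc , (A , bip) , (C , fair) , bound) = y , y≤ , trans (check≡ x y)
    (At.complete x y I enc ((A , bip) , (C , minimum-lower (λ j → profit (FairInstance.p I j) (PartialColoring.X C j)) fair) , bound)
      (Pairing.second≡ x y))
    where
    classes = PartialColoring.X C
    y = At.certificate x [] A classes
    y≤ : length y ≤ suc k * length x
    y≤ = ≤-trans (≤-reflexive (length-concat-tabulate (At.rows x [] A classes) (At.length-rows x [] A classes)))
      (*-monoʳ-≤ (suc k) (≤-trans (≤-reflexive (At.vertices x [] I enc)) (At.n≤L x [])))

  restricted-InNP : InNP (Restricted k strict)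
  restricted-InNP = verifier k strict , verifier-PolyTime k strict , (0 ∷ suc k ∷ []) , λ x → mk⇔
    (λ h → let (y , y≤ , ok) = ⇒verified h in y , ≤-trans y≤ (≤-reflexive (lemma (suc k) (length x))) , ok)
    (λ (y , _ , ok) →
      let (wf , h₁) = ∧-true {Check.wellFormed k strict _ (length x) (secondPart ⟨ x , y ⟩)} (trans (sym (check≡ x y)) ok)
          (gr , _) = ∧-true {Check.graphOK k strict _ (length x) (secondPart ⟨ x , y ⟩)} h₁
          (I , enc) = At.decodable x y wf gr
      in I , enc , verified⇒ {x} {y} ok I enc)
    where
    lemma : ∀ a b → a * b ≡ b * (a + b * 0)
    lemma = solve-∀

InNP-resp : ∀ {L L′ : Language} → (∀ x → L x ⇔ L′ x) → InNP L → InNP L′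
InNP-resp eq (verify , pt , p , spec) = verify , pt , p , λ x → mk⇔
  (λ h → Equivalence.to (spec x) (Equivalence.from (eq x) h))
  (λ h → Equivalence.to (eq x) (Equivalence.from (spec x) h))

all-≤ : ∀ {a b l} → a ≡ b → All (_≤ a) l → All (_≤ b) l
all-≤ refl h = h

module Membership (k′ : ℕ) where

  private
    k = 2 + k′

  plain : InNP (language (BipartiteFairDivision k))
  plain = InNP-resp (λ x → mk⇔
    (λ (I , enc , bip , yes′ , _) → (I , bip) , enc , yes′)
    (λ ((I , bip) , enc , yes′) → I , enc , bip , yes′ , λ ())) (restricted-InNP k′ false)

  bounded : InNP (language (restrict (BipartiteFairDivision k) (NumbersBounded (BipartiteFairDivision k) (0 ∷ 1 ∷ []))))
  bounded = InNP-resp (λ x → mk⇔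
    (λ (I , enc , bip , yes′ , bd) → ((I , bip) , all-≤ (sym (trans (eval-id _) (cong length enc))) (bd refl)) , enc , yes′)
    (λ (((I , bip) , bd) , enc , yes′) → I , enc , bip , yes′ , λ _ → all-≤ (trans (eval-id _) (cong length enc)) bd))
    (restricted-InNP k′ true)

-- Hardness

module Hardness (k′ : ℕ) {L : Language} (verify : Bits → Bool) (M : TM) (r p : Polynomial)
  (computes : ∀ w → ∃ λ c → HaltsWithin M (eval r (length w)) (initial M w) c × output M c ≡ verify w ∷ [])
  (certified : ∀ x → L x ⇔ (∃ λ y → length y ≤ eval p (length x) × verify ⟨ x , y ⟩ ≡ true)) where

  private
    k = 2 + k′

  open Tableau M r p
  open CliqueReduction N K compat k′ NC KC compatB

  reduce : Bits → Bits
  reduce x = encodeFair (I x)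

  yes⇔ : ∀ x → L x ⇔ C.Yes x
  yes⇔ x = mk⇔
    (λ h → C.clique⇒yes x (proj₂ (Equivalence.from clique⇔certificate (Equivalence.to (certified x) h))))
    (λ h → Equivalence.from (certified x) (Equivalence.to clique⇔certificate (C.yes⇒clique x h)))
    where open Correct M r p verify computes x using (clique⇔certificate)

  -- Instances with equal encodings have the same answer, as the verifier sees
  -- only the encoding.
  same-answer : ∀ I₁ I₂ → encodeFair {k} I₁ ≡ encodeFair I₂ → Bipartite (FairInstance.G I₁) →
    DecisionProblem.Yes (FairDivision k) I₁ → DecisionProblem.Yes (FairDivision k) I₂
  same-answer I₁ I₂ enc bip yes′ =
    let (y , _ , ok) = ⇒verified k′ false (I₁ , enc , bip , yes′ , λ ())
    in proj₁ (proj₂ (verified⇒ k′ false {encodeFair I₂} {y} ok I₂ refl))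

  reduce-PolyTime : PolyTime reduce
  reduce-PolyTime = out⇒PolyTime encodeO

  plain : L ≤ᵖ language (BipartiteFairDivision k)
  plain = reduce , reduce-PolyTime , λ x → mk⇔
    (λ h → (I x , C.bipartite x) , refl , Equivalence.to (yes⇔ x) h)
    (λ ((I′ , bip) , enc , yes′) → Equivalence.from (yes⇔ x) (same-answer I′ (I x) enc bip yes′))

  -- The same reduction serves again, since the instances it produces have small numbers.
  bounded : L ≤ᵖ language (restrict (BipartiteFairDivision k) (NumbersBounded (BipartiteFairDivision k) (0 ∷ 1 ∷ [])))
  bounded = reduce , reduce-PolyTime , λ x → mk⇔
    (λ h → ((I x , C.bipartite x) , numbers≤ x (Correct.K≤N M r p verify computes x)) , refl , Equivalence.to (yes⇔ x) h)
    (λ (((I′ , bip) , _) , enc , yes′) → Equivalence.from (yes⇔ x) (same-answer I′ (I x) enc bip yes′))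

theorem3 : (k : ℕ) → 2 ≤ k → StronglyNPComplete (BipartiteFairDivision k)
theorem3 (suc (suc k′)) (s≤s (s≤s _)) =
  (Membership.plain k′ , λ L (verify , (M , r , computes) , p , certified) →
    Hardness.plain k′ verify M r p computes certified) ,
  (0 ∷ 1 ∷ []) ,
  (Membership.bounded k′ , λ L (verify , (M , r , computes) , p , certified) →
    Hardness.bounded k′ verify M r p computes certified)
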